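{- Let $G$ be a graph on $n$ nodes where each node has a unique $b$-bit identifier with $b = O(\log n)$. There is a deterministic distributed algorithm that computes a network decomposition of $G$ with $O(\log n)$ colors and weak-diameter $O(\log^2 n)$, in $O(\log^5 n)$ rounds of the $\mathsf{CONGEST}$ model with $\Theta(\log n)$-bit messages. Moreover, for each cluster $\mathcal{C}$ of vertices in the output network decomposition, the algorithm provides a Steiner tree $T_{\mathcal{C}}$ with radius $O(\log^2 n)$ in $G$ whose set of terminal nodes is equal to $\mathcal{C}$, and each vertex of $G$ is in $O(\log n)$ Steiner trees of any given color out of the $O(\log n)$ color classes.
   Context: $\mathsf{CONGEST}$ model: the network is the graph $G$; there is a processor at each node; computation proceeds in synchronous rounds, and per round each node can send one message of the stated bit-size to each neighbor. Nodes initially know only their own identifier and neighbors (and $n$ up to a polynomial). The round complexity is the number of rounds until all nodes finish; each node must know its own part of the output (its cluster and color, and its part of the Steiner trees). A network decomposition with $C$ colors and weak-diameter $D$ is a partition of $V(G)$ into disjoint clusters, each cluster assigned one of $C$ colors, such that clusters joined by an edge of $G$ have different colors, and any two vertices of the same cluster are at distance at most $D$ in $G$ (distance measured in $G$, not in the cluster). A Steiner tree for a cluster $\mathcal{C}$ is a subtree of $G$ containing all vertices of $\mathcal{C}$ (its terminal nodes) and possibly other vertices (non-terminal nodes). -}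

module Defs where

open import Level using (0ℓ)
open import Data.Bool.Base using (Bool; if_then_else_)
import Data.Bool.Properties as Bool
open import Data.Fin.Base using (Fin)
open import Data.Fin.Properties using (any?)
open import Data.List.Base using (List; []; _∷_; _++_; [_]; length)
open import Data.List.Membership.Propositional using (_∈_)
open import Data.List.Relation.Unary.All using (All)
open import Data.List.Relation.Unary.Linked using (Linked)
open import Data.List.Relation.Unary.Unique.Propositional using (Unique)
open import Data.Maybe.Base using (Maybe; just; nothing; is-just)
open import Data.Nat.Base using (ℕ; zero; suc; _≤_; _<_)
open import Data.Nat.Logarithm using (⌊log₂_⌋)
open import Data.Product.Base using (∃; _×_; _,_)
open import Data.Vec.Base using (Vec)
import Data.Vec.Properties as Vec
open import Relation.Binary.Construct.Closure.ReflexiveTransitive using (Star)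
open import Relation.Binary.Core using (Rel)
open import Relation.Binary.Definitions
  using (Decidable; DecidableEquality; Symmetric)
open import Relation.Binary.PropositionalEquality.Core using (_≡_; _≢_)
open import Relation.Nullary.Decidable using (does; yes; no; _×-dec_)
open import Relation.Nullary.Negation.Core using (¬_)
open import Relation.Unary using (Pred)

private
  variable
    n b : ℕ

-- The additive 1 keeps the logarithm positive, so that f n ≤ K * log n ^ p for
-- all n expresses f = O(log^p n) with no exception for n ≤ 1.
log : ℕ → ℕ
log n = suc ⌊log₂ n ⌋

record Graph (n : ℕ) : Set₁ where
  field
    Adj    : Rel (Fin n) 0ℓ
    adj?   : Decidable Adj
    sym    : Symmetric Adj
    irrefl : ∀ {v} → ¬ Adj v v

-- There is a walk from u to v of length at most d, that is, the distance
-- between u and v in the graph with edge relation E is at most d.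
data Within {V : Set} (E : Rel V 0ℓ) : ℕ → V → V → Set where
  stop : ∀ {d u} → Within E d u u
  step : ∀ {d u w v} → E u w → Within E d w v → Within E (suc d) u v

Acyclic : {V : Set} → Rel V 0ℓ → Set
Acyclic E = ∀ x ys → 2 ≤ length ys → Unique (x ∷ ys) →
            ¬ Linked E (x ∷ ys ++ [ x ])

record IsSubtree (G : Graph n) (Vertex : Pred (Fin n) 0ℓ)
                 (Edge : Rel (Fin n) 0ℓ) : Set where
  open Graph G
  field
    edges     : ∀ {u v} → Edge u v → Adj u v
    endpoints : ∀ {u v} → Edge u v → Vertex u × Vertex v
    symmetric : Symmetric Edge
    nonempty  : ∃ Vertex
    connected : ∀ {u v} → Vertex u → Vertex v → Star Edge u v
    acyclic   : Acyclic Edge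

-- The radius is measured along the edges of the tree itself, which also bounds
-- the corresponding distances in any graph containing it.
Radius≤ : {V : Set} → ℕ → Pred V 0ℓ → Rel V 0ℓ → Set
Radius≤ r Vertex Edge =
  ∃ λ c → Vertex c × (∀ {v} → Vertex v → Within Edge r c v)

AtMost : {A : Set} → ℕ → Pred A 0ℓ → Set
AtMost m P = ∀ xs → Unique xs → All P xs → length xs ≤ m

Id : ℕ → Set
Id b = Vec Bool b

_≟ᴵ_ : DecidableEquality (Id b)
_≟ᴵ_ = Vec.≡-dec Bool._≟_

-- The program run by a node. Neighbours are addressed by identifier: `init`
-- gets the node's identifier and the set of identifiers of its neighbours,
-- `send s i` is the message for neighbour i, and `receive` gets the
-- messages of one round indexed by the sender's identifier. The vertex names
-- in Fin n are never visible to a node. `nothing` is silence.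
-- A node has finished as soon as its state has an output.
record Algorithm (b : ℕ) (Out : Set) : Set₁ where
  field
    bandwidth : ℕ

  Message : Set
  Message = Vec Bool bandwidth

  field
    State   : Set
    init    : Id b → (Id b → Bool) → State
    send    : State → Id b → Maybe Message
    receive : State → (Id b → Maybe Message) → State
    output  : State → Maybe Out

module Execution {Out : Set} (A : Algorithm b Out)
                 (G : Graph n) (ident : Fin n → Id b) where
  open Algorithm A
  open Graph G

  Configuration : Set
  Configuration = Fin n → State

  start : Configuration
  start v = init (ident v) λ i → does (any? λ u → adj? v u ×-dec (ident u ≟ᴵ i))

  finished : State → Bool
  finished s = is-just (output s)

  inbox : Configuration → Fin n → Id b → Maybe Message
  inbox s v i with any? (λ u → adj? v u ×-dec (ident u ≟ᴵ i))
  ... | yes (u , _) = if finished (s u) then nothing else send (s u) (ident v)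
  ... | no _        = nothing

  round : Configuration → Configuration
  round s v = if finished (s v) then s v else receive (s v) (inbox s v)

  after : ℕ → Configuration
  after zero    = start
  after (suc t) = round (after t)

  AllFinish : ℕ → (Fin n → Out) → Set
  AllFinish t out = ∀ v → output (after t v) ≡ just (out v)

-- What a node knows at the end: the name of its cluster, the colour of its
-- cluster, and, for every Steiner tree containing the node, the name of the
-- cluster of that tree with the identifiers of the node's neighbours in it.
record Output (b : ℕ) : Set where
  field
    cluster : ℕ
    colour  : ℕ
    trees   : List (ℕ × List (Id b))

module Decomposition (G : Graph n) (ident : Fin n → Id b)
                     (out : Fin n → Output b) where
  open Graph G

  cluster colour : Fin n → ℕ
  cluster v = Output.cluster (out v)
  colour  v = Output.colour (out v)

  Terminal : ℕ → Pred (Fin n) 0ℓ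
  Terminal c v = cluster v ≡ c

  TreeVertex : ℕ → Pred (Fin n) 0ℓ
  TreeVertex c v = ∃ λ is → (c , is) ∈ Output.trees (out v)

  TreeEdge : ℕ → Rel (Fin n) 0ℓ
  TreeEdge c u v =
    ∃ λ is → (c , is) ∈ Output.trees (out u) × ident v ∈ is

  record IsNetworkDecomposition (colours diameter : ℕ) : Set where
    field
      colour-bound   : ∀ v → colour v < colours
      cluster-colour : ∀ {u v} → cluster u ≡ cluster v → colour u ≡ colour v
      proper         : ∀ {u v} → Adj u v → cluster u ≢ cluster v →
                       colour u ≢ colour v
      weak-diameter  : ∀ {u v} → cluster u ≡ cluster v →
                       Within Adj diameter u v

  record IsSteinerTree (c radius : ℕ) : Set where
    field
      subtree      : IsSubtree G (TreeVertex c) (TreeEdge c)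
      terminals    : ∀ {v} → Terminal c v → TreeVertex c v
      radius-bound : Radius≤ radius (TreeVertex c) (TreeEdge c)

  record HasSteinerTrees (radius multiplicity : ℕ) : Set where
    field
      tree               : ∀ v → IsSteinerTree (cluster v) radius
      -- Trees are listed only for clusters that occur in the decomposition.
      only-clusters      : ∀ {c v} → TreeVertex c v → ∃ (Terminal c)
      multiplicity-bound : ∀ v κ → AtMost multiplicity λ c →
                           (∃ λ u → Terminal c u × colour u ≡ κ) × TreeVertex c v

{-# OPTIONS --safe #-}
-- One colour class is found by letting clusters, at first single vertices,
-- compete. Write key = 2 level + (the bit of the cluster's identifier at its
-- level). In every step a vertex next to an unstalled cluster of smaller key asks
-- the smallest such cluster for admission. A cluster whose applicants number at
-- least a 1/M fraction of its tokens admits them all and gains a token for each;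
-- otherwise they die, the cluster loses half of its tokens, and it stalls until
-- it rises one level at the end of the phase of M steps. Adjacent clusters always
-- agree on the bits below the smaller of their levels.
--   A phase either raises the level of a cluster or doubles its tokens, so
-- O(b) phases bring every level to b, when adjacent clusters coincide. Since a
-- key falls with every change of cluster and rises by at most 3 per phase, a
-- vertex lies in O(b) trees and O(b) tokens per vertex are created, whence at
-- most half of the vertices die for M = O(b). Trees are no higher than the number
-- of steps, O(b^2). The dead are left to the next of the b + 1 colours.
--   Each step counts applicants along the trees, in O(b^2) rounds because the
-- counts are sent bit by bit. Identifiers are distinct, so b is at least log n.
module Submission where

open import Defs
open import Data.Bool.Base using (Bool; true; false; if_then_else_; not; _∧_; _∨_; T)
open import Data.Bool.Properties using (T?; T-≡; T-∨; ∨-zeroʳ)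
open import Data.Fin.Base using (Fin; fromℕ<)
open import Data.Fin.Properties using (any?; injective⇒≤; fromℕ<-injective)
open import Data.List.Base using (List; []; _∷_; _++_; [_]; length; map; concatMap; filter; upTo; replicate)
open import Data.List.Membership.Propositional using (_∈_; find; lose)
open import Data.List.Membership.Propositional.Properties
open import Data.List.Properties using (length-++; length-map; length-replicate; length-upTo)
open import Data.List.Relation.Unary.All as All using (All; []; _∷_)
open import Data.List.Relation.Unary.AllPairs using ([]; _∷_)
open import Data.List.Relation.Unary.Any using (here; there)
open import Data.List.Relation.Unary.Linked using (Linked; []; _∷_)
open import Data.List.Relation.Unary.Unique.Propositional using (Unique)
open import Data.Maybe.Base as Maybe using (Maybe; just; nothing; maybe′; is-just; is-nothing)
open import Data.Maybe.Properties using (just-injective)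
open import Data.Nat.Base
open import Data.Nat.Divisibility using (_∣_; divides; m∣m*n)
open import Data.Nat.DivMod
  using (%-distribˡ-+; n%1≡0; m%n<n; m<n⇒m%n≡m; m≡m%n+[m/n]*n; m%[n*o]/o≡m/o%n; m∣n⇒o%n%m≡o%m)
open import Data.Nat.Logarithm using (⌊log₂_⌋; ⌊log₂⌋-mono-≤; ⌊log₂[2^n]⌋≡n)
open import Data.Nat.Properties
open import Data.Nat.Tactic.RingSolver using (solve-∀)
open import Data.Product.Base using (∃; _×_; _,_; proj₁; proj₂)
open import Data.Product.Properties using (,-injectiveˡ)
open import Data.Sum.Base using (_⊎_; inj₁; inj₂)
open import Data.Unit.Base using (tt)
open import Data.Vec.Base as Vec using (Vec; []; _∷_)
open import Function.Base using (_∘_; case_of_)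
open import Function.Bundles using (Equivalence)
open import Function.Definitions using (Injective)
open import Level using (0ℓ)
open import Relation.Binary.Construct.Closure.ReflexiveTransitive using (Star; ε; _◅_)
open import Relation.Binary.Core using (Rel)
open import Relation.Binary.PropositionalEquality hiding ([_])
open import Relation.Nullary using (¬_; Dec; yes; no; does; _×-dec_; contradiction)
open import Relation.Nullary.Decidable using (dec-true; dec-false)

-- Progress is measured in tokens, not in members, because a cluster may lose members to neighbours
-- of smaller key while its tokens stay. A cluster with `t` tokens at level `l` satisfies
-- `2 ^ i ≤ t * 4 ^ l` when phase `i` begins: `M` admissions multiply `t` by at least
-- `(1 + 1/M) ^ M ≥ 2`, while a stall halves `t` but the rise that follows gains the factor 4.
-- Stalling makes the rise safe. Once its applicants are dead, a cluster has no living neighbour of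
-- larger key, and keys only fall within a phase. So adjacent clusters that rise together have equal
-- keys, hence the same level and the same bit there. Tokens and deaths are paid from one account. A
-- token is worth three units and a dead vertex costs `M`; an admission is paid by the fall of a
-- key, a death by the halved tokens. At most `3 * (3 * R + 2)` units per vertex are supplied in `R`
-- phases, so `M = 6 * (3 * R + 2)` lets at most half of the vertices die. The number
-- `R = 8 * (b + 1)` of phases makes `2 ^ R` exceed what all tokens together allow at a level below
-- `b`.

private
  variable
    b m : ℕ

-- Sums over all identifiers

⟦_⟧ : Bool → ℕ
⟦ x ⟧ = if x then 1 else 0

⟦⟧≤1 : ∀ x → ⟦ x ⟧ ≤ 1
⟦⟧≤1 true  = ≤-refl
⟦⟧≤1 false = z≤n

_==_ : Id b → Id b → Bool
v == w = does (v ≟ᴵ w)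

==-refl : (v : Id b) → (v == v) ≡ true
==-refl v with v ≟ᴵ v
... | yes _ = refl
... | no v≢v = contradiction refl v≢v

==⇒≡ : {v w : Id b} → (v == w) ≡ true → v ≡ w
==⇒≡ {v = v} {w} eq with v ≟ᴵ w
... | yes v≡w = v≡w

≢⇒== : {v w : Id b} → v ≢ w → (v == w) ≡ false
≢⇒== {v = v} {w} v≢w with v ≟ᴵ w
... | yes v≡w = contradiction v≡w v≢w
... | no _ = refl

isEq : Maybe (Id b) → Id b → Bool
isEq nothing  _ = false
isEq (just v) w = v == w

∑ : (Id b → ℕ) → ℕ
∑ {zero}  f = f []
∑ {suc b} f = ∑ (λ v → f (false ∷ v)) + ∑ (λ v → f (true ∷ v))

∑-cong : {f g : Id b → ℕ} → (∀ v → f v ≡ g v) → ∑ f ≡ ∑ g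
∑-cong {zero}  f≗g = f≗g []
∑-cong {suc b} f≗g = cong₂ _+_ (∑-cong λ v → f≗g (false ∷ v)) (∑-cong λ v → f≗g (true ∷ v))

∑-mono : {f g : Id b → ℕ} → (∀ v → f v ≤ g v) → ∑ f ≤ ∑ g
∑-mono {zero}  f≤g = f≤g []
∑-mono {suc b} f≤g = +-mono-≤ (∑-mono λ v → f≤g (false ∷ v)) (∑-mono λ v → f≤g (true ∷ v))

+-interchange : ∀ m n o p → (m + n) + (o + p) ≡ (m + o) + (n + p)
+-interchange = solve-∀

∑-+ : (f g : Id b → ℕ) → ∑ (λ v → f v + g v) ≡ ∑ f + ∑ g
∑-+ {zero}  f g = refl
∑-+ {suc b} f g =
  trans (cong₂ _+_ (∑-+ (λ v → f (false ∷ v)) (λ v → g (false ∷ v)))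
                   (∑-+ (λ v → f (true ∷ v)) (λ v → g (true ∷ v))))
        (+-interchange (∑ λ v → f (false ∷ v)) (∑ λ v → g (false ∷ v)) _ _)

∑-* : (k : ℕ) (f : Id b → ℕ) → ∑ (λ v → k * f v) ≡ k * ∑ f
∑-* {zero}  k f = refl
∑-* {suc b} k f =
  trans (cong₂ _+_ (∑-* k (λ v → f (false ∷ v))) (∑-* k (λ v → f (true ∷ v))))
        (sym (*-distribˡ-+ k (∑ λ v → f (false ∷ v)) _))

∑-swap : ∀ {b c} (f : Id b → Id c → ℕ) → ∑ (λ v → ∑ (f v)) ≡ ∑ (λ w → ∑ λ v → f v w)
∑-swap {zero}  f = refl
∑-swap {suc b} f =
  trans (cong₂ _+_ (∑-swap λ v → f (false ∷ v)) (∑-swap λ v → f (true ∷ v)))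
        (sym (∑-+ (λ w → ∑ λ v → f (false ∷ v) w) (λ w → ∑ λ v → f (true ∷ v) w)))

∑-zero : {f : Id b → ℕ} → (∀ v → f v ≡ 0) → ∑ f ≡ 0
∑-zero {zero}  f≗0 = f≗0 []
∑-zero {suc b} f≗0 = cong₂ _+_ (∑-zero λ v → f≗0 (false ∷ v)) (∑-zero λ v → f≗0 (true ∷ v))

∑-1 : ∑ {b} (λ _ → 1) ≡ 2 ^ b
∑-1 {zero}  = refl
∑-1 {suc b} = cong₂ _+_ (∑-1 {b}) (trans (∑-1 {b}) (sym (+-identityʳ _)))

term≤∑ : (f : Id b → ℕ) (v : Id b) → f v ≤ ∑ f
term≤∑ f []          = ≤-refl
term≤∑ f (false ∷ v) = ≤-trans (term≤∑ _ v) (m≤m+n _ _)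
term≤∑ f (true ∷ v)  = ≤-trans (term≤∑ (λ v → f (true ∷ v)) v) (m≤n+m _ _)

∑-δ : (v : Id b) (f : Id b → ℕ) → ∑ (λ w → ⟦ v == w ⟧ * f w) ≡ f v
∑-δ []          f = +-identityʳ (f [])
∑-δ (false ∷ v) f =
  trans (cong₂ _+_ (∑-δ v λ w → f (false ∷ w)) (∑-zero {b = _} {λ w → ⟦ (false ∷ v) == (true ∷ w) ⟧ * f (true ∷ w)} λ _ → refl)) (+-identityʳ _)
∑-δ (true ∷ v)  f =
  cong₂ _+_ (∑-zero {b = _} {λ w → ⟦ (true ∷ v) == (false ∷ w) ⟧ * f (false ∷ w)} λ _ → refl) (∑-δ v λ w → f (true ∷ w))

==-sym : (v w : Id b) → (v == w) ≡ (w == v)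
==-sym v w with v ≟ᴵ w
... | yes refl = sym (==-refl v)
... | no v≢w = sym (≢⇒== λ w≡v → v≢w (sym w≡v))

∑-isEq : (x : Maybe (Id b)) (f : Id b → ℕ) → ∑ (λ w → ⟦ isEq x w ⟧ * f w) ≡ maybe′ f 0 x
∑-isEq nothing  f = ∑-zero {f = λ w → ⟦ isEq nothing w ⟧ * f w} λ _ → refl
∑-isEq (just v) f = ∑-δ v f

-- The low bits of a sum depend only on the low bits of its summands. This is what permits a node to
-- forward bits of a sum whose summands have not fully arrived.
∑-%-cong : ∀ d .{{_ : NonZero d}} {f g : Id b → ℕ} →
           (∀ v → f v % d ≡ g v % d) → ∑ f % d ≡ ∑ g % d
∑-%-cong {zero}  d f≗g = f≗g []
∑-%-cong {suc b} d {f} {g} f≗g = begin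
  (∑ f₀ + ∑ f₁) % d          ≡⟨ %-distribˡ-+ (∑ f₀) (∑ f₁) d ⟩
  (∑ f₀ % d + ∑ f₁ % d) % d  ≡⟨ cong₂ (λ x y → (x + y) % d) (∑-%-cong d λ v → f≗g (false ∷ v)) (∑-%-cong d λ v → f≗g (true ∷ v)) ⟩
  (∑ g₀ % d + ∑ g₁ % d) % d  ≡⟨ %-distribˡ-+ (∑ g₀) (∑ g₁) d ⟨
  (∑ g₀ + ∑ g₁) % d          ∎
  where
  open ≡-Reasoning
  f₀ f₁ g₀ g₁ : Id _ → ℕ
  f₀ v = f (false ∷ v)
  f₁ v = f (true ∷ v)
  g₀ v = g (false ∷ v)
  g₁ v = g (true ∷ v)

-- Binary digits and residues modulo powers of two

2^≢0 : ∀ k → NonZero (2 ^ k)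
2^≢0 k = m^n≢0 2 k

digit : ℕ → ℕ → ℕ
digit x k = (x / 2 ^ k) {{2^≢0 k}} % 2

_mod2^_ : ℕ → ℕ → ℕ
x mod2^ k = (x % 2 ^ k) {{2^≢0 k}}

infixl 7 _mod2^_

mod2^-suc/ : ∀ x k → ((x mod2^ suc k) / 2 ^ k) {{2^≢0 k}} ≡ digit x k
mod2^-suc/ x k = m%[n*o]/o≡m/o%n x 2 (2 ^ k)
  where instance
    _ = 2^≢0 k
    _ = 2^≢0 (suc k)

digit-cong : ∀ {x y} k → x mod2^ suc k ≡ y mod2^ suc k → digit x k ≡ digit y k
digit-cong {x} {y} k eq = begin
  digit x k                                ≡⟨ mod2^-suc/ x k ⟨
  ((x mod2^ suc k) / 2 ^ k) {{2^≢0 k}}     ≡⟨ cong (λ z → (z / 2 ^ k) {{2^≢0 k}}) eq ⟩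
  ((y mod2^ suc k) / 2 ^ k) {{2^≢0 k}}     ≡⟨ mod2^-suc/ y k ⟩
  digit y k                                ∎
  where open ≡-Reasoning

-- This is the update made by `newTotal` when one further bit arrives.
mod2^-suc : ∀ x k → x mod2^ suc k ≡ x mod2^ k + digit x k * 2 ^ k
mod2^-suc x k = begin
  z                              ≡⟨ m≡m%n+[m/n]*n z (2 ^ k) ⟩
  z % 2 ^ k + z / 2 ^ k * 2 ^ k  ≡⟨ cong₂ (λ p q → p + q * 2 ^ k) (m∣n⇒o%n%m≡o%m (2 ^ k) (2 ^ suc k) x (divides 2 refl)) (mod2^-suc/ x k) ⟩
  x mod2^ k + digit x k * 2 ^ k  ∎
  where
  open ≡-Reasoning
  instance
    _ = 2^≢0 k
    _ = 2^≢0 (suc k)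
  z = x mod2^ suc k

mod2^-mod2^ : ∀ x {k l} → k ≤ l → (x mod2^ l) mod2^ k ≡ x mod2^ k
mod2^-mod2^ x {k} {l} k≤l = m∣n⇒o%n%m≡o%m (2 ^ k) (2 ^ l) x
  (subst (2 ^ k ∣_) (trans (sym (^-distribˡ-+-* 2 k (l ∸ k))) (cong (2 ^_) (m+[n∸m]≡n k≤l))) (m∣m*n _))
  where instance
    _ = 2^≢0 k
    _ = 2^≢0 l

mod2^-small : ∀ {x} k → x < 2 ^ k → x mod2^ k ≡ x
mod2^-small k x<2^k = m<n⇒m%n≡m {{2^≢0 k}} x<2^k

digit-bool : ∀ x k → ⟦ digit x k ≡ᵇ 1 ⟧ ≡ digit x k
digit-bool x k = bool (digit x k) (m%n<n ((x / 2 ^ k) {{2^≢0 k}}) 2)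
  where
  bool : ∀ d → d < 2 → ⟦ d ≡ᵇ 1 ⟧ ≡ d
  bool 0 _ = refl
  bool 1 _ = refl
  bool (suc (suc d)) (s≤s (s≤s ()))

-- Bit strings, and search and tabulation over identifiers

bits : ∀ m → (ℕ → Bool) → Vec Bool m
bits zero    f = []
bits (suc m) f = f 0 ∷ bits m (f ∘ suc)

bitAt : Vec Bool m → ℕ → Bool
bitAt []       _       = false
bitAt (x ∷ xs) zero    = x
bitAt (x ∷ xs) (suc k) = bitAt xs k

bitAt-bits : ∀ {m} f {k} → k < m → bitAt (bits m f) k ≡ f k
bitAt-bits {suc m} f {zero}  _         = refl
bitAt-bits {suc m} f {suc k} (s≤s k<m) = bitAt-bits (f ∘ suc) k<m

unary : ∀ m → ℕ → Vec Bool m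
unary zero    _       = []
unary (suc m) zero    = false ∷ unary m zero
unary (suc m) (suc n) = true ∷ unary m n

count : Vec Bool m → ℕ
count []       = 0
count (x ∷ xs) = ⟦ x ⟧ + count xs

count-unary : ∀ {m n} → n ≤ m → count (unary m n) ≡ n
count-unary {zero}          z≤n       = refl
count-unary {suc m} {zero}  _         = count-unary {m} z≤n
count-unary {suc m} {suc n} (s≤s n≤m) = cong suc (count-unary n≤m)

minimal : ∀ {A : Set} → (Id b → Maybe A) → (A → ℕ) → Maybe (Id b × A)
minimal {zero}  f μ = maybe′ (λ a → just ([] , a)) nothing (f [])
minimal {suc b} f μ = merge (minimal (λ v → f (false ∷ v)) μ) (minimal (λ v → f (true ∷ v)) μ)
  where
  merge : Maybe (Id b × _) → Maybe (Id b × _) → Maybe (Id (suc b) × _)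
  merge nothing        nothing        = nothing
  merge (just (v , a)) nothing        = just (false ∷ v , a)
  merge nothing        (just (w , c)) = just (true ∷ w , c)
  merge (just (v , a)) (just (w , c)) = if μ a ≤ᵇ μ c then just (false ∷ v , a) else just (true ∷ w , c)

Minimal : ∀ {A : Set} → (Id b → Maybe A) → (A → ℕ) → Maybe (Id b × A) → Set
Minimal f μ nothing        = ∀ v → f v ≡ nothing
Minimal f μ (just (v , a)) = f v ≡ just a × (∀ w c → f w ≡ just c → μ a ≤ μ c)

minimal-correct : ∀ {A : Set} → (f : Id b → Maybe A) (μ : A → ℕ) → Minimal f μ (minimal f μ)
minimal-correct {zero} f μ with f [] in eq
... | nothing = λ where [] → eq
... | just a  = eq , λ where [] c eq′ → ≤-reflexive (cong μ (just-injective (trans (sym eq) eq′)))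
minimal-correct {suc b} f μ
  with minimal (λ v → f (false ∷ v)) μ | minimal-correct (λ v → f (false ∷ v)) μ
     | minimal (λ v → f (true ∷ v)) μ | minimal-correct (λ v → f (true ∷ v)) μ
... | nothing | p | nothing | q = λ where
  (false ∷ v) → p v
  (true ∷ v)  → q v
... | just (v , a) | (fv , p) | nothing | q = fv , λ where
  (false ∷ w) c eq → p w c eq
  (true ∷ w)  c eq → case trans (sym eq) (q w) of λ ()
... | nothing | p | just (w , c) | (fw , q) = fw , λ where
  (false ∷ v) a eq → case trans (sym eq) (p v) of λ ()
  (true ∷ v)  a eq → q v a eq
... | just (v , a) | (fv , p) | just (w , c) | (fw , q) with μ a ≤ᵇ μ c in eq
...   | true = fv , λ where
  (false ∷ x) d eq′ → p x d eq′
  (true ∷ x)  d eq′ → ≤-trans (≤ᵇ⇒≤ _ _ (subst T (sym eq) tt)) (q x d eq′)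
...   | false = fw , λ where
  (false ∷ x) d eq′ → ≤-trans (<⇒≤ (≰⇒> λ le → subst T eq (≤⇒≤ᵇ le))) (p x d eq′)
  (true ∷ x)  d eq′ → q x d eq′

-- Pointwise equal functions have equal tables by `tabulate-cong`, whereas the functions themselves
-- cannot be identified without function extensionality. The simulation argument compares states by
-- propositional equality, so neighbour sets and inboxes pass through tables.
Table : Set → ℕ → Set
Table A zero    = A
Table A (suc b) = Table A b × Table A b

tabulate : ∀ {A : Set} → (Id b → A) → Table A b
tabulate {zero}  f = f []
tabulate {suc b} f = tabulate (λ v → f (false ∷ v)) , tabulate (λ v → f (true ∷ v))

lookup : ∀ {A : Set} → Table A b → Id b → A
lookup t       []          = t
lookup (t , _) (false ∷ v) = lookup t v
lookup (_ , t) (true ∷ v)  = lookup t v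

lookup-tabulate : ∀ {A : Set} → (f : Id b → A) (v : Id b) → lookup (tabulate f) v ≡ f v
lookup-tabulate f []          = refl
lookup-tabulate f (false ∷ v) = lookup-tabulate (λ v → f (false ∷ v)) v
lookup-tabulate f (true ∷ v)  = lookup-tabulate (λ v → f (true ∷ v)) v

tabulate-cong : {A : Set} {f g : Id b → A} → (∀ v → f v ≡ g v) → tabulate f ≡ tabulate g
tabulate-cong {zero}  f≗g = f≗g []
tabulate-cong {suc b} f≗g = cong₂ _,_ (tabulate-cong λ v → f≗g (false ∷ v)) (tabulate-cong λ v → f≗g (true ∷ v))

-- Programs of send and receive actions

record Packet (b w : ℕ) : Set where
  constructor packet
  field
    tag₁ tag₂ : Bool
    name      : Id b
    payload   : Vec Bool w

open Packet public

module _ {b w : ℕ} where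

  encode : Packet b w → Vec Bool (2 + (b + w))
  encode (packet s t i p) = s ∷ t ∷ i Vec.++ p

  decode : Vec Bool (2 + (b + w)) → Packet b w
  decode (s ∷ t ∷ x) = packet s t (Vec.take b x) (Vec.drop b x)

  take-++ : ∀ {m k} (x : Vec Bool m) (y : Vec Bool k) → Vec.take m (x Vec.++ y) ≡ x
  take-++ []      y = refl
  take-++ (a ∷ x) y = cong (a ∷_) (take-++ x y)

  drop-++ : ∀ {m k} (x : Vec Bool m) (y : Vec Bool k) → Vec.drop m (x Vec.++ y) ≡ y
  drop-++ []      y = refl
  drop-++ (a ∷ x) y = drop-++ x y

  decode-encode : ∀ p → decode (encode p) ≡ p
  decode-encode (packet s t i p) = cong₂ (packet s t) (take-++ i p) (drop-++ i p)

  -- Both tags are false, so a missing message reads as no membership and as no request for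
  -- admission.
  silence : Packet b w
  silence = packet false false (Vec.replicate b false) (Vec.replicate w false)

record Action (b w : ℕ) (D : Set) : Set where
  field
    send    : Id b → D → Id b → Packet b w
    receive : Id b → (Id b → Bool) → D → (Id b → Packet b w) → D

module _ {b w : ℕ} {D Out : Set} where

  record ProgramState : Set where
    constructor state
    field
      todo  : List (Action b w D)
      self  : Id b
      nbrs  : Table Bool b
      local : D

  -- All nodes run the same list of actions and so finish in the same round; the rule that a
  -- finished neighbour is silent never cuts off a message.
  program : List (Action b w D) → (Id b → D) → (Id b → D → Out) → Algorithm b Out
  program actions initial result = record
    { bandwidth = 2 + (b + w)
    ; State     = ProgramState
    ; init      = λ i N → state actions i (tabulate N) (initial i)
    ; send      = send
    ; receive   = receive
    ; output    = output
    }
    where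
    send : ProgramState → Id b → Maybe (Vec Bool (2 + (b + w)))
    send (state []      i N d) j = nothing
    send (state (a ∷ _) i N d) j = just (encode (Action.send a i d j))

    receive : ProgramState → (Id b → Maybe (Vec Bool (2 + (b + w)))) → ProgramState
    receive (state []      i N d) box = state [] i N d
    receive (state (a ∷ p) i N d) box =
      state p i N (Action.receive a i (lookup N) d (lookup (tabulate (maybe′ decode silence ∘ box))))

    output : ProgramState → Maybe Out
    output (state []      i N d) = just (result i d)
    output (state (_ ∷ _) i N d) = nothing

iterate : ∀ {A : Set} → (ℕ → List A) → ℕ → ℕ → List A
iterate f k zero    = []
iterate f k (suc n) = f k ++ iterate f (suc k) n

length-iterate : ∀ {A : Set} (f : ℕ → List A) {l} → (∀ k → length (f k) ≡ l) → ∀ k n → length (iterate f k n) ≡ n * l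
length-iterate f eq k zero    = refl
length-iterate f eq k (suc n) = trans (length-++ (f k)) (cong₂ _+_ (eq k) (length-iterate f eq (suc k) n))

-- The run of a program on the graph whose vertices are all 2 ^ b identifiers,
-- where the identifiers that name no node are isolated.
module Run {b w : ℕ} {D : Set} (adj : Id b → Id b → Bool) where

  received : Action b w D → (Id b → D) → Id b → Id b → Packet b w
  received a s i j = if adj i j then Action.send a j (s j) i else silence

  oneRound : Action b w D → (Id b → D) → Id b → D
  oneRound a s i = Action.receive a i (lookup (tabulate (adj i))) (s i) (lookup (tabulate (received a s i)))

  exec : List (Action b w D) → (Id b → D) → Id b → D
  exec []      s = s
  exec (a ∷ p) s = exec p (oneRound a s)

  exec-++ : ∀ p q s → exec (p ++ q) s ≡ exec q (exec p s)
  exec-++ []      q s = refl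
  exec-++ (a ∷ p) q s = exec-++ p q (oneRound a s)

  exec-iterate : ∀ (f : ℕ → List (Action b w D)) {m} (P : ℕ → (Id b → D) → Set) →
                 (∀ {k s} → k < m → P k s → P (suc k) (exec (f k) s)) →
                 ∀ n {k s} → n + k ≤ m → P k s → P (n + k) (exec (iterate f k n) s)
  exec-iterate f P next zero    le p = p
  exec-iterate f {m} P next (suc n) {k} {s} le p =
    subst₂ P (+-suc n k) (sym (exec-++ (f k) (iterate f (suc k) n) s))
      (exec-iterate f P next n (subst (_≤ m) (sym (+-suc n k)) le) (next (≤-trans (s≤s (m≤n+m k n)) le) p))

module IdGraph {n b : ℕ} (G : Graph n) (ident : Fin n → Id b) (injective : Injective _≡_ _≡_ ident) where
  open Graph G renaming (sym to Adj-sym)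

  neighbour? : ∀ v i → Dec (∃ λ u → Adj v u × ident u ≡ i)
  neighbour? v i = any? λ u → adj? v u ×-dec (ident u ≟ᴵ i)

  adjacent? : ∀ i j → Dec (∃ λ v → ident v ≡ i × ∃ λ u → Adj v u × ident u ≡ j)
  adjacent? i j = any? λ v → (ident v ≟ᴵ i) ×-dec neighbour? v j

  abstract
    adj : Id b → Id b → Bool
    adj i j = does (adjacent? i j)

    adj⇒ : ∀ {i j} → adj i j ≡ true → ∃ λ v → ident v ≡ i × ∃ λ u → Adj v u × ident u ≡ j
    adj⇒ {i} {j} eq with adjacent? i j
    ... | yes p = p

    adj⇒Adj : ∀ {v u} → adj (ident v) (ident u) ≡ true → Adj v u
    adj⇒Adj eq with v , v≡ , u , vu , u≡ ← adj⇒ eq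
      rewrite injective v≡ | injective u≡ = vu

    Adj⇒adj : ∀ {v u} → Adj v u → adj (ident v) (ident u) ≡ true
    Adj⇒adj {v} {u} vu = dec-true (adjacent? (ident v) (ident u)) (v , refl , u , vu , refl)

    adj-sym : ∀ {i j} → adj i j ≡ true → adj j i ≡ true
    adj-sym eq with v , refl , u , vu , refl ← adj⇒ eq = Adj⇒adj (Adj-sym vu)

    -- Nodes sharing an identifier would have their neighbourhoods merged in `adj`; injectivity
    -- excludes this, and each node sees exactly its row of `adj`.
    neighbour≡adj : ∀ v j → does (neighbour? v j) ≡ adj (ident v) j
    neighbour≡adj v j with neighbour? v j
    ... | yes (u , vu , refl) = sym (Adj⇒adj vu)
    ... | no ¬p = sym (dec-false (adjacent? (ident v) j)
                    λ (v′ , eq , u , vu , u≡) → ¬p (u , subst (λ v → Adj v u) (injective eq) vu , u≡))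

module _ {n b w : ℕ} {D Out : Set} (G : Graph n) (ident : Fin n → Id b) (injective : Injective _≡_ _≡_ ident)
         (actions : List (Action b w D)) (initial : Id b → D) (result : Id b → D → Out) where
  open IdGraph G ident injective
  open Run {b} {w} {D} adj
  open Execution (program actions initial result) G ident

  private
    at : List (Action b w D) → (Id b → D) → Fin n → ProgramState {b} {w} {D} {Out}
    at p s v = state p (ident v) (tabulate (adj (ident v))) (s (ident v))

    inbox-at : ∀ a p s c → (∀ v → c v ≡ at (a ∷ p) s v) → ∀ v j →
               maybe′ decode silence (inbox c v j) ≡ received a s (ident v) j
    inbox-at a p s c eq v j with neighbour? v j | neighbour≡adj v j
    ... | yes (u , vu , refl) | e rewrite sym e | eq u = decode-encode (Action.send a (ident u) (s (ident u)) (ident v))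
    ... | no _ | e rewrite sym e = refl

    round-at : ∀ a p s c → (∀ v → c v ≡ at (a ∷ p) s v) → ∀ v → round c v ≡ at p (oneRound a s) v
    round-at a p s c eq v = trans (helper (c v) (eq v))
      (cong (λ t → state p (ident v) (tabulate (adj (ident v)))
                    (Action.receive a (ident v) (lookup (tabulate (adj (ident v)))) (s (ident v)) (lookup t)))
            (tabulate-cong (inbox-at a p s c eq v)))
      where
      -- The test `finished x` reduces only when `x` is visibly a state with work left, which
      -- matching on the equation provides.
      helper : ∀ x → x ≡ at (a ∷ p) s v →
        (if finished x then x else Algorithm.receive (program actions initial result) x (inbox c v)) ≡
        state p (ident v) (tabulate (adj (ident v)))
          (Action.receive a (ident v) (lookup (tabulate (adj (ident v)))) (s (ident v))
            (lookup (tabulate (λ j → maybe′ decode silence (inbox c v j)))))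
      helper _ refl = refl

    after-at : ∀ p t s → (∀ v → after t v ≡ at p s v) → ∀ v → after (length p + t) v ≡ at [] (exec p s) v
    after-at []      t s eq v = eq v
    after-at (a ∷ p) t s eq v =
      subst (λ t → after t v ≡ at [] (exec p (oneRound a s)) v) (+-suc (length p) t)
            (after-at p (suc t) (oneRound a s) (round-at a p s (after t) eq) v)

  program-finishes : AllFinish (length actions + 0) (λ v → result (ident v) (exec actions initial (ident v)))
  program-finishes v =
    cong (Algorithm.output (program actions initial result))
      (after-at actions 0 initial
        (λ v → cong (λ t → state actions (ident v) t (initial (ident v)))
                    (tabulate-cong (neighbour≡adj v))) v)

-- Pipelined counting along trees

record Entry (b : ℕ) : Set where
  constructor entry
  field
    slot   : ℕ
    parent : Maybe (Id b)
    time   : ℕ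

-- A node's view of the cluster trees, which are named by their roots:
-- `entryOf w` is its position in the tree of w, `treeAt` is the tree held by
-- one of its slots, and `kid c w` and `kidTree c` are what it remembers of
-- slot and time of its child c in the tree of w, and of the trees in c's slots.
record Links (b : ℕ) : Set where
  constructor mkLinks
  field
    entryOf : Id b → Maybe (Entry b)
    treeAt  : ℕ → Id b
    kid     : Id b → Id b → Maybe (ℕ × ℕ)
    kidTree : Id b → ℕ → Id b

record Memory (b : ℕ) (X : Set) : Set where
  constructor memory
  field
    links : Links b
    total : Id b → Id b → ℕ
    flag  : Id b → Bool
    rest  : X

open Entry public
open Links public
open Memory public

module Forests {b : ℕ} (W : ℕ) (adj : Id b → Id b → Bool) where

  -- Strictly decreasing times make the parent pointers well founded and bound the length of every
  -- climb to the root. The last two conditions of `child` make the parent's records mirror those of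
  -- the child.
  data Placed (L : Id b → Links b) (v w : Id b) : Entry b → Set where
    root  : ∀ {j} → v ≡ w → Placed L v w (entry j nothing 0)
    child : ∀ {j p t e} → v ≢ w → adj v p ≡ true →
            entryOf (L p) w ≡ just e → time e < t →
            kid (L p) v w ≡ just (j , t) → kidTree (L p) v j ≡ w →
            Placed L v w (entry j (just p) t)

  record Forest (L : Id b → Links b) (τ : ℕ) : Set where
    field
      placed     : ∀ {v w e} → entryOf (L v) w ≡ just e → Placed L v w e
      slot-tree  : ∀ {v w e} → entryOf (L v) w ≡ just e → treeAt (L v) (slot e) ≡ w
      slot-bound : ∀ {v w e} → entryOf (L v) w ≡ just e → slot e < W
      time-bound : ∀ {v w e} → entryOf (L v) w ≡ just e → time e ≤ τ
      kid-entry  : ∀ {p v w j t} → kid (L p) v w ≡ just (j , t) →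
                   entryOf (L v) w ≡ just (entry j (just p) t)

module Local {b W : ℕ} {D : Set} where

  locally : (Id b → D → D) → Action b W D
  locally f = record { send = λ _ _ _ → silence ; receive = λ i _ d _ → f i d }

-- Every node of every tree adds up the marks below it. A node that joined the
-- tree at time t sends bit k of its sum in round S - t + k, when the bits up to
-- k of its children, who joined later, have already arrived. So one bit per
-- tree and round suffices, and all sums reach the roots in S + Λ rounds.
module Counting {b : ℕ} (W S Λ : ℕ) {X : Set} (mark : X → Maybe (Id b)) (decide : Id b → X → ℕ → Bool) where

  open Local {b} {W} {Memory b X}

  subtotal : Memory b X → Id b → ℕ
  subtotal m w = ⟦ isEq (mark (rest m)) w ⟧ + ∑ λ c → ⟦ is-just (kid (links m) c w) ⟧ * total m c w

  reset : Action b W (Memory b X)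
  reset = locally λ i m → memory (links m) (λ _ _ → 0) (λ _ → false) (rest m)

  upBit : ℕ → Memory b X → Id b → Maybe (Entry b) → Bool
  upBit r m w nothing  = false
  upBit r m w (just e) = digit (subtotal m w) (r + time e ∸ S) ≡ᵇ 1

  -- Before round `S ∸ t` truncated subtraction makes a child send bit 0 of a sum that may be
  -- incomplete. The parent knows `t` and ignores these rounds.
  newTotal : ℕ → (ℕ → Bool) → Maybe (ℕ × ℕ) → ℕ → ℕ
  newTotal r box nothing        x = x
  newTotal r box (just (j , t)) x = if S ≤ᵇ r + t then x + ⟦ box j ⟧ * 2 ^ (r + t ∸ S) else x

  up : ℕ → Action b W (Memory b X)
  up r = record
    { send    = λ i m _ → packet false false i
                  (bits W λ j → upBit r m (treeAt (links m) j) (entryOf (links m) (treeAt (links m) j)))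
    ; receive = λ i _ m box → memory (links m)
                  (λ c w → newTotal r (bitAt (payload (box c))) (kid (links m) c w) (total m c w))
                  (flag m) (rest m)
    }

  verdict : Action b W (Memory b X)
  verdict = locally λ i m → memory (links m) (total m)
              (λ w → if w == i then decide i (rest m) (subtotal m i) else false) (rest m)

  newFlag : (Id b → ℕ → Bool) → Maybe (Entry b) → Bool → Bool
  newFlag box (just (entry j (just p) t)) x = box p j
  newFlag box _                           x = x

  -- Both directions index the bits of a message by the slots of the child. Hence the sender
  -- translates through `treeAt` on the way up and through `kidTree` on the way down.
  down : Action b W (Memory b X)
  down = record
    { send    = λ i m c → packet false false i (bits W λ j → flag m (kidTree (links m) c j))
    ; receive = λ i _ m box → memory (links m) (total m)
                  (λ w → newFlag (λ p → bitAt (payload (box p))) (entryOf (links m) w) (flag m w)) (rest m)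
    }

  ups : ℕ → ℕ → List (Action b W (Memory b X))
  ups r zero    = []
  ups r (suc n) = up r ∷ ups (suc r) n

  counting : List (Action b W (Memory b X))
  counting = reset ∷ ups 0 (S + Λ) ++ verdict ∷ replicate S down

  length-counting : length counting ≡ 2 + (S + Λ + S)
  length-counting = cong suc (begin
    length (ups 0 (S + Λ) ++ verdict ∷ replicate S down) ≡⟨ length-++ (ups 0 (S + Λ)) ⟩
    length (ups 0 (S + Λ)) + suc (length (replicate S down)) ≡⟨ cong₂ (λ x y → x + suc y) (length-ups 0 (S + Λ)) (length-replicate S) ⟩
    S + Λ + suc S ≡⟨ +-suc _ _ ⟩
    suc (S + Λ + S) ∎)
    where
    open ≡-Reasoning
    length-ups : ∀ r n → length (ups r n) ≡ n
    length-ups r zero    = refl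
    length-ups r (suc n) = cong suc (length-ups (suc r) n)

  module Correct (adj : Id b → Id b → Bool) (adj-sym : ∀ {i j} → adj i j ≡ true → adj j i ≡ true)
                 (L : Id b → Links b) (ξ : Id b → X) (b<Λ : b < Λ)
                 (forest : Forests.Forest W adj L S)
                 (marked : ∀ {v w} → isEq (mark (ξ v)) w ≡ true → ∃ λ e → entryOf (L v) w ≡ just e) where
    open Forests W adj
    open Forest forest
    open Run {b} {W} {Memory b X} adj

    parentOf : Id b → Id b → Maybe (Id b)
    parentOf w v = maybe′ parent nothing (entryOf (L v) w)

    -- The number of visits to u on the way from v to the root of the tree of w,
    -- among its first f vertices.
    visits : Id b → ℕ → Id b → Id b → ℕ
    visits w zero    v u = 0
    visits w (suc f) v u = ⟦ v == u ⟧ + maybe′ (λ p → visits w f p u) 0 (parentOf w v)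

    isKid : Id b → Id b → Id b → ℕ
    isKid w u c = ⟦ is-just (kid (L u) c w) ⟧

    marks : Id b → Id b → ℕ
    marks w v = ⟦ isEq (mark (ξ v)) w ⟧

    isKid-parent : ∀ w u c → isKid w u c ≡ maybe′ (λ p → ⟦ p == u ⟧) 0 (parentOf w c)
    isKid-parent w u c with kid (L u) c w in eq
    ... | just (j , t) rewrite kid-entry eq | ==-refl u = refl
    ... | nothing with entryOf (L c) w in eq₁
    ...   | nothing = refl
    ...   | just (entry j nothing t) = refl
    ...   | just (entry j (just p) t) with placed eq₁ | p ≟ᴵ u
    ...     | child _ _ _ _ isK _ | yes refl = case trans (sym isK) eq of λ ()
    ...     | _ | no _ = refl

    -- `visits` unfolds at the start `v` of a climb, but sums are formed at `u`. A climb that meets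
    -- `u` either starts there or arrives from a child of `u`; the induction on the fuel peels off
    -- the parent of `v`.
    visits-kids : ∀ w f v u → visits w (suc f) v u ≡ ⟦ v == u ⟧ + ∑ λ c → isKid w u c * visits w f v c
    visits-kids w f v u = cong (⟦ v == u ⟧ +_) (above f)
      where
      open ≡-Reasoning
      distrib : ∀ x y z → x * (y + z) ≡ y * x + x * z
      distrib = solve-∀
      above : ∀ f → maybe′ (λ p → visits w f p u) 0 (parentOf w v) ≡ ∑ λ c → isKid w u c * visits w f v c
      above zero with parentOf w v
      ... | nothing = sym (∑-zero λ c → *-zeroʳ (isKid w u c))
      ... | just p = sym (∑-zero λ c → *-zeroʳ (isKid w u c))
      above (suc f) = begin
        maybe′ (λ p → visits w (suc f) p u) 0 (parentOf w v)
          ≡⟨ atParent (parentOf w v) ⟩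
        maybe′ (λ p → ⟦ p == u ⟧) 0 (parentOf w v) + ∑ (λ c → isKid w u c * rest′ c)
          ≡⟨ cong (_+ ∑ λ c → isKid w u c * rest′ c) (isKid-parent w u v) ⟨
        isKid w u v + ∑ (λ c → isKid w u c * rest′ c)
          ≡⟨ cong (_+ ∑ λ c → isKid w u c * rest′ c) (∑-δ v (isKid w u)) ⟨
        ∑ (λ c → ⟦ v == c ⟧ * isKid w u c) + ∑ (λ c → isKid w u c * rest′ c)
          ≡⟨ ∑-+ (λ c → ⟦ v == c ⟧ * isKid w u c) (λ c → isKid w u c * rest′ c) ⟨
        ∑ (λ c → ⟦ v == c ⟧ * isKid w u c + isKid w u c * rest′ c)
          ≡⟨ ∑-cong (λ c → distrib (isKid w u c) ⟦ v == c ⟧ (rest′ c)) ⟨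
        ∑ (λ c → isKid w u c * visits w (suc f) v c) ∎
        where
        rest′ : Id b → ℕ
        rest′ c = maybe′ (λ p → visits w f p c) 0 (parentOf w v)
        atParent : ∀ x → maybe′ (λ p → visits w (suc f) p u) 0 x ≡
          maybe′ (λ p → ⟦ p == u ⟧) 0 x + ∑ (λ c → isKid w u c * maybe′ (λ p → visits w f p c) 0 x)
        atParent nothing  = sym (∑-zero λ c → *-zeroʳ (isKid w u c))
        atParent (just p) = visits-kids w f p u

    -- Times fall strictly along a climb, so a climb from time `e` ends before fuel larger than that
    -- time runs out.
    visits-stable : ∀ f {w v e} u → entryOf (L v) w ≡ just e → time e < f →
                    visits w f v u ≡ visits w (suc f) v u
    visits-stable (suc f) {w} {v} u eq t<f with entryOf (L v) w in eq₁
    visits-stable (suc f) {w} {v} u refl t<f | just e with placed eq₁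
    ... | root _ = refl
    ... | child _ _ eq₂ t′<t _ _ = cong (⟦ v == u ⟧ +_) (visits-stable f u eq₂ (≤-trans t′<t (s≤s⁻¹ t<f)))

    visits-root : ∀ f {w v e} → entryOf (L v) w ≡ just e → time e < f → visits w f v w ≡ 1
    visits-root (suc f) {w} {v} eq t<f with entryOf (L v) w in eq₁
    visits-root (suc f) {w} {v} refl t<f | just e with placed eq₁
    ... | root refl rewrite ==-refl v = refl
    ... | child v≢w _ eq₂ t′<t _ _ rewrite ≢⇒== v≢w = visits-root f eq₂ (≤-trans t′<t (s≤s⁻¹ t<f))

    -- The sum that `u` ought to report in the tree of `w`. It is defined by climbs from the marked
    -- vertices, since a descent into the children is not a structural recursion; `tally-kids`
    -- recovers that recursion.
    tally : Id b → Id b → ℕ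
    tally w u = ∑ λ v → marks w v * visits w (suc S) v u

    marks-cong : ∀ w v {x y} → (∀ {e} → entryOf (L v) w ≡ just e → x ≡ y) → marks w v * x ≡ marks w v * y
    marks-cong w v eq with isEq (mark (ξ v)) w in eq₁
    ... | false = refl
    ... | true  = cong (1 *_) (eq (proj₂ (marked eq₁)))

    tally-kids : ∀ w u → tally w u ≡ marks w u + ∑ λ c → isKid w u c * tally w c
    tally-kids w u = begin
      ∑ (λ v → marks w v * visits w (suc S) v u)
        ≡⟨ ∑-cong (λ v → marks-cong w v λ eq → visits-stable (suc S) u eq (s≤s (time-bound eq))) ⟩
      ∑ (λ v → marks w v * visits w (suc (suc S)) v u)
        ≡⟨ ∑-cong (λ v → trans (cong (marks w v *_) (visits-kids w (suc S) v u))
                           (trans (*-distribˡ-+ (marks w v) ⟦ v == u ⟧ _)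
                             (cong₂ _+_ (trans (*-comm (marks w v) ⟦ v == u ⟧) (cong (λ x → ⟦ x ⟧ * marks w v) (==-sym v u)))
                               (sym (∑-* (marks w v) (λ c → isKid w u c * visits w (suc S) v c)))))) ⟩
      ∑ (λ v → ⟦ u == v ⟧ * marks w v + ∑ λ c → marks w v * (isKid w u c * visits w (suc S) v c))
        ≡⟨ ∑-+ (λ v → ⟦ u == v ⟧ * marks w v) (λ v → ∑ λ c → marks w v * (isKid w u c * visits w (suc S) v c)) ⟩
      ∑ (λ v → ⟦ u == v ⟧ * marks w v) + ∑ (λ v → ∑ λ c → marks w v * (isKid w u c * visits w (suc S) v c))
        ≡⟨ cong₂ _+_ (∑-δ u (marks w)) (∑-swap λ v c → marks w v * (isKid w u c * visits w (suc S) v c)) ⟩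
      marks w u + ∑ (λ c → ∑ λ v → marks w v * (isKid w u c * visits w (suc S) v c))
        ≡⟨ cong (marks w u +_) (∑-cong λ c → trans
             (∑-cong λ v → rotate (marks w v) (isKid w u c) (visits w (suc S) v c))
             (∑-* (isKid w u c) (λ v → marks w v * visits w (suc S) v c))) ⟩
      marks w u + ∑ (λ c → isKid w u c * tally w c) ∎
      where
      open ≡-Reasoning
      rotate : ∀ x y z → x * (y * z) ≡ y * (x * z)
      rotate = solve-∀

    -- By `marked`, a vertex marked for `w` lies in the tree of `w`, and its climb meets the root
    -- exactly once.
    tally-root : ∀ w → tally w w ≡ ∑ (marks w)
    tally-root w = ∑-cong λ v → trans
      (marks-cong w v λ eq → visits-root (suc S) eq (s≤s (time-bound eq)))
      (*-identityʳ (marks w v))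

    -- The sum of a child of the root is part of the root's own sum, which is at most `2 ^ b`;
    -- therefore `Λ > b` bits hold it.
    tally-small : ∀ {w c j t} → kid (L w) c w ≡ just (j , t) → tally w c < 2 ^ Λ
    tally-small {w} {c} eq = begin-strict
      tally w c                                        ≡⟨ *-identityˡ _ ⟨
      1 * tally w c                                    ≡⟨ cong (λ x → ⟦ is-just x ⟧ * tally w c) eq ⟨
      isKid w w c * tally w c                          ≤⟨ term≤∑ (λ c → isKid w w c * tally w c) c ⟩
      ∑ (λ c → isKid w w c * tally w c)                ≤⟨ m≤n+m _ (marks w w) ⟩
      marks w w + ∑ (λ c → isKid w w c * tally w c)    ≡⟨ tally-kids w w ⟨
      tally w w                                        ≡⟨ tally-root w ⟩
      ∑ (marks w)                                      ≤⟨ ∑-mono (λ v → ⟦⟧≤1 (isEq (mark (ξ v)) w)) ⟩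
      ∑ {b} (λ _ → 1)                                  ≡⟨ ∑-1 {b} ⟩
      2 ^ b                                            <⟨ ^-monoʳ-< 2 (s≤s (s≤s z≤n)) b<Λ ⟩
      2 ^ Λ                                            ∎
      where open ≤-Reasoning

    record Fixed (s : Id b → Memory b X) : Set where
      field
        links≡ : ∀ v → links (s v) ≡ L v
        rest≡  : ∀ v → rest (s v) ≡ ξ v

    open Fixed

    -- A child that joined at time `t` starts to send in round `S ∸ t`, so exactly its lowest
    -- `r + t ∸ S` bits are known before round `r`.
    Received : ℕ → (Id b → Memory b X) → Set
    Received r s = ∀ {p c w j t} → kid (L p) c w ≡ just (j , t) →
                   total (s p) c w ≡ tally w c mod2^ (r + t ∸ S)

    -- Children joined strictly later than `u`, so each of them is at least one bit ahead of `u`.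
    -- Bit `k` of the partial sum, carries included, is therefore already final in the round in
    -- which `u` sends it.
    subtotal-mod : ∀ {r s} → Fixed s → Received r s → ∀ {u w e} → entryOf (L u) w ≡ just e → S ≤ r + time e →
                   subtotal (s u) w mod2^ suc (r + time e ∸ S) ≡ tally w u mod2^ suc (r + time e ∸ S)
    subtotal-mod {r} {s} fix rec {u} {w} {e} eq S≤
      rewrite links≡ fix u | rest≡ fix u | tally-kids w u =
      trans (%-distribˡ-+ (marks w u) _ (2 ^ suc k))
        (trans (cong (λ x → (marks w u mod2^ suc k + x) mod2^ suc k) (∑-%-cong (2 ^ suc k) kids))
          (sym (%-distribˡ-+ (marks w u) _ (2 ^ suc k))))
      where
      k = r + time e ∸ S
      instance _ = 2^≢0 (suc k)
      later : ∀ {c j t} → kid (L u) c w ≡ just (j , t) → suc k ≤ r + t ∸ S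
      later {c} {j} {t} isK with placed (kid-entry isK)
      ... | child _ _ eq′ t′<t _ _ with refl ← just-injective (trans (sym eq) eq′) =
        subst (_≤ r + t ∸ S) (+-∸-assoc 1 S≤) (∸-monoˡ-≤ S (≤-trans (≤-reflexive (sym (+-suc r _))) (+-monoʳ-≤ r t′<t)))
      kids : ∀ c → (⟦ is-just (kid (L u) c w) ⟧ * total (s u) c w) mod2^ suc k ≡ (isKid w u c * tally w c) mod2^ suc k
      kids c with kid (L u) c w in isK
      ... | nothing = refl
      ... | just (j , t) rewrite rec isK | *-identityˡ (tally w c mod2^ (r + t ∸ S)) | *-identityˡ (tally w c) =
        mod2^-mod2^ (tally w c) (later isK)

    up-fixed : ∀ r {s} → Fixed s → Fixed (oneRound (up r) s)
    up-fixed r fix = record { links≡ = links≡ fix ; rest≡ = rest≡ fix }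

    up-received : ∀ r {s} → Fixed s → Received r s → Received (suc r) (oneRound (up r) s)
    up-received r {s} fix rec {p} {c} {w} {j} {t} isK with placed (kid-entry isK)
    ... | child {e = e} _ cp eq t′<t _ _ = begin
      newTotal r (bitAt (payload (lookup (tabulate (received (up r) s p)) c))) (kid (links (s p)) c w) (total (s p) c w)
        ≡⟨ cong₂ (λ q k → newTotal r (bitAt (payload q)) k (total (s p) c w)) box
             (trans (cong (λ l → kid l c w) (links≡ fix p)) isK) ⟩
      newTotal r (bitAt (bits W bit)) (just (j , t)) (total (s p) c w)
        ≡⟨ cong₂ (λ x y → if S ≤ᵇ r + t then y + ⟦ x ⟧ * 2 ^ (r + t ∸ S) else y)
             (trans (bitAt-bits bit (slot-bound isE)) bit≡) (rec isK) ⟩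
      (if S ≤ᵇ r + t then Y mod2^ (r + t ∸ S) + ⟦ digit (subtotal (s c) w) (r + t ∸ S) ≡ᵇ 1 ⟧ * 2 ^ (r + t ∸ S) else Y mod2^ (r + t ∸ S))
        ≡⟨ cases ⟩
      Y mod2^ (suc r + t ∸ S) ∎
      where
      open ≡-Reasoning
      Y = tally w c
      isE = kid-entry isK
      bit : ℕ → Bool
      bit j = upBit r (s c) (treeAt (links (s c)) j) (entryOf (links (s c)) (treeAt (links (s c)) j))
      box : lookup (tabulate (received (up r) s p)) c ≡ packet false false c (bits W bit)
      box = trans (lookup-tabulate (received (up r) s p) c)
              (cong (λ x → if x then packet false false c (bits W bit) else silence) (adj-sym cp))
      bit≡ : bit j ≡ (digit (subtotal (s c) w) (r + t ∸ S) ≡ᵇ 1)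
      bit≡ = trans (cong (λ l → upBit r (s c) (treeAt l j) (entryOf l (treeAt l j))) (links≡ fix c))
               (trans (cong (λ x → upBit r (s c) x (entryOf (L c) x)) (slot-tree isE)) (cong (upBit r (s c) w) isE))
      cases : (if S ≤ᵇ r + t then Y mod2^ (r + t ∸ S) + ⟦ digit (subtotal (s c) w) (r + t ∸ S) ≡ᵇ 1 ⟧ * 2 ^ (r + t ∸ S) else Y mod2^ (r + t ∸ S))
              ≡ Y mod2^ (suc r + t ∸ S)
      cases with S ≤ᵇ r + t in eqb
      ... | true rewrite digit-bool (subtotal (s c) w) (r + t ∸ S) = begin
        Y mod2^ k + digit (subtotal (s c) w) k * 2 ^ k ≡⟨ cong (λ x → Y mod2^ k + x * 2 ^ k) (digit-cong k (subtotal-mod fix rec isE S≤)) ⟩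
        Y mod2^ k + digit Y k * 2 ^ k ≡⟨ mod2^-suc Y k ⟨
        Y mod2^ suc k ≡⟨ cong (Y mod2^_) (+-∸-assoc 1 S≤) ⟨
        Y mod2^ (suc r + t ∸ S) ∎
        where
        k = r + t ∸ S
        S≤ : S ≤ r + t
        S≤ = ≤ᵇ⇒≤ _ _ (subst T (sym eqb) tt)
      ... | false = cong (Y mod2^_) (trans (m≤n⇒m∸n≡0 (<⇒≤ r+t<S)) (sym (m≤n⇒m∸n≡0 r+t<S)))
        where
        r+t<S : r + t < S
        r+t<S = ≰⇒> λ le → subst T eqb (≤⇒≤ᵇ le)

    ups-correct : ∀ n r {s} → Fixed s → Received r s →
                  Fixed (exec (ups r n) s) × Received (n + r) (exec (ups r n) s)
    ups-correct zero    r fix rec = fix , rec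
    ups-correct (suc n) r {s} fix rec =
      subst (λ k → Fixed (exec (ups r (suc n)) s) × Received k (exec (ups r (suc n)) s)) (+-suc n r)
        (ups-correct n (suc r) (up-fixed r fix) (up-received r {s} fix rec))

    outcome : Id b → Bool
    outcome w = decide w (ξ w) (∑ (marks w))

    Informed : ℕ → (Id b → Memory b X) → Set
    Informed r s = ∀ {v w e} → entryOf (L v) w ≡ just e → time e ≤ r → flag (s v) w ≡ outcome w

    Summed : (Id b → Memory b X) → Set
    Summed s = ∀ w → subtotal (s w) w ≡ ∑ (marks w)

    received-summed : ∀ {s} → Fixed s → Received (S + Λ) s → Summed s
    received-summed {s} fix rec w rewrite links≡ fix w | rest≡ fix w =
      trans (cong (marks w w +_) (∑-cong kids)) (trans (sym (tally-kids w w)) (tally-root w))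
      where
      kids : ∀ c → ⟦ is-just (kid (L w) c w) ⟧ * total (s w) c w ≡ isKid w w c * tally w c
      kids c with kid (L w) c w in isK
      ... | nothing = refl
      ... | just (j , t) = cong (1 *_) (trans (rec isK)
        (mod2^-small (S + Λ + t ∸ S) (<-≤-trans (tally-small isK)
          (^-monoʳ-≤ 2 (≤-trans (m≤m+n Λ t) (≤-reflexive (sym (trans (cong (_∸ S) (+-assoc S Λ t)) (m+n∸m≡n S (Λ + t))))))))))

    verdict-informed : ∀ {s} → Fixed s → Summed s → Informed 0 (oneRound verdict s)
    verdict-informed {s} fix sum {v} {w} eq t≤0 with placed eq
    ... | root refl rewrite ==-refl v = cong₂ (decide v) (rest≡ fix v) (sum v)
    ... | child _ _ _ t′<t _ _ = contradiction (≤-trans t′<t t≤0) λ ()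

    -- The parent of a node with time at most `r + 1` has time at most `r` and so knows the verdict
    -- already.
    down-informed : ∀ {r s} → Fixed s → Informed r s → Informed (suc r) (oneRound down s)
    down-informed {r} {s} fix inf {v} {w} eq t≤ = trans
      (cong (λ l → newFlag (λ p → bitAt (payload (lookup (tabulate (received down s v)) p))) (entryOf l w) (flag (s v) w)) (links≡ fix v))
      (trans (cong (λ x → newFlag (λ p → bitAt (payload (lookup (tabulate (received down s v)) p))) x (flag (s v) w)) eq) (new (placed eq) eq t≤))
      where
      new : ∀ {e} → Placed L v w e → entryOf (L v) w ≡ just e → time e ≤ suc r →
            newFlag (λ p → bitAt (payload (lookup (tabulate (received down s v)) p))) (just e) (flag (s v) w) ≡ outcome w
      new (root _) eq _ = inf eq z≤n
      new (child {j} {p} _ vp eq′ t′<t _ tree) eq t≤ = begin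
        bitAt (payload (lookup (tabulate (received down s v)) p)) j
          ≡⟨ cong (λ q → bitAt (payload q) j) (trans (lookup-tabulate (received down s v) p)
               (cong (λ x → if x then Action.send down p (s p) v else silence) vp)) ⟩
        bitAt (bits W λ j → flag (s p) (kidTree (links (s p)) v j)) j
          ≡⟨ bitAt-bits (λ j → flag (s p) (kidTree (links (s p)) v j)) (slot-bound eq) ⟩
        flag (s p) (kidTree (links (s p)) v j)
          ≡⟨ cong (flag (s p)) (trans (cong (λ l → kidTree l v j) (links≡ fix p)) tree) ⟩
        flag (s p) w
          ≡⟨ inf eq′ (≤-trans (s≤s⁻¹ (≤-trans t′<t t≤)) ≤-refl) ⟩
        outcome w ∎
        where open ≡-Reasoning

    downs-correct : ∀ n {r s} → Fixed s → Informed r s → Summed s →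
                    Fixed (exec (replicate n down) s) × Informed (n + r) (exec (replicate n down) s) ×
                    Summed (exec (replicate n down) s)
    downs-correct zero fix inf sum = fix , inf , sum
    downs-correct (suc n) {r} {s} fix inf sum =
      subst (λ k → Fixed (exec (replicate (suc n) down) s) × Informed k (exec (replicate (suc n) down) s) ×
                   Summed (exec (replicate (suc n) down) s)) (+-suc n r)
        (downs-correct n (record { links≡ = links≡ fix ; rest≡ = rest≡ fix }) (λ {v} {w} {e} → down-informed {r} {s} fix inf {v} {w} {e}) sum)

    counting-correct : ∀ {s} → Fixed s →
      Fixed (exec counting s) × Summed (exec counting s) ×
      (∀ {v w e} → entryOf (L v) w ≡ just e → flag (exec counting s v) w ≡ outcome w)
    counting-correct {s} fix
      rewrite exec-++ (ups 0 (S + Λ)) (verdict ∷ replicate S down) (oneRound reset s) =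
      proj₁ downs , proj₂ (proj₂ downs) ,
      λ eq → proj₁ (proj₂ downs) eq (≤-trans (time-bound eq) (≤-reflexive (sym (+-identityʳ S))))
      where
      s₁ = oneRound reset s
      s₂ = exec (ups 0 (S + Λ)) s₁
      fix₁ : Fixed s₁
      fix₁ = record { links≡ = links≡ fix ; rest≡ = rest≡ fix }
      rec₁ : Received 0 s₁
      -- No time exceeds `S`, so at `r = 0` the claim concerns residues modulo 1, and the totals
      -- just reset to 0 satisfy it.
      rec₁ {c = c} {w} isK rewrite m≤n⇒m∸n≡0 (time-bound (kid-entry isK)) = sym (n%1≡0 (tally w c))
      ups₂ = ups-correct (S + Λ) 0 fix₁ (λ {p} {c} {w} {j} {t} → rec₁ {p} {c} {w} {j} {t})
      fix₂ = proj₁ ups₂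
      sum₂ : Summed s₂
      sum₂ = received-summed fix₂ (subst (λ k → Received k s₂) (+-identityʳ (S + Λ)) (λ {p} {c} {w} {j} {t} → proj₂ ups₂ {p} {c} {w} {j} {t}))
      fix₃ : Fixed (oneRound verdict s₂)
      fix₃ = record { links≡ = links≡ fix₂ ; rest≡ = rest≡ fix₂ }
      downs = downs-correct S {0} fix₃ (λ {v} {w} {e} → verdict-informed {s₂} fix₂ sum₂ {v} {w} {e}) sum₂

-- The competition of clusters

≤ᵇ-true : ∀ {m n} → (m ≤ᵇ n) ≡ true → m ≤ n
≤ᵇ-true eq = ≤ᵇ⇒≤ _ _ (subst T (sym eq) tt)

≤ᵇ-false : ∀ {m n} → (m ≤ᵇ n) ≡ false → n < m
≤ᵇ-false eq = ≰⇒> λ le → subst T eq (≤⇒≤ᵇ le)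

-- Bits beyond the length are 0, so levels need no upper bound.
bit : ∀ {b} → Id b → ℕ → ℕ
bit []      _       = 0
bit (x ∷ v) zero    = ⟦ x ⟧
bit (x ∷ v) (suc k) = bit v k

bit≤1 : ∀ {b} (v : Id b) k → bit v k ≤ 1
bit≤1 []      k       = z≤n
bit≤1 (x ∷ v) zero    = ⟦⟧≤1 x
bit≤1 (x ∷ v) (suc k) = bit≤1 v k

bit-ext : ∀ {b} (v w : Id b) → (∀ k → k < b → bit v k ≡ bit w k) → v ≡ w
bit-ext []      []      _  = refl
bit-ext (x ∷ v) (y ∷ w) eq = cong₂ _∷_ (head x y (eq 0 z<s)) (bit-ext v w λ k k<b → eq (suc k) (s<s k<b))
  where
  head : ∀ x y → ⟦ x ⟧ ≡ ⟦ y ⟧ → x ≡ y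
  head true  true  _ = refl
  head false false _ = refl

key : ∀ {b} → Id b → ℕ → ℕ
key w l = 2 * l + bit w l

2*-reflects : ∀ {x y} → 2 * x ≤ suc (2 * y) → x ≤ y
2*-reflects {x} {y} le = ≮⇒≥ λ y<x → <⇒≱ (s≤s le) (≤-trans (≤-reflexive (lemma y)) (*-monoʳ-≤ 2 y<x))
  where
  lemma : ∀ y → suc (suc (2 * y)) ≡ 2 * suc y
  lemma = solve-∀

key-level : ∀ {b} {w w′ : Id b} {l l′} → key w l ≤ key w′ l′ → l ≤ l′
key-level {w = w} {w′} {l} {l′} le = 2*-reflects (begin
  2 * l              ≤⟨ m≤m+n _ _ ⟩
  key w l            ≤⟨ le ⟩
  2 * l′ + bit w′ l′ ≤⟨ +-monoʳ-≤ (2 * l′) (bit≤1 w′ l′) ⟩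
  2 * l′ + 1         ≡⟨ +-comm (2 * l′) 1 ⟩
  suc (2 * l′)       ∎)
  where open ≤-Reasoning

record Member (b : ℕ) : Set where
  constructor member
  field
    cluster : Id b
    level   : ℕ
    stalled : Bool

open Member public

rank : ∀ {b} → Member b → ℕ
rank m = key (cluster m) (level m)

record Snapshot (b : ℕ) : Set where
  field
    tree  : Links b
    used  : Id b → Bool
    final : Maybe (Id b)

-- `tokens`, `rootLevel` and `rootStalled` are what a node keeps as the root of
-- the cluster with its own name; `target` is the neighbour in whose cluster it
-- asks to be admitted, with the membership of that neighbour.
record Node (b : ℕ) : Set where
  field
    active      : Bool
    current     : Maybe (Member b)
    target      : Maybe (Id b × Member b)
    tokens      : ℕ
    rootLevel   : ℕ
    rootStalled : Bool
    done        : Maybe (ℕ × Id b)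
    archive     : ℕ → Snapshot b

open Snapshot public
open Node public

aim : ∀ {b} → Maybe (Id b × Member b) → Maybe (Id b)
aim = Maybe.map (cluster ∘ proj₂)

-- Rejected applicants die at once. This is what leaves a cluster that has just stalled without
-- living neighbours of larger key.
settleCurrent : ∀ {b} → (Id b → Bool) → Maybe (Id b × Member b) → Maybe (Member b) → Maybe (Member b)
settleCurrent ok (just (_ , m)) _        = if ok (cluster m) then just (member (cluster m) (level m) false) else nothing
settleCurrent ok nothing        nothing  = nothing
settleCurrent ok nothing        (just m) = just (member (cluster m) (level m) (not (ok (cluster m))))

settleTokens : Bool → Bool → ℕ → ℕ → ℕ
settleTokens ok st t p = if ok then t + p else if st then t else ⌈ t /2⌉

advanceMember : ∀ {b} → Member b → Member b
advanceMember m = member (cluster m) (level m + ⟦ stalled m ⟧) false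

⌈n/2⌉≤1+⌊n/2⌋ : ∀ n → ⌈ n /2⌉ ≤ suc ⌊ n /2⌋
⌈n/2⌉≤1+⌊n/2⌋ zero          = z≤n
⌈n/2⌉≤1+⌊n/2⌋ (suc zero)    = ≤-refl
⌈n/2⌉≤1+⌊n/2⌋ (suc (suc n)) = s≤s (⌈n/2⌉≤1+⌊n/2⌋ n)

n≤2*⌈n/2⌉ : ∀ n → n ≤ 2 * ⌈ n /2⌉
n≤2*⌈n/2⌉ n = begin
  n                    ≡⟨ ⌊n/2⌋+⌈n/2⌉≡n n ⟨
  ⌊ n /2⌋ + ⌈ n /2⌉    ≤⟨ +-monoˡ-≤ _ (⌊n/2⌋≤⌈n/2⌉ n) ⟩
  ⌈ n /2⌉ + ⌈ n /2⌉    ≡⟨ cong (⌈ n /2⌉ +_) (+-identityʳ _) ⟨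
  2 * ⌈ n /2⌉          ∎
  where open ≤-Reasoning

-- For a rejecting cluster `x` is `M` times the number of applicants, the cost of their deaths.
-- Rounding up is harmless because `3 * ⌈ t /2⌉` is at most `2 * t + 1` and the strict inequality
-- absorbs the extra unit.
halving : ∀ {x} t → x < t → 3 * ⌈ t /2⌉ + x ≤ 3 * t
halving {x} t x<t = s≤s⁻¹ (begin
  suc (3 * ⌈ t /2⌉ + x)        ≡⟨ +-suc _ x ⟨
  3 * ⌈ t /2⌉ + suc x          ≤⟨ +-monoʳ-≤ (3 * ⌈ t /2⌉) x<t ⟩
  3 * ⌈ t /2⌉ + t              ≤⟨ +-monoˡ-≤ t (begin
    3 * ⌈ t /2⌉                        ≡⟨ *-distribʳ-+ ⌈ t /2⌉ 1 2 ⟩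
    1 * ⌈ t /2⌉ + 2 * ⌈ t /2⌉          ≡⟨ cong (_+ 2 * ⌈ t /2⌉) (*-identityˡ ⌈ t /2⌉) ⟩
    ⌈ t /2⌉ + 2 * ⌈ t /2⌉              ≤⟨ +-monoˡ-≤ (2 * ⌈ t /2⌉) (≤-trans (⌈n/2⌉≤1+⌊n/2⌋ t) (s≤s (m≤m+n _ _))) ⟩
    suc (2 * ⌊ t /2⌋ + 2 * ⌈ t /2⌉)    ≡⟨ cong suc (*-distribˡ-+ 2 ⌊ t /2⌋ ⌈ t /2⌉) ⟨
    suc (2 * (⌊ t /2⌋ + ⌈ t /2⌉))      ≡⟨ cong (λ x → suc (2 * x)) (⌊n/2⌋+⌈n/2⌉≡n t) ⟩
    suc (2 * t)                        ∎) ⟩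
  suc (2 * t) + t              ≡⟨ lemma t ⟩
  suc (3 * t)                  ∎)
  where
  open ≤-Reasoning
  lemma : ∀ t → suc (2 * t) + t ≡ suc (3 * t)
  lemma = solve-∀

-- Bernoulli's inequality for `(1 + 1/m) ^ k`, with denominators cleared. At `k = m` it says that
-- `m` such factors at least double a quantity.
bernoulli : ∀ m k → m ^ k * (m + k) ≤ m * suc m ^ k
bernoulli m zero    = ≤-reflexive (lemma m)
  where
  lemma : ∀ m → 1 * (m + 0) ≡ m * 1
  lemma = solve-∀
bernoulli m (suc k) = begin
  m * m ^ k * (m + suc k)                     ≤⟨ m≤m+n _ (m ^ k * k) ⟩
  m * m ^ k * (m + suc k) + m ^ k * k         ≡⟨ lemma m (m ^ k) k ⟩
  suc m * (m ^ k * (m + k))                   ≤⟨ *-monoʳ-≤ (suc m) (bernoulli m k) ⟩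
  suc m * (m * suc m ^ k)                     ≡⟨ lemma₂ m (suc m ^ k) ⟩
  m * (suc m * suc m ^ k)                     ∎
  where
  open ≤-Reasoning
  lemma : ∀ m x k → m * x * (m + suc k) + x * k ≡ suc m * (x * (m + k))
  lemma = solve-∀
  lemma₂ : ∀ m x → suc m * (m * x) ≡ m * (suc m * x)
  lemma₂ = solve-∀

2*m^m≤[1+m]^m : ∀ m .{{_ : NonZero m}} → 2 * m ^ m ≤ suc m ^ m
2*m^m≤[1+m]^m m = *-cancelˡ-≤ m (begin
  m * (2 * m ^ m)  ≡⟨ lemma m (m ^ m) ⟩
  m ^ m * (m + m)  ≤⟨ bernoulli m m ⟩
  m * suc m ^ m    ∎)
  where
  open ≤-Reasoning
  lemma : ∀ m x → m * (2 * x) ≡ x * (m + m)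
  lemma = solve-∀

module Clusters {b : ℕ} (M : ℕ) .{{_ : NonZero M}} (adj : Id b → Id b → Bool) where

  weight : Node b → ℕ
  weight x = maybe′ (λ m → 3 * rank m) (if active x then M else 0) (current x)

  -- With denominators cleared, an unstalled cluster has `t * 4 ^ l` at least
  -- `2 ^ i * (1 + 1/M) ^ k`. A stalled cluster is credited with the level that it is about to
  -- reach, and so meets the demand of phase `i + 1` already.
  Growth : ℕ → ℕ → Bool → ℕ → ℕ → Set
  Growth i k true  t l = 2 ^ suc i ≤ t * 4 ^ suc l
  Growth i k false t l = 2 ^ i * suc M ^ k ≤ t * 4 ^ l * M ^ k

  -- Step k of phase i. The weights pay for the dead vertices: a token is worth
  -- three units, and the rank of a vertex is the number of tokens that its
  -- changes of cluster may still create before the level of a cluster rises.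
  record Clustered (i k : ℕ) (ξ : Id b → Node b) : Set where
    field
      home-level   : ∀ {v m} → current (ξ v) ≡ just m → level m ≡ rootLevel (ξ (cluster m))
      home-stalled : ∀ {v m} → current (ξ v) ≡ just m → stalled m ≡ rootStalled (ξ (cluster m))
      home-active  : ∀ {v m} → current (ξ v) ≡ just m → active (ξ (cluster m)) ≡ true
      self-active  : ∀ {v m} → current (ξ v) ≡ just m → active (ξ v) ≡ true
      low          : ∀ w → rootLevel (ξ w) ≤ i
      agree        : ∀ {u v m m′} → adj u v ≡ true → current (ξ u) ≡ just m → current (ξ v) ≡ just m′ →
                     ∀ j → j < level m → j < level m′ → bit (cluster m) j ≡ bit (cluster m′) j
      settled      : ∀ {u v m m′} → adj u v ≡ true → current (ξ u) ≡ just m → stalled m ≡ true →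
                     current (ξ v) ≡ just m′ → rank m′ ≤ rank m
      potential    : 3 * ∑ (tokens ∘ ξ) + ∑ (weight ∘ ξ) ≤ 3 * (3 * i + 2) * ∑ (⟦_⟧ ∘ active ∘ ξ)
      growth       : ∀ {w} → active (ξ w) ≡ true → Growth i k (rootStalled (ξ w)) (tokens (ξ w)) (rootLevel (ξ w))

  IsTarget : (Id b → Node b) → Id b → Maybe (Id b × Member b) → Set
  IsTarget ξ v nothing = ∀ {u m m′} → adj v u ≡ true → current (ξ u) ≡ just m → stalled m ≡ false →
                         current (ξ v) ≡ just m′ → rank m′ ≤ rank m
  IsTarget ξ v (just (u , m)) = adj v u ≡ true × current (ξ u) ≡ just m × stalled m ≡ false ×
    (∃ λ m′ → current (ξ v) ≡ just m′ × rank m < rank m′) ×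
    (∀ {u′ m′} → adj v u′ ≡ true → current (ξ u′) ≡ just m′ → stalled m′ ≡ false → rank m ≤ rank m′)

  module Transition {i k : ℕ} {ξ ξ′ : Id b → Node b} (clustered : Clustered i k ξ)
    (adj-sym : ∀ {u v} → adj u v ≡ true → adj v u ≡ true)
    (tgt : Id b → Maybe (Id b × Member b)) (isTarget : ∀ v → IsTarget ξ v (tgt v)) where

    open Clustered clustered

    proposals : Id b → ℕ
    proposals w = ∑ λ v → ⟦ isEq (aim (tgt v)) w ⟧

    -- An active cluster has a positive number of tokens by `growth`, so it stalls also when nobody
    -- applies.
    accepts : Id b → Bool
    accepts w = not (rootStalled (ξ w)) ∧ (tokens (ξ w) ≤ᵇ M * proposals w)

    module _
      (active≡ : ∀ v → active (ξ′ v) ≡ active (ξ v))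
      (level≡ : ∀ v → rootLevel (ξ′ v) ≡ rootLevel (ξ v))
      (stalled≡ : ∀ v → rootStalled (ξ′ v) ≡ not (accepts v))
      (tokens≡ : ∀ v → tokens (ξ′ v) ≡ settleTokens (accepts v) (rootStalled (ξ v)) (tokens (ξ v)) (proposals v))
      (current≡ : ∀ v → current (ξ′ v) ≡ settleCurrent accepts (tgt v) (current (ξ v))) where

      data Outcome (v : Id b) : Member b → Set where
        stayed : ∀ {m} → tgt v ≡ nothing → current (ξ v) ≡ just m →
                 Outcome v (member (cluster m) (level m) (not (accepts (cluster m))))
        moved  : ∀ {u m} → tgt v ≡ just (u , m) → accepts (cluster m) ≡ true →
                 Outcome v (member (cluster m) (level m) false)

      outcome : ∀ {v m} → current (ξ′ v) ≡ just m → Outcome v m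
      outcome {v} eq with tgt v in eq₁ | current (ξ v) in eq₂ | trans (sym eq) (current≡ v)
      ... | nothing | just m | refl = stayed eq₁ eq₂
      ... | just (u , m) | _ | e with accepts (cluster m) in eq₃
      ...   | true with refl ← e = moved eq₁ eq₃
      outcome {v} eq | just (u , m) | _ | () | false

      target-of : ∀ {v u m} → tgt v ≡ just (u , m) → IsTarget ξ v (just (u , m))
      target-of {v} eq = subst (IsTarget ξ v) eq (isTarget v)

      no-target : ∀ {v} → tgt v ≡ nothing → IsTarget ξ v nothing
      no-target {v} eq = subst (IsTarget ξ v) eq (isTarget v)

      record Origin (v : Id b) (m : Member b) : Set where
        field
          old    : Member b
          was    : current (ξ v) ≡ just old
          rank≤  : rank m ≤ rank old
          level≤ : level m ≤ level old
          bits≡  : ∀ j → j < level m → bit (cluster m) j ≡ bit (cluster old) j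

      -- A vertex moves to an adjacent cluster of smaller key, hence of no higher level, and the two
      -- clusters agree below that level. The bits that matter do not change, so agreement with the
      -- neighbours of the vertex is inherited.
      origin : ∀ {v m} → Outcome v m → Origin v m
      origin (stayed {m} _ eq) = record { old = m ; was = eq ; rank≤ = ≤-refl ; level≤ = ≤-refl ; bits≡ = λ _ _ → refl }
      origin {v} (moved {u} {m} eq _) with adj-vu , cur , _ , (m′ , was , rank<) , _ ← target-of eq =
        record { old = m′ ; was = was ; rank≤ = <⇒≤ rank< ; level≤ = lev≤
               ; bits≡ = λ j j<l → agree (adj-sym adj-vu) cur was j j<l (<-≤-trans j<l lev≤) }
        where
        lev≤ : level m ≤ level m′
        lev≤ = key-level {w = cluster m} {cluster m′} (<⇒≤ rank<)

      agree′ : ∀ {u v m m′} → adj u v ≡ true → current (ξ′ u) ≡ just m → current (ξ′ v) ≡ just m′ →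
               ∀ j → j < level m → j < level m′ → bit (cluster m) j ≡ bit (cluster m′) j
      agree′ uv eq eq′ j j<m j<m′ =
        trans (O.bits≡ j j<m) (trans (agree uv O.was O′.was j (<-≤-trans j<m O.level≤) (<-≤-trans j<m′ O′.level≤))
                                     (sym (O′.bits≡ j j<m′)))
        where
        module O  = Origin (origin (outcome eq))
        module O′ = Origin (origin (outcome eq′))

      -- If the cluster of `u` was stalled before, the key of `v` can only have fallen. If it stalls
      -- now, a neighbour `v` of larger key had a target, whose key was minimal and so no larger
      -- than that of `u`'s cluster; `v` has gone there or has died.
      settled′ : ∀ {u v m m′} → adj u v ≡ true → current (ξ′ u) ≡ just m → stalled m ≡ true →
                 current (ξ′ v) ≡ just m′ → rank m′ ≤ rank m
      settled′ uv eq st eq′ with outcome eq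
      settled′ uv eq () eq′ | moved _ _
      settled′ {u} {v} uv eq st eq′ | stayed {m} _ was with stalled m in eqs
      ... | true = ≤-trans O′.rank≤ (settled uv was eqs O′.was)
        where module O′ = Origin (origin (outcome eq′))
      ... | false with outcome eq′
      ...   | stayed none was′ = no-target none (adj-sym uv) was eqs was′
      ...   | moved some _ = proj₂ (proj₂ (proj₂ (proj₂ (target-of some)))) (adj-sym uv) was eqs

      proposals-stalled : ∀ {w} → rootStalled (ξ w) ≡ true → proposals w ≡ 0
      proposals-stalled {w} st = ∑-zero λ v → none v
        where
        none : ∀ v → ⟦ isEq (aim (tgt v)) w ⟧ ≡ 0
        none v with tgt v in eq
        ... | nothing = refl
        ... | just (u , m) with cluster m ≟ᴵ w
        ...   | no _ = refl
        ...   | yes refl with _ , cur , ns , _ ← target-of eq =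
          contradiction (trans (sym st) (trans (sym (home-stalled cur)) ns)) λ ()

      exchange : (f : Id b → ℕ) → ∑ (λ w → f w * proposals w) ≡ ∑ (λ v → maybe′ f 0 (aim (tgt v)))
      exchange f = begin
        ∑ (λ w → f w * proposals w)                              ≡⟨ ∑-cong (λ w → ∑-* (f w) (λ v → ⟦ isEq (aim (tgt v)) w ⟧)) ⟨
        ∑ (λ w → ∑ λ v → f w * ⟦ isEq (aim (tgt v)) w ⟧)         ≡⟨ ∑-swap (λ w v → f w * ⟦ isEq (aim (tgt v)) w ⟧) ⟩
        ∑ (λ v → ∑ λ w → f w * ⟦ isEq (aim (tgt v)) w ⟧)         ≡⟨ ∑-cong (λ v → trans (∑-cong λ w → *-comm (f w) _) (∑-isEq (aim (tgt v)) f)) ⟩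
        ∑ (λ v → maybe′ f 0 (aim (tgt v)))                       ∎
        where open ≡-Reasoning

      root-balance : ∀ w → 3 * tokens (ξ′ w) + M * (⟦ not (accepts w) ⟧ * proposals w) ≤
                           3 * tokens (ξ w) + 3 * (⟦ accepts w ⟧ * proposals w)
      root-balance w rewrite tokens≡ w with rootStalled (ξ w) in st | tokens (ξ w) ≤ᵇ M * proposals w in eq
      ... | true | _ rewrite proposals-stalled st = ≤-reflexive (lemma (tokens (ξ w)) M)
        where
        lemma : ∀ t M → 3 * t + M * (1 * 0) ≡ 3 * t + 3 * (0 * 0)
        lemma = solve-∀
      ... | false | true = ≤-reflexive (lemma (tokens (ξ w)) M (proposals w))
        where
        lemma : ∀ t M p → 3 * (t + p) + M * (0 * p) ≡ 3 * t + 3 * (1 * p)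
        lemma = solve-∀
      ... | false | false = ≤-trans
        (subst (λ x → 3 * ⌈ tokens (ξ w) /2⌉ + M * x ≤ 3 * tokens (ξ w)) (sym (*-identityˡ (proposals w)))
               (halving (tokens (ξ w)) (≤ᵇ-false eq)))
        (m≤m+n _ _)

      -- The applicant's side of the account: admission lowers its rank by at least one, which frees
      -- the three units for its token, and rejection raises its weight by at most `M`.
      vertex-balance : ∀ v → weight (ξ′ v) + 3 * maybe′ (λ w → ⟦ accepts w ⟧) 0 (aim (tgt v)) ≤
                             weight (ξ v) + M * maybe′ (λ w → ⟦ not (accepts w) ⟧) 0 (aim (tgt v))
      vertex-balance v rewrite current≡ v | active≡ v with tgt v in eq
      ... | nothing with current (ξ v)
      ...   | nothing = +-monoʳ-≤ (if active (ξ v) then M else 0) z≤n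
      ...   | just m  = +-monoʳ-≤ (3 * rank m) z≤n
      vertex-balance v | just (u , m)
        with _ , _ , _ , (m′ , was , rank<) , _ ← target-of eq rewrite was | self-active was with accepts (cluster m)
      ... | true = begin
        3 * rank m + 3 * 1     ≡⟨ *-distribˡ-+ 3 (rank m) 1 ⟨
        3 * (rank m + 1)       ≡⟨ cong (3 *_) (+-comm (rank m) 1) ⟩
        3 * suc (rank m)       ≤⟨ *-monoʳ-≤ 3 rank< ⟩
        3 * rank m′            ≤⟨ m≤m+n _ _ ⟩
        3 * rank m′ + M * 0    ∎
        where open ≤-Reasoning
      ... | false = ≤-trans (≤-reflexive (trans (+-identityʳ M) (sym (*-identityʳ M)))) (m≤n+m (M * 1) (3 * rank m′))

      potential′ : 3 * ∑ (tokens ∘ ξ′) + ∑ (weight ∘ ξ′) ≤ 3 * (3 * i + 2) * ∑ (⟦_⟧ ∘ active ∘ ξ′)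
      potential′ = begin
        3 * ∑ (tokens ∘ ξ′) + ∑ (weight ∘ ξ′)  ≤⟨ +-cancelʳ-≤ (M * B + 3 * A) _ _ both ⟩
        3 * ∑ (tokens ∘ ξ) + ∑ (weight ∘ ξ)    ≤⟨ potential ⟩
        3 * (3 * i + 2) * ∑ (⟦_⟧ ∘ active ∘ ξ) ≡⟨ cong (3 * (3 * i + 2) *_) (∑-cong (λ v → cong ⟦_⟧ (active≡ v))) ⟨
        3 * (3 * i + 2) * ∑ (⟦_⟧ ∘ active ∘ ξ′) ∎
        where
        open ≤-Reasoning
        A = ∑ λ w → ⟦ accepts w ⟧ * proposals w
        B = ∑ λ w → ⟦ not (accepts w) ⟧ * proposals w
        linear : ∀ k (f : Id b → ℕ) l (g : Id b → ℕ) → ∑ (λ v → k * f v + l * g v) ≡ k * ∑ f + l * ∑ g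
        linear k f l g = trans (∑-+ (λ v → k * f v) (λ v → l * g v)) (cong₂ _+_ (∑-* k f) (∑-* l g))
        roots : 3 * ∑ (tokens ∘ ξ′) + M * B ≤ 3 * ∑ (tokens ∘ ξ) + 3 * A
        roots = subst₂ _≤_ (linear 3 (tokens ∘ ξ′) M (λ w → ⟦ not (accepts w) ⟧ * proposals w))
                           (linear 3 (tokens ∘ ξ) 3 (λ w → ⟦ accepts w ⟧ * proposals w)) (∑-mono root-balance)
        vertices : ∑ (weight ∘ ξ′) + 3 * A ≤ ∑ (weight ∘ ξ) + M * B
        vertices = subst₂ _≤_ (sum ξ′ 3 (λ w → ⟦ accepts w ⟧)) (sum ξ M (λ w → ⟦ not (accepts w) ⟧)) (∑-mono vertex-balance)
          where
          sum : ∀ ζ k (f : Id b → ℕ) → ∑ (λ v → weight (ζ v) + k * maybe′ f 0 (aim (tgt v))) ≡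
                ∑ (weight ∘ ζ) + k * ∑ (λ w → f w * proposals w)
          sum ζ k f = trans (∑-+ (weight ∘ ζ) (λ v → k * maybe′ f 0 (aim (tgt v))))
            (cong (∑ (weight ∘ ζ) +_) (trans (∑-* k (λ v → maybe′ f 0 (aim (tgt v)))) (cong (k *_) (sym (exchange f)))))
        shuffle : ∀ t w x y → t + w + (x + y) ≡ (t + x) + (w + y)
        shuffle = solve-∀
        shuffle₂ : ∀ t w x y → (t + y) + (w + x) ≡ t + w + (x + y)
        shuffle₂ = solve-∀
        -- The payments `A` and `B` between roots and applicants are counted once by root and once
        -- by applicant, and cancel.
        both : 3 * ∑ (tokens ∘ ξ′) + ∑ (weight ∘ ξ′) + (M * B + 3 * A) ≤ 3 * ∑ (tokens ∘ ξ) + ∑ (weight ∘ ξ) + (M * B + 3 * A)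
        both = subst₂ _≤_ (sym (shuffle (3 * ∑ (tokens ∘ ξ′)) (∑ (weight ∘ ξ′)) (M * B) (3 * A)))
                          (shuffle₂ (3 * ∑ (tokens ∘ ξ)) (∑ (weight ∘ ξ)) (M * B) (3 * A)) (+-mono-≤ roots vertices)

      -- Admission means `t ≤ M * p`, so the new `t + p` gains the factor `1 + 1/M`. After a
      -- rejection at least half of `t` is left, and the stalled form of `Growth` counts one level
      -- more: a factor `4 / 2`.
      growth′ : ∀ {w} → active (ξ′ w) ≡ true → Growth i (suc k) (rootStalled (ξ′ w)) (tokens (ξ′ w)) (rootLevel (ξ′ w))
      growth′ {w} act rewrite active≡ w | level≡ w | stalled≡ w | tokens≡ w
        with rootStalled (ξ w) | growth act | tokens (ξ w) ≤ᵇ M * proposals w in eq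
      ... | true  | g | _ = g
      ... | false | g | true = begin
        2 ^ i * (suc M * suc M ^ k)                         ≡⟨ lemma₁ (2 ^ i) M (suc M ^ k) ⟩
        (2 ^ i * suc M ^ k) * suc M                         ≤⟨ *-monoˡ-≤ (suc M) g ⟩
        t * 4 ^ l * M ^ k * suc M                           ≡⟨ lemma₂ t (4 ^ l) (M ^ k) M ⟩
        (t * M + t) * (4 ^ l * M ^ k)                       ≤⟨ *-monoˡ-≤ (4 ^ l * M ^ k) (+-monoʳ-≤ (t * M) (≤ᵇ-true eq)) ⟩
        (t * M + M * p) * (4 ^ l * M ^ k)                   ≡⟨ lemma₃ t (4 ^ l) (M ^ k) M p ⟩
        (t + p) * 4 ^ l * (M * M ^ k)                       ∎
        where
        open ≤-Reasoning
        t = tokens (ξ w)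
        l = rootLevel (ξ w)
        p = proposals w
        lemma₁ : ∀ x M y → x * (suc M * y) ≡ (x * y) * suc M
        lemma₁ = solve-∀
        lemma₂ : ∀ t x y M → t * x * y * suc M ≡ (t * M + t) * (x * y)
        lemma₂ = solve-∀
        lemma₃ : ∀ t x y M p → (t * M + M * p) * (x * y) ≡ (t + p) * x * (M * y)
        lemma₃ = solve-∀
      ... | false | g | false = begin
        2 * 2 ^ i                      ≤⟨ *-monoʳ-≤ 2 cancelled ⟩
        2 * (t * 4 ^ l)                ≤⟨ *-monoʳ-≤ 2 (*-monoˡ-≤ (4 ^ l) (n≤2*⌈n/2⌉ t)) ⟩
        2 * (2 * ⌈ t /2⌉ * 4 ^ l)      ≡⟨ lemma ⌈ t /2⌉ (4 ^ l) ⟩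
        ⌈ t /2⌉ * (4 * 4 ^ l)          ∎
        where
        open ≤-Reasoning
        t = tokens (ξ w)
        l = rootLevel (ξ w)
        lemma : ∀ t x → 2 * (2 * t * x) ≡ t * (4 * x)
        lemma = solve-∀
        cancelled : 2 ^ i ≤ t * 4 ^ l
        cancelled = *-cancelʳ-≤ (2 ^ i) (t * 4 ^ l) (M ^ k) {{m^n≢0 M k}}
                      (≤-trans (*-monoʳ-≤ (2 ^ i) (^-monoˡ-≤ k (n≤1+n M))) g)

      transition : Clustered i (suc k) ξ′
      transition = record
        { home-level   = λ eq → home-level′ (outcome eq)
        ; home-stalled = λ eq → home-stalled′ (outcome eq)
        ; home-active  = λ eq → home-active′ (outcome eq)
        ; self-active  = λ {v} eq → trans (active≡ v) (self-active (Origin.was (origin (outcome eq))))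
        ; low          = λ w → subst (_≤ i) (sym (level≡ w)) (low w)
        ; agree        = agree′
        ; settled      = settled′
        ; potential    = potential′
        ; growth       = growth′
        }
        where
        home-level′ : ∀ {v m} → Outcome v m → level m ≡ rootLevel (ξ′ (cluster m))
        home-level′ (stayed _ was)    = trans (home-level was) (sym (level≡ _))
        home-level′ (moved some _) = trans (home-level (proj₁ (proj₂ (target-of some)))) (sym (level≡ _))
        home-stalled′ : ∀ {v m} → Outcome v m → stalled m ≡ rootStalled (ξ′ (cluster m))
        home-stalled′ (stayed _ _) = sym (stalled≡ _)
        home-stalled′ (moved {m = m} _ ok) = sym (trans (stalled≡ (cluster m)) (cong not ok))
        home-active′ : ∀ {v m} → Outcome v m → active (ξ′ (cluster m)) ≡ true
        home-active′ (stayed _ was)    = trans (active≡ _) (home-active was)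
        home-active′ (moved some _) = trans (active≡ _) (home-active (proj₁ (proj₂ (target-of some))))

-- The start, the end of a phase, and the end of the competition

map-just : ∀ {A B : Set} {f : A → B} {x y} → Maybe.map f x ≡ just y → ∃ λ a → x ≡ just a × f a ≡ y
map-just {x = just a} refl = a , refl , refl

-- Two for the level and one for the bit at the new level. This 3 reappears as the `3 * i` of the
-- potential and of the slots.
rank-advance : ∀ {b} (m : Member b) → rank (advanceMember m) ≤ rank m + 3
rank-advance m = begin
  2 * (level m + ⟦ stalled m ⟧) + bit (cluster m) _  ≤⟨ +-mono-≤ (*-monoʳ-≤ 2 (+-monoʳ-≤ (level m) (⟦⟧≤1 (stalled m)))) (bit≤1 (cluster m) _) ⟩
  2 * (level m + 1) + 1                              ≡⟨ lemma (level m) ⟩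
  2 * level m + 3                                    ≤⟨ +-monoˡ-≤ 3 (m≤m+n _ _) ⟩
  rank m + 3                                         ∎
  where
  open ≤-Reasoning
  lemma : ∀ l → 2 * (l + 1) + 1 ≡ 2 * l + 3
  lemma = solve-∀

module Phases {b : ℕ} (M : ℕ) .{{_ : NonZero M}} (adj : Id b → Id b → Bool) where
  open Clusters {b} M adj

  start : ∀ {ξ} → (∀ v → current (ξ v) ≡ (if active (ξ v) then just (member v 0 false) else nothing)) →
          (∀ v → tokens (ξ v) ≡ ⟦ active (ξ v) ⟧) → (∀ v → rootLevel (ξ v) ≡ 0) → (∀ v → rootStalled (ξ v) ≡ false) →
          Clustered 0 0 ξ
  start {ξ} current≡ tokens≡ level≡ stalled≡ = record
    { home-level   = λ eq → case known eq of λ { (_ , refl) → sym (level≡ _) }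
    ; home-stalled = λ eq → case known eq of λ { (_ , refl) → sym (stalled≡ _) }
    ; home-active  = λ eq → case known eq of λ { (act , refl) → act }
    ; self-active  = λ eq → proj₁ (known eq)
    ; low          = λ w → ≤-reflexive (level≡ w)
    ; agree        = λ _ eq _ j j< → case trans (cong level (proj₂ (known eq))) refl of λ l → contradiction (subst (j <_) (sym l) j<) λ ()
    ; settled      = λ _ eq st → case trans (sym st) (cong stalled (sym (proj₂ (known eq)))) of λ ()
    ; potential    = begin
        3 * ∑ (tokens ∘ ξ) + ∑ (weight ∘ ξ)                     ≤⟨ +-mono-≤ (≤-reflexive (cong (3 *_) (∑-cong tokens≡))) (≤-trans (∑-mono weight≤) (≤-reflexive (∑-* 3 (⟦_⟧ ∘ active ∘ ξ)))) ⟩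
        3 * ∑ (⟦_⟧ ∘ active ∘ ξ) + 3 * ∑ (⟦_⟧ ∘ active ∘ ξ)     ≡⟨ *-distribʳ-+ (∑ (⟦_⟧ ∘ active ∘ ξ)) 3 3 ⟨
        6 * ∑ (⟦_⟧ ∘ active ∘ ξ)                                ∎
    ; growth       = λ {w} act → grow w act
    }
    where
    open ≤-Reasoning
    known : ∀ {v m} → current (ξ v) ≡ just m → active (ξ v) ≡ true × member v 0 false ≡ m
    known {v} eq with active (ξ v) | trans (sym (current≡ v)) eq
    ... | true | refl = refl , refl
    weight≤ : ∀ v → weight (ξ v) ≤ 3 * ⟦ active (ξ v) ⟧
    weight≤ v rewrite current≡ v with active (ξ v)
    ... | false = z≤n
    ... | true  = *-monoʳ-≤ 3 (bit≤1 v 0)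
    grow : ∀ w → active (ξ w) ≡ true → Growth 0 0 (rootStalled (ξ w)) (tokens (ξ w)) (rootLevel (ξ w))
    grow w act rewrite stalled≡ w | level≡ w | tokens≡ w | act = ≤-refl

  advance : ∀ {i ξ ξ′} → Clustered i M ξ → (∀ {u v} → adj u v ≡ true → adj v u ≡ true) →
            (∀ v → active (ξ′ v) ≡ active (ξ v)) → (∀ v → tokens (ξ′ v) ≡ tokens (ξ v)) →
            (∀ v → rootLevel (ξ′ v) ≡ rootLevel (ξ v) + ⟦ rootStalled (ξ v) ⟧) → (∀ v → rootStalled (ξ′ v) ≡ false) →
            (∀ v → current (ξ′ v) ≡ Maybe.map advanceMember (current (ξ v))) →
            Clustered (suc i) 0 ξ′
  advance {i} {ξ} {ξ′} clustered adj-sym active≡ tokens≡ level≡ stalled≡ current≡ = record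
    { home-level   = λ eq → case before eq of λ { (m , was , refl) →
                       trans (cong₂ (λ x y → x + ⟦ y ⟧) (home-level was) (home-stalled was)) (sym (level≡ _)) }
    ; home-stalled = λ eq → case before eq of λ { (m , was , refl) → sym (stalled≡ _) }
    ; home-active  = λ eq → case before eq of λ { (m , was , refl) → trans (active≡ _) (home-active was) }
    ; self-active  = λ {v} eq → case before eq of λ { (m , was , refl) → trans (active≡ v) (self-active was) }
    ; low          = λ w → subst (_≤ suc i) (sym (level≡ w)) (≤-trans (+-mono-≤ (low w) (⟦⟧≤1 (rootStalled (ξ w)))) (≤-reflexive (+-comm i 1)))
    ; agree        = λ uv eq eq′ → case before eq of λ { (m , was , refl) → case before eq′ of λ { (m′ , was′ , refl) → agree′ uv was was′ } }
    ; settled      = λ _ eq st _ → case before eq of λ { (m , was , refl) → case st of λ () }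
    ; potential    = potential′
    ; growth       = λ {w} → growth′ w
    }
    where
    open Clustered clustered
    before : ∀ {v m} → current (ξ′ v) ≡ just m → ∃ λ m₀ → current (ξ v) ≡ just m₀ × advanceMember m₀ ≡ m
    before {v} eq = map-just (trans (sym (current≡ v)) eq)
    rank-below : ∀ {u v m m′} → adj u v ≡ true → current (ξ u) ≡ just m → stalled m ≡ true → current (ξ v) ≡ just m′ →
                 level m′ ≤ level m
    rank-below {m = m} {m′} uv was st was′ = key-level {w = cluster m′} {cluster m} (settled uv was st was′)
    -- Beside an unstalled cluster, a stalled one has no lower level, so no new bit has to be
    -- compared. Two adjacent stalled clusters have equal keys by `settled` in both directions, so
    -- they share the level and, by cancelling it, the bit there.
    agree′ : ∀ {u v m m′} → adj u v ≡ true → current (ξ u) ≡ just m → current (ξ v) ≡ just m′ →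
             ∀ j → j < level m + ⟦ stalled m ⟧ → j < level m′ + ⟦ stalled m′ ⟧ → bit (cluster m) j ≡ bit (cluster m′) j
    agree′ {m = m} {m′} uv was was′ j j< j<′ with stalled m in st | stalled m′ in st′
    ... | false | false = agree uv was was′ j (subst (j <_) (+-identityʳ _) j<) (subst (j <_) (+-identityʳ _) j<′)
    ... | true  | false = agree uv was was′ j (<-≤-trans j<m′ (rank-below uv was st was′)) j<m′
      where j<m′ = subst (j <_) (+-identityʳ _) j<′
    ... | false | true  = agree uv was was′ j j<m (<-≤-trans j<m (rank-below (adj-sym uv) was′ st′ was))
      where j<m = subst (j <_) (+-identityʳ _) j<
    ... | true  | true  with m≤n⇒m<n∨m≡n (s≤s⁻¹ (subst (j <_) (+-comm (level m) 1) j<))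
    ...   | inj₁ j<m = agree uv was was′ j j<m (subst (j <_) same j<m)
      where
      same : level m ≡ level m′
      same = ≤-antisym (rank-below (adj-sym uv) was′ st′ was) (rank-below uv was st was′)
    ...   | inj₂ refl = +-cancelˡ-≡ (2 * level m) _ _ (trans (≤-antisym (settled (adj-sym uv) was′ st′ was) (settled uv was st was′))
                          (cong (λ l → 2 * l + bit (cluster m′) l) (sym same)))
      where
      same : level m ≡ level m′
      same = ≤-antisym (rank-below (adj-sym uv) was′ st′ was) (rank-below uv was st was′)
    weight-advance : ∀ v → weight (ξ′ v) ≤ weight (ξ v) + 9 * ⟦ active (ξ v) ⟧
    weight-advance v rewrite current≡ v | active≡ v with current (ξ v) in was
    ... | nothing = m≤m+n _ _
    ... | just m rewrite self-active was =
      ≤-trans (*-monoʳ-≤ 3 (rank-advance m)) (≤-reflexive (*-distribˡ-+ 3 (rank m) 3))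
    potential′ : 3 * ∑ (tokens ∘ ξ′) + ∑ (weight ∘ ξ′) ≤ 3 * (3 * suc i + 2) * ∑ (⟦_⟧ ∘ active ∘ ξ′)
    potential′ = begin
      3 * ∑ (tokens ∘ ξ′) + ∑ (weight ∘ ξ′)                       ≤⟨ +-mono-≤ (≤-reflexive (cong (3 *_) (∑-cong tokens≡))) (∑-mono weight-advance) ⟩
      3 * ∑ (tokens ∘ ξ) + ∑ (λ v → weight (ξ v) + 9 * ⟦ active (ξ v) ⟧)
        ≡⟨ cong (3 * ∑ (tokens ∘ ξ) +_) (trans (∑-+ (weight ∘ ξ) (λ v → 9 * ⟦ active (ξ v) ⟧)) (cong (∑ (weight ∘ ξ) +_) (∑-* 9 (⟦_⟧ ∘ active ∘ ξ)))) ⟩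
      3 * ∑ (tokens ∘ ξ) + (∑ (weight ∘ ξ) + 9 * A)               ≡⟨ +-assoc (3 * ∑ (tokens ∘ ξ)) (∑ (weight ∘ ξ)) (9 * A) ⟨
      3 * ∑ (tokens ∘ ξ) + ∑ (weight ∘ ξ) + 9 * A                 ≤⟨ +-monoˡ-≤ (9 * A) potential ⟩
      3 * (3 * i + 2) * A + 9 * A                                 ≡⟨ lemma i A ⟩
      3 * (3 * suc i + 2) * A                                     ≡⟨ cong (3 * (3 * suc i + 2) *_) (∑-cong (λ v → cong ⟦_⟧ (active≡ v))) ⟨
      3 * (3 * suc i + 2) * ∑ (⟦_⟧ ∘ active ∘ ξ′)                 ∎
      where
      open ≤-Reasoning
      A = ∑ (⟦_⟧ ∘ active ∘ ξ)
      lemma : ∀ i A → 3 * (3 * i + 2) * A + 9 * A ≡ 3 * (3 * suc i + 2) * A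
      lemma = solve-∀
    growth′ : ∀ w → active (ξ′ w) ≡ true → Growth (suc i) 0 (rootStalled (ξ′ w)) (tokens (ξ′ w)) (rootLevel (ξ′ w))
    growth′ w act rewrite active≡ w | level≡ w | stalled≡ w | tokens≡ w with rootStalled (ξ w) | growth act
    ... | true  | g rewrite +-comm (rootLevel (ξ w)) 1 =
      ≤-trans (≤-reflexive (*-identityʳ (2 ^ suc i))) (≤-trans g (≤-reflexive (sym (*-identityʳ _))))
    ... | false | g rewrite +-identityʳ (rootLevel (ξ w)) =
      ≤-trans (≤-reflexive (*-identityʳ (2 ^ suc i))) (≤-trans doubled (≤-reflexive (sym (*-identityʳ _))))
      where
      open ≤-Reasoning
      T′ = tokens (ξ w) * 4 ^ rootLevel (ξ w)
      lemma : ∀ x y → 2 * x * y ≡ x * (2 * y)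
      lemma = solve-∀
      doubled : 2 * 2 ^ i ≤ T′
      doubled = *-cancelʳ-≤ (2 * 2 ^ i) T′ (M ^ M) {{m^n≢0 M M}} (begin
        2 * 2 ^ i * M ^ M     ≡⟨ lemma (2 ^ i) (M ^ M) ⟩
        2 ^ i * (2 * M ^ M)   ≤⟨ *-monoʳ-≤ (2 ^ i) (2*m^m≤[1+m]^m M) ⟩
        2 ^ i * suc M ^ M     ≤⟨ g ⟩
        T′ * M ^ M            ∎)

  module Finish {R : ℕ} {ξ : Id b → Node b} (clustered : Clustered R 0 ξ)
                (M≡ : M ≡ 6 * (3 * R + 2)) (large : 2 * ((3 * R + 2) * 2 ^ b * 4 ^ b) < 2 ^ R) where
    open Clustered clustered

    private
      A = ∑ (⟦_⟧ ∘ active ∘ ξ)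
      W = 3 * R + 2

    tokens-small : ∀ w → tokens (ξ w) ≤ W * 2 ^ b
    tokens-small w = *-cancelˡ-≤ 3 (begin
      3 * tokens (ξ w)                       ≤⟨ *-monoʳ-≤ 3 (term≤∑ (tokens ∘ ξ) w) ⟩
      3 * ∑ (tokens ∘ ξ)                     ≤⟨ m≤m+n _ _ ⟩
      3 * ∑ (tokens ∘ ξ) + ∑ (weight ∘ ξ)    ≤⟨ potential ⟩
      3 * W * A                              ≤⟨ *-monoʳ-≤ (3 * W) (≤-trans (∑-mono λ v → ⟦⟧≤1 (active (ξ v))) (≤-reflexive (∑-1 {b}))) ⟩
      3 * W * 2 ^ b                          ≡⟨ *-assoc 3 W (2 ^ b) ⟩
      3 * (W * 2 ^ b)                        ∎)
      where open ≤-Reasoning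

    -- At a level below `b`, growth would require more tokens than the potential permits; this is
    -- the inequality `large`.
    complete : ∀ {w} → active (ξ w) ≡ true → b ≤ rootLevel (ξ w)
    complete {w} act = ≮⇒≥ λ short → <⇒≱ large (begin
      2 ^ R                                           ≤⟨ grown (rootStalled (ξ w)) (growth act) ⟩
      2 * (tokens (ξ w) * 4 ^ rootLevel (ξ w))        ≤⟨ *-monoʳ-≤ 2 (*-mono-≤ (tokens-small w) (^-monoʳ-≤ 4 (<⇒≤ short))) ⟩
      2 * (W * 2 ^ b * 4 ^ b)                         ∎)
      where
      open ≤-Reasoning
      lemma : ∀ t x → t * (4 * x) ≡ 2 * (2 * (t * x))
      lemma = solve-∀
      grown : ∀ st {t l} → Growth R 0 st t l → 2 ^ R ≤ 2 * (t * 4 ^ l)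
      grown true  {t} {l} g = *-cancelˡ-≤ 2 (≤-trans g (≤-reflexive (lemma t (4 ^ l))))
      grown false {t} {l} g = ≤-trans (≤-reflexive (sym (*-identityʳ (2 ^ R)))) (≤-trans g (≤-trans (≤-reflexive (*-identityʳ (t * 4 ^ l))) (m≤m+n (t * 4 ^ l) _)))

    separated : ∀ {u v m m′} → adj u v ≡ true → current (ξ u) ≡ just m → current (ξ v) ≡ just m′ → cluster m ≡ cluster m′
    separated uv eq eq′ = bit-ext _ _ λ j j<b → agree uv eq eq′ j (<-≤-trans j<b (full eq)) (<-≤-trans j<b (full eq′))
      where
      full : ∀ {v m} → current (ξ v) ≡ just m → b ≤ level m
      full eq = subst (b ≤_) (sym (home-level eq)) (complete (home-active eq))

    dead : Id b → ℕ
    dead v = ⟦ active (ξ v) ∧ is-nothing (current (ξ v)) ⟧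

    -- Every dead vertex holds `M = 6 * W` units of a potential of at most `3 * W * A`.
    half-survives : 2 * ∑ dead ≤ A
    half-survives = *-cancelˡ-≤ (3 * W) {{m*n≢0 3 W {{_}} {{≢-nonZero λ eq → case trans (+-comm 2 (3 * R)) eq of λ ()}}}} (begin
      3 * W * (2 * ∑ dead)                   ≡⟨ lemma W (∑ dead) ⟩
      6 * W * ∑ dead                         ≡⟨ cong (_* ∑ dead) M≡ ⟨
      M * ∑ dead                             ≡⟨ ∑-* M dead ⟨
      ∑ (λ v → M * dead v)                   ≤⟨ ∑-mono weigh ⟩
      ∑ (weight ∘ ξ)                         ≤⟨ m≤n+m _ _ ⟩
      3 * ∑ (tokens ∘ ξ) + ∑ (weight ∘ ξ)    ≤⟨ potential ⟩
      3 * W * A                              ∎)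
      where
      open ≤-Reasoning
      lemma : ∀ w d → 3 * w * (2 * d) ≡ 6 * w * d
      lemma = solve-∀
      weigh : ∀ v → M * dead v ≤ weight (ξ v)
      weigh v with current (ξ v) | active (ξ v)
      ... | nothing | true  = ≤-reflexive (*-identityʳ M)
      ... | nothing | false = ≤-reflexive (*-zeroʳ M)
      ... | just _  | true  = ≤-trans (≤-reflexive (*-zeroʳ M)) z≤n
      ... | just _  | false = ≤-trans (≤-reflexive (*-zeroʳ M)) z≤n

-- Growth of the trees

≡ᵇ-refl : ∀ n → (n ≡ᵇ n) ≡ true
≡ᵇ-refl zero    = refl
≡ᵇ-refl (suc n) = ≡ᵇ-refl n

<⇒≢ᵇ : ∀ {m n} → m < n → (m ≡ᵇ n) ≡ false
<⇒≢ᵇ {zero}  {suc n} _         = refl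
<⇒≢ᵇ {suc m} {suc n} (s≤s m<n) = <⇒≢ᵇ m<n

-- Each slot is used once: 3 i + 1 minus the rank of its cluster grows whenever a
-- vertex moves, and never falls from one phase i to the next.
slotFor : ∀ {b} → ℕ → Member b → ℕ
slotFor i m = suc (3 * i) ∸ rank m

rank-bound : ∀ {b i} (m : Member b) → level m ≤ i → rank m ≤ suc (3 * i)
rank-bound {i = i} m l≤i = begin
  2 * level m + bit (cluster m) (level m)  ≤⟨ +-mono-≤ (*-mono-≤ (n≤1+n 2) l≤i) (bit≤1 (cluster m) (level m)) ⟩
  3 * i + 1                                ≡⟨ +-comm (3 * i) 1 ⟩
  suc (3 * i)                              ∎
  where open ≤-Reasoning

-- A vertex remains in the trees of the clusters that it has left. If it applies to one of them
-- again, it keeps its old place there, so times and slots are never rewritten.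
joining : ∀ {b} → Links b → Maybe (Id b × Member b) → Maybe (Id b × Member b)
joining l nothing        = nothing
joining l (just (p , m)) = if is-nothing (entryOf l (cluster m)) then just (p , m) else nothing

asksFor : ∀ {b} → Maybe (Id b × Member b) → Id b → Bool
asksFor nothing        _ = false
asksFor (just (q , _)) p = q == p

module _ {b : ℕ} (i τ : ℕ) where

  newEntry : Maybe (Id b × Member b) → Id b → Maybe (Entry b) → Maybe (Entry b)
  newEntry nothing        w old = old
  newEntry (just (p , m)) w old = if w == cluster m then just (entry (slotFor i m) (just p) (suc τ)) else old

  newTree : Maybe (Id b × Member b) → ℕ → Id b → Id b
  newTree nothing        j old = old
  newTree (just (p , m)) j old = if j ≡ᵇ slotFor i m then cluster m else old

  newKid : Maybe (Member b) → Bool → Id b → Maybe (ℕ × ℕ) → Maybe (ℕ × ℕ)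
  newKid nothing  _   w old = old
  newKid (just m) ask w old = if ask ∧ (w == cluster m) then just (slotFor i m , suc τ) else old

  newKidTree : Maybe (Member b) → Bool → ℕ → Id b → Id b
  newKidTree nothing  _   j old = old
  newKidTree (just m) ask j old = if ask ∧ (j ≡ᵇ slotFor i m) then cluster m else old

  newLinks : Links b → Maybe (Id b × Member b) → Maybe (Member b) → (Id b → Bool) → Links b
  newLinks l tgt cur ask = mkLinks
    (λ w → newEntry (joining l tgt) w (entryOf l w))
    (λ j → newTree (joining l tgt) j (treeAt l j))
    (λ c w → newKid cur (ask c) w (kid l c w))
    (λ c j → newKidTree cur (ask c) j (kidTree l c j))

joining-just : ∀ {b} (l : Links b) tgt {p m} → joining l tgt ≡ just (p , m) →
               tgt ≡ just (p , m) × entryOf l (cluster m) ≡ nothing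
joining-just l (just (q , m)) eq with entryOf l (cluster m) in none
joining-just l (just (q , m)) refl | nothing = refl , none

asksFor-true : ∀ {b} (x : Maybe (Id b × Member b)) {p} → asksFor x p ≡ true → ∃ λ m → x ≡ just (p , m)
asksFor-true (just (q , m)) eq with refl ← ==⇒≡ {v = q} eq = m , refl

module ForestProperties {b : ℕ} (W : ℕ) (adj : Id b → Id b → Bool) where
  open Forests W adj

  forest-cong : ∀ {L L′ τ τ′} → (∀ v → L v ≡ L′ v) → τ ≤ τ′ → Forest L τ → Forest L′ τ′
  forest-cong {L} {L′} L≡ τ≤τ′ forest = record
    { placed     = λ eq → placed′ (placed (back eq))
    ; slot-tree  = λ {v} eq → trans (cong (λ l → treeAt l _) (sym (L≡ v))) (slot-tree (back eq))
    ; slot-bound = λ eq → slot-bound (back eq)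
    ; time-bound = λ eq → ≤-trans (time-bound (back eq)) τ≤τ′
    ; kid-entry  = λ {p} {v} eq → trans (cong (λ l → entryOf l _) (sym (L≡ v)))
                     (kid-entry (trans (cong (λ l → kid l _ _) (L≡ p)) eq))
    }
    where
    open Forest forest
    back : ∀ {v w e} → entryOf (L′ v) w ≡ just e → entryOf (L v) w ≡ just e
    back {v} eq = trans (cong (λ l → entryOf l _) (L≡ v)) eq
    placed′ : ∀ {v w e} → Placed L v w e → Placed L′ v w e
    placed′ (root eq) = root eq
    placed′ (child {p = p} v≢w vp eq t< isK tree) =
      child v≢w vp (trans (cong (λ l → entryOf l _) (sym (L≡ p))) eq) t<
        (trans (cong (λ l → kid l _ _) (sym (L≡ p))) isK) (trans (cong (λ l → kidTree l _ _) (sym (L≡ p))) tree)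

  module _ {L : Id b → Links b} {τ : ℕ} (forest : Forest L τ) where
    open Forest forest

    root-entry : ∀ {v w e} → entryOf (L v) w ≡ just e → ∃ λ e′ → entryOf (L w) w ≡ just e′
    root-entry eq = climb _ ≤-refl eq
      where
      climb : ∀ n {v w e} → time e ≤ n → entryOf (L v) w ≡ just e → ∃ λ e′ → entryOf (L w) w ≡ just e′
      climb n t≤n eq with placed eq
      climb n       t≤n eq | root refl = _ , eq
      climb (suc n) t≤n eq | child _ _ eq′ t< _ _ = climb n (s≤s⁻¹ (≤-trans t< t≤n)) eq′
      climb zero    t≤n eq | child _ _ eq′ t< _ _ = contradiction (≤-trans t< t≤n) λ ()

  module Attach {L : Id b → Links b} {i τ : ℕ} (forest : Forest L τ)
    (cur : Id b → Maybe (Member b)) (tgt : Id b → Maybe (Id b × Member b)) (ask : Id b → Id b → Bool)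
    (slots : ∀ {v m w e} → cur v ≡ just m → entryOf (L v) w ≡ just e → slot e + rank m ≤ suc (3 * i))
    (home : ∀ {v m} → cur v ≡ just m → ∃ λ e → entryOf (L v) (cluster m) ≡ just e)
    (low : ∀ {v m} → cur v ≡ just m → level m ≤ i)
    (contact : ∀ {v p m} → tgt v ≡ just (p , m) →
               adj v p ≡ true × cur p ≡ just m × ∃ λ m′ → cur v ≡ just m′ × rank m < rank m′)
    (ask⇒ : ∀ {p c} → ask p c ≡ true → ∃ λ m → joining (L c) (tgt c) ≡ just (p , m))
    (ask⇐ : ∀ {p c m} → joining (L c) (tgt c) ≡ just (p , m) → ask p c ≡ true)
    (i<W : suc (3 * i) < W) where
    open Forest forest

    L′ : Id b → Links b
    L′ v = newLinks i τ (L v) (tgt v) (cur v) (ask v)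

    persist : ∀ {v w e} → entryOf (L v) w ≡ just e → entryOf (L′ v) w ≡ just e
    persist {v} {w} eq with joining (L v) (tgt v) in eqj
    ... | nothing = eq
    ... | just (p , m) with w ≟ᴵ cluster m
    ...   | no _ = eq
    ...   | yes refl = contradiction (trans (sym eq) (proj₂ (joining-just (L v) (tgt v) eqj))) λ ()

    data New (v w : Id b) (e : Entry b) : Set where
      old : entryOf (L v) w ≡ just e → New v w e
      new : ∀ {p m} → joining (L v) (tgt v) ≡ just (p , m) → w ≡ cluster m →
            e ≡ entry (slotFor i m) (just p) (suc τ) → New v w e

    classify : ∀ {v w e} → entryOf (L′ v) w ≡ just e → New v w e
    classify {v} {w} eq with joining (L v) (tgt v) in eqj
    ... | nothing = old eq
    ... | just (p , m) with w ≟ᴵ cluster m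
    ...   | no _ = old eq
    ...   | yes w≡ = new eqj w≡ (sym (just-injective eq))

    slot+rank : ∀ {v p m} → tgt v ≡ just (p , m) → slotFor i m + rank m ≡ suc (3 * i)
    slot+rank {m = m} eq = m∸n+n≡m (rank-bound m (low (proj₁ (proj₂ (contact eq)))))

    slot-fresh : ∀ {v p m w e} → tgt v ≡ just (p , m) → entryOf (L v) w ≡ just e → slot e < slotFor i m
    slot-fresh {m = m} {e = e} eq isE with _ , _ , m′ , cur-v , rank< ← contact eq =
      +-cancelʳ-< (rank m) (slot e) (slotFor i m)
        (<-≤-trans (+-monoʳ-< (slot e) rank<) (≤-trans (slots cur-v isE) (≤-reflexive (sym (slot+rank eq)))))

    slotFor<W : ∀ (m : Member b) → slotFor i m < W
    slotFor<W m = ≤-<-trans (m∸n≤m (suc (3 * i)) (rank m)) i<W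

    -- The slot of a joining vertex exceeds all slots it has used, and the tree it joins is new to
    -- it. Hence neither `kidTree` nor `kid` is overwritten for an existing edge.
    kid-persist : ∀ {v p w e j t} → entryOf (L v) w ≡ just e → slot e ≡ j → kid (L p) v w ≡ just (j , t) → kidTree (L p) v j ≡ w →
                  kid (L′ p) v w ≡ just (j , t) × kidTree (L′ p) v j ≡ w
    kid-persist {v} {p} {w} isE refl isK tree with cur p in eqc
    ... | nothing = isK , tree
    ... | just m with ask p v in eqa
    ...   | false = isK , tree
    ...   | true with m′ , eqj ← ask⇒ eqa with eqt , none ← joining-just (L v) (tgt v) eqj
      with refl ← just-injective (trans (sym eqc) (proj₁ (proj₂ (contact eqt))))
      rewrite <⇒≢ᵇ (slot-fresh eqt isE) with w ≟ᴵ cluster m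
    ...     | no _ = isK , tree
    ...     | yes refl = contradiction (trans (sym isE) none) λ ()

    kid-new : ∀ {v p m} → joining (L v) (tgt v) ≡ just (p , m) →
              kid (L′ p) v (cluster m) ≡ just (slotFor i m , suc τ) × kidTree (L′ p) v (slotFor i m) ≡ cluster m
    kid-new {v} {p} {m} eqj with eqt , _ ← joining-just (L v) (tgt v) eqj
      rewrite proj₁ (proj₂ (contact eqt)) | ask⇐ eqj | ==-refl (cluster m) | ≡ᵇ-refl (slotFor i m) = refl , refl

    entry-new : ∀ {v p m} → joining (L v) (tgt v) ≡ just (p , m) →
                entryOf (L′ v) (cluster m) ≡ just (entry (slotFor i m) (just p) (suc τ))
    entry-new {v} {p} {m} eqj rewrite eqj | ==-refl (cluster m) = refl

    entered : ∀ {v p m} → tgt v ≡ just (p , m) → ∃ λ e → entryOf (L′ v) (cluster m) ≡ just e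
    entered {v} {p} {m} eqt = from (entryOf (L v) (cluster m)) refl
      where
      from : ∀ x → entryOf (L v) (cluster m) ≡ x → ∃ λ e → entryOf (L′ v) (cluster m) ≡ just e
      from (just e) eq = e , persist eq
      from nothing  eq = _ , entry-new {v} {p} {m}
        (trans (cong (joining (L v)) eqt) (cong (λ x → if is-nothing x then just (p , m) else nothing) eq))

    attached : Forest L′ (suc τ)
    attached = record
      { placed     = λ eq → placed′ (classify eq)
      ; slot-tree  = λ eq → slot-tree′ (classify eq)
      ; slot-bound = λ eq → slot-bound′ (classify eq)
      ; time-bound = λ eq → time-bound′ (classify eq)
      ; kid-entry  = kid-entry′
      }
      where
      placed′ : ∀ {v w e} → New v w e → Placed L′ v w e
      placed′ (old eq) with placed eq
      ... | root v≡w = root v≡w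
      ... | child v≢w vp eq′ t< isK tree with isK′ , tree′ ← kid-persist eq refl isK tree =
        child v≢w vp (persist eq′) t< isK′ tree′
      placed′ {v} (new {p} {m} eqj refl refl) with eqt , none ← joining-just (L v) (tgt v) eqj
        with vp , cur-p , _ ← contact eqt with e , isE ← home cur-p with isK , tree ← kid-new eqj =
        child v≢w vp (persist isE) (s≤s (time-bound isE)) isK tree
        where
        -- A nonempty tree contains its root, so a vertex without an entry in the tree cannot be
        -- that root.
        v≢w : v ≢ cluster m
        v≢w refl = case trans (sym none) (proj₂ (root-entry forest isE)) of λ ()

      slot-tree′ : ∀ {v w e} → New v w e → treeAt (L′ v) (slot e) ≡ w
      slot-tree′ {v} (old eq) with joining (L v) (tgt v) in eqj
      ... | nothing = slot-tree eq
      ... | just (p , m) with eqt , _ ← joining-just (L v) (tgt v) eqj rewrite <⇒≢ᵇ (slot-fresh eqt eq) = slot-tree eq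
      slot-tree′ (new {p} {m} eqj refl refl) rewrite eqj | ≡ᵇ-refl (slotFor i m) = refl

      slot-bound′ : ∀ {v w e} → New v w e → slot e < W
      slot-bound′ (old eq) = slot-bound eq
      slot-bound′ (new {m = m} _ _ refl) = slotFor<W m

      time-bound′ : ∀ {v w e} → New v w e → time e ≤ suc τ
      time-bound′ (old eq) = ≤-trans (time-bound eq) (n≤1+n τ)
      time-bound′ (new _ _ refl) = ≤-refl

      kid-entry′ : ∀ {p v w j t} → kid (L′ p) v w ≡ just (j , t) → entryOf (L′ v) w ≡ just (entry j (just p) t)
      kid-entry′ {p} {v} {w} isK with cur p in eqc
      ... | nothing = persist (kid-entry isK)
      ... | just m with ask p v in eqa | w ≟ᴵ cluster m
      ...   | false | _ = persist (kid-entry isK)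
      ...   | true | no _ = persist (kid-entry isK)
      ...   | true | yes refl with refl ← isK with m′ , eqj ← ask⇒ eqa with eqt , none ← joining-just (L v) (tgt v) eqj
        with refl ← just-injective (trans (sym eqc) (proj₁ (proj₂ (contact eqt)))) = entry-new eqj

    slots′ : ∀ {v p m w e} → tgt v ≡ just (p , m) → entryOf (L′ v) w ≡ just e → slot e + rank m ≤ suc (3 * i)
    slots′ {v} {p} {m} {w} {e} eqt isE with classify isE
    ... | old eq = ≤-trans (+-monoˡ-≤ (rank m) (<⇒≤ (slot-fresh eqt eq))) (≤-reflexive (slot+rank eqt))
    ... | new eqj _ refl with refl ← just-injective (trans (sym eqt) (proj₁ (joining-just (L v) (tgt v) eqj))) =
      ≤-reflexive (slot+rank eqt)

    slots-idle : ∀ {v m w e} → tgt v ≡ nothing → cur v ≡ just m → entryOf (L′ v) w ≡ just e → slot e + rank m ≤ suc (3 * i)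
    slots-idle {v} eqt eqc isE with classify isE
    ... | old eq = slots eqc eq
    ... | new eqj _ _ = case trans (sym eqt) (proj₁ (joining-just (L v) (tgt v) eqj)) of λ ()

-- The rounds of one step

module Colouring (b R M : ℕ) where

  W S : ℕ
  W = 3 * R + 2
  S = R * M

  Store : Set
  Store = Memory b (Node b)

  Step : Set
  Step = Action b W Store

  open Local {b} {W} {Store}

  -- The level is sent in unary. It is below `R` during the phases, so `W` bits suffice.
  announce : Id b → Maybe (Member b) → Packet b W
  announce i nothing  = silence
  announce i (just m) = packet true (stalled m) (cluster m) (unary W (level m))

  membership : Packet b W → Maybe (Member b)
  membership p = if tag₁ p then just (member (name p) (count (payload p)) (tag₂ p)) else nothing

  candidate : Maybe (Member b) → Maybe (Member b) → Maybe (Member b)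
  candidate (just own) (just m) = if not (stalled m) ∧ (suc (rank m) ≤ᵇ rank own) then just m else nothing
  candidate _          _        = nothing

  hello : Step
  hello = record
    { send    = λ i m _ → announce i (current (rest m))
    ; receive = λ i _ m box → memory (links m) (total m) (flag m)
                  record (rest m) { target = minimal (λ u → candidate (current (rest m)) (membership (box u))) rank }
    }

  -- Applicants enter the tree before the decision, because the tree has to count them and to carry
  -- the verdict to them. The rejected ones stay in it as non-terminal vertices.
  attach : ℕ → ℕ → Step
  attach i τ = record
    { send    = λ v m p → packet (asksFor (joining (links m) (target (rest m))) p) false v (bits W λ _ → false)
    ; receive = λ _ _ m box → memory
                  (newLinks i τ (links m) (target (rest m)) (current (rest m)) (λ c → tag₁ (box c)))
                  (total m) (flag m) (rest m)
    }

  admits : Id b → Node b → ℕ → Bool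
  admits _ x p = not (rootStalled x) ∧ (tokens x ≤ᵇ M * p)

  module Proposals = Counting {b} W S (suc b) {Node b} (aim ∘ target) admits
  -- A cluster may have lost all its members. This count tells the vertices of its tree, so that the
  -- tree is left out of the output.
  module Sizes     = Counting {b} W S (suc b) {Node b} (Maybe.map cluster ∘ current) (λ _ _ p → 1 ≤ᵇ p)

  settleNode : (Id b → Bool) → Bool → ℕ → Node b → Node b
  settleNode fl ok p x = record x
    { current     = settleCurrent fl (target x) (current x)
    ; tokens      = settleTokens ok (rootStalled x) (tokens x) p
    ; rootStalled = not ok
    }

  settle : Step
  settle = locally λ i m → memory (links m) (total m) (flag m)
    (settleNode (flag m) (admits i (rest m) (Proposals.subtotal m i)) (Proposals.subtotal m i) (rest m))

  macroStep : ℕ → ℕ → List Step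
  macroStep i τ = hello ∷ attach i τ ∷ Proposals.counting ++ settle ∷ []

  kept : Node b → Bool × Maybe (ℕ × Id b) × (ℕ → Snapshot b)
  kept x = active x , done x , archive x

  module StepCorrect .{{_ : NonZero M}} (adj : Id b → Id b → Bool)
                     (adj-sym : ∀ {u v} → adj u v ≡ true → adj v u ≡ true) where
    open Run {b} {W} {Store} adj
    open Clusters {b} M adj
    open Forests {b} W adj
    open ForestProperties {b} W adj

    record Stage (i k : ℕ) (s : Id b → Store) : Set where
      field
        clustered : Clustered i k (rest ∘ s)
        forest    : Forest (links ∘ s) (i * M + k)
        slots     : ∀ {v m w e} → current (rest (s v)) ≡ just m → entryOf (links (s v)) w ≡ just e →
                    slot e + rank m ≤ suc (3 * i)
        home      : ∀ {v m} → current (rest (s v)) ≡ just m → ∃ λ e → entryOf (links (s v)) (cluster m) ≡ just e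

    candidate-just : ∀ x y {m} → candidate x y ≡ just m →
                     ∃ λ m′ → x ≡ just m′ × y ≡ just m × stalled m ≡ false × rank m < rank m′
    candidate-just (just own) (just m) eq with stalled m in st | suc (rank m) ≤ᵇ rank own in lt
    candidate-just (just own) (just m) refl | false | true = own , refl , refl , st , ≤ᵇ-true lt

    candidate-nothing : ∀ m m′ → candidate (just m′) (just m) ≡ nothing → stalled m ≡ false → rank m′ ≤ rank m
    candidate-nothing m m′ eq st rewrite st with suc (rank m) ≤ᵇ rank m′ in lt
    ... | false = s≤s⁻¹ (≤ᵇ-false lt)

    candidate-true : ∀ m m′ → stalled m ≡ false → rank m < rank m′ → candidate (just m′) (just m) ≡ just m
    candidate-true m m′ st lt rewrite st with suc (rank m) ≤ᵇ rank m′ in eq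
    ... | true = refl
    ... | false = contradiction lt (<⇒≱ (≤ᵇ-false eq))

    i*M+k<S : ∀ {i k} → i < R → k < M → suc (i * M + k) ≤ S
    i*M+k<S {i} {k} i<R k<M = begin
      suc (i * M + k)  ≡⟨ +-suc (i * M) k ⟨
      i * M + suc k    ≤⟨ +-monoʳ-≤ (i * M) k<M ⟩
      i * M + M        ≡⟨ +-comm (i * M) M ⟩
      suc i * M        ≤⟨ *-monoˡ-≤ M i<R ⟩
      S                ∎
      where open ≤-Reasoning

    slots<W : ∀ {i} → i ≤ R → suc (3 * i) < W
    slots<W {i} i≤R = ≤-trans (s≤s (s≤s (*-monoʳ-≤ 3 i≤R))) (≤-reflexive (+-comm 2 (3 * R)))

    module _ {i k : ℕ} (i<R : i < R) (k<M : k < M) {s : Id b → Store} (stage : Stage i k s) where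
      open Stage stage
      open Clustered clustered

      private
        τ = i * M + k
        s₁ = oneRound hello s
        s₂ = oneRound (attach i τ) s₁
        s₃ = exec Proposals.counting s₂
        s₄ = oneRound settle s₃

        tgt : Id b → Maybe (Id b × Member b)
        tgt v = target (rest (s₁ v))

        cur : Id b → Maybe (Member b)
        cur v = current (rest (s v))

        level-low : ∀ {v m} → cur v ≡ just m → level m ≤ i
        level-low eq = subst (_≤ i) (sym (home-level eq)) (low _)

        heard : Id b → Id b → Maybe (Member b)
        heard v u = membership (lookup (tabulate (received hello s v)) u)

        membership-announce : ∀ {v} x → cur v ≡ x → membership (announce v x) ≡ x
        membership-announce nothing  _  = refl
        membership-announce (just m) eq = cong (λ l → just (member (cluster m) l (stalled m)))
          (count-unary (≤-trans (level-low eq) (≤-trans (<⇒≤ i<R) (≤-trans (m≤m+n R _) (m≤m+n (3 * R) 2)))))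

        heard≡ : ∀ v u → heard v u ≡ (if adj v u then cur u else nothing)
        heard≡ v u rewrite lookup-tabulate (received hello s v) u with adj v u
        ... | true  = membership-announce (cur u) refl
        ... | false = refl

        heard-adj : ∀ {v u} → adj v u ≡ true → heard v u ≡ cur u
        heard-adj {v} {u} vu rewrite heard≡ v u | vu = refl

        heard-just : ∀ {v u m} → heard v u ≡ just m → adj v u ≡ true × cur u ≡ just m
        heard-just {v} {u} eq with adj v u | trans (sym (heard≡ v u)) eq
        ... | true | eq′ = refl , eq′

        isTarget : ∀ v → IsTarget (rest ∘ s) v (tgt v)
        isTarget v = from (tgt v) (minimal-correct (λ u → candidate (cur v) (heard v u)) rank)
          where
          from : ∀ t → Minimal (λ u → candidate (cur v) (heard v u)) rank t → IsTarget (rest ∘ s) v t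
          from nothing min {u} {m} {m′} vu cu ns cv = candidate-nothing m m′
            (trans (sym (cong₂ candidate cv (trans (heard-adj vu) cu))) (min u)) ns
          from (just (p , m)) (found , min)
            with m′ , cv , hp , ns , rank< ← candidate-just (cur v) (heard v p) found
            with vp , cp ← heard-just hp = vp , cp , ns , (m′ , cv , rank<) , least
            where
            least : ∀ {u′ m″} → adj v u′ ≡ true → cur u′ ≡ just m″ → stalled m″ ≡ false → rank m ≤ rank m″
            least {u′} {m″} vu cu ns′ with rank m ≤? rank m″
            ... | yes le = le
            -- A cluster of smaller key than the chosen one also lies below the vertex's own key, so
            -- it was a candidate and the minimum applies to it.
            ... | no  gt = min u′ m″ (trans (cong₂ candidate cv (trans (heard-adj vu) cu))
                                            (candidate-true m″ m′ ns′ (<-trans (≰⇒> gt) rank<)))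

        contact : ∀ {v p m} → tgt v ≡ just (p , m) → adj v p ≡ true × cur p ≡ just m × ∃ λ m′ → cur v ≡ just m′ × rank m < rank m′
        contact {v} eq with vp , cp , _ , lt , _ ← subst (IsTarget (rest ∘ s) v) eq (isTarget v) = vp , cp , lt

        ask : Id b → Id b → Bool
        ask p c = tag₁ (lookup (tabulate (received (attach i τ) s₁ p)) c)

        ask≡ : ∀ p c → ask p c ≡ (if adj p c then asksFor (joining (links (s c)) (tgt c)) p else false)
        ask≡ p c rewrite lookup-tabulate (received (attach i τ) s₁ p) c with adj p c
        ... | true  = refl
        ... | false = refl

        ask⇒ : ∀ {p c} → ask p c ≡ true → ∃ λ m → joining (links (s c)) (tgt c) ≡ just (p , m)
        ask⇒ {p} {c} eq with adj p c | trans (sym (ask≡ p c)) eq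
        ... | true | eq′ = asksFor-true _ eq′

        ask⇐ : ∀ {p c m} → joining (links (s c)) (tgt c) ≡ just (p , m) → ask p c ≡ true
        ask⇐ {p} {c} eq rewrite ask≡ p c | adj-sym (proj₁ (contact (proj₁ (joining-just (links (s c)) (tgt c) eq)))) | eq = ==-refl p

        module A = Attach {links ∘ s} {i} {τ} forest cur tgt ask slots home level-low contact ask⇒ ask⇐ (slots<W (<⇒≤ i<R))

        marked : ∀ {v w} → isEq (aim (tgt v)) w ≡ true → ∃ λ e → entryOf (A.L′ v) w ≡ just e
        marked {v} {w} eq with tgt v in eqt
        ... | just (p , m) with refl ← ==⇒≡ {v = cluster m} eq = subst (λ t → ∃ λ e → entryOf (newLinks i τ (links (s v)) t (cur v) (ask v)) (cluster m) ≡ just e) eqt (A.entered eqt)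

        module C = Proposals.Correct adj adj-sym A.L′ (rest ∘ s₂) ≤-refl
                     (forest-cong (λ _ → refl) (i*M+k<S i<R k<M) A.attached)
                     (λ {v} {w} → marked {v} {w})

        counted = C.counting-correct {s₂} (record { links≡ = λ _ → refl ; rest≡ = λ _ → refl })

        open C.Fixed (proj₁ counted)

        module Tr = Transition {i} {k} {rest ∘ s} {rest ∘ s₄} clustered adj-sym tgt isTarget

        subtotal≡ : ∀ v → Proposals.subtotal (s₃ v) v ≡ Tr.proposals v
        subtotal≡ = proj₁ (proj₂ counted)

        admits≡ : ∀ v → admits v (rest (s₃ v)) (Proposals.subtotal (s₃ v) v) ≡ Tr.accepts v
        admits≡ v = cong₂ (admits v) (rest≡ v) (subtotal≡ v)

        flags : ∀ {v w e} → entryOf (A.L′ v) w ≡ just e → flag (s₃ v) w ≡ Tr.accepts w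
        flags = proj₂ (proj₂ counted)

        settled≡ : ∀ v → rest (s₄ v) ≡ settleNode (flag (s₃ v)) (Tr.accepts v) (Tr.proposals v) (rest (s₂ v))
        settled≡ v = trans
          (cong₂ (λ a p → settleNode (flag (s₃ v)) a p (rest (s₃ v))) (admits≡ v) (subtotal≡ v))
          (cong (settleNode (flag (s₃ v)) (Tr.accepts v) (Tr.proposals v)) (rest≡ v))

        -- Flags are reliable only for the trees that contain `v`. Just two are consulted, those of
        -- the target's cluster and of the current one: `attach` has put `v` into the former, and
        -- `home` places it in the latter.
        settleCurrent-cong : ∀ v (t : Maybe (Id b × Member b)) x → tgt v ≡ t → cur v ≡ x →
                             settleCurrent (flag (s₃ v)) t x ≡ settleCurrent Tr.accepts t x
        settleCurrent-cong v (just (p , m)) _ eqt _ =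
          cong (λ a → if a then just (member (cluster m) (level m) false) else nothing) (flags (proj₂ (A.entered eqt)))
        settleCurrent-cong v nothing nothing _ _ = refl
        settleCurrent-cong v nothing (just m) _ eqc =
          cong (λ a → just (member (cluster m) (level m) (not a))) (flags (A.persist (proj₂ (home eqc))))

        current≡ : ∀ v → current (rest (s₄ v)) ≡ settleCurrent Tr.accepts (tgt v) (cur v)
        current≡ v = trans (cong current (settled≡ v)) (settleCurrent-cong v (tgt v) (cur v) refl refl)

        outcome : ∀ {v m} → current (rest (s₄ v)) ≡ just m → Tr.Outcome _ _ _ _ current≡ v m
        outcome = Tr.outcome (λ v → cong active (settled≡ v)) (λ v → cong rootLevel (settled≡ v))
          (λ v → cong rootStalled (settled≡ v)) (λ v → cong tokens (settled≡ v)) current≡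

        links₄ : ∀ v → A.L′ v ≡ links (s₄ v)
        links₄ v = sym (links≡ v)

      macroStep-correct : Stage i (suc k) (exec (macroStep i τ) s) ×
                          (∀ v → kept (rest (exec (macroStep i τ) s v)) ≡ kept (rest (s v)))
      macroStep-correct rewrite exec-++ Proposals.counting (settle ∷ []) s₂ =
        record
          { clustered = Tr.transition (λ v → cong active (settled≡ v)) (λ v → cong rootLevel (settled≡ v))
              (λ v → cong rootStalled (settled≡ v)) (λ v → cong tokens (settled≡ v)) current≡
          ; forest    = forest-cong links₄ (≤-reflexive (sym (+-suc (i * M) k))) A.attached
          ; slots     = λ {v} eq isE → slots₄ (outcome eq) (trans (cong (λ l → entryOf l _) (links₄ v)) isE)
          ; home      = λ {v} eq → case home₄ (outcome eq) of λ (e , isE) → e , trans (cong (λ l → entryOf l _) (sym (links₄ v))) isE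
          } , λ v → cong kept (settled≡ v)
        where
        slots₄ : ∀ {v m w e} → Tr.Outcome _ _ _ _ current≡ v m → entryOf (A.L′ v) w ≡ just e → slot e + rank m ≤ suc (3 * i)
        slots₄ (Tr.stayed eqt eqc) isE = A.slots-idle eqt eqc isE
        slots₄ (Tr.moved eqt _)    isE = A.slots′ eqt isE
        home₄ : ∀ {v m} → Tr.Outcome _ _ _ _ current≡ v m → ∃ λ e → entryOf (A.L′ v) (cluster m) ≡ just e
        home₄ (Tr.stayed _ eqc) with e , isE ← home eqc = e , A.persist isE
        home₄ (Tr.moved eqt _) = A.entered eqt

-- Colour classes

∑-positive : ∀ {b} (f : Id b → ℕ) → 1 ≤ ∑ f → ∃ λ v → 1 ≤ f v
∑-positive {zero}  f pos = [] , pos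
∑-positive {suc b} f pos with ∑ (λ v → f (false ∷ v)) in eq
... | suc _ with v , p ← ∑-positive (λ v → f (false ∷ v)) (subst (1 ≤_) (sym eq) (s≤s z≤n)) = false ∷ v , p
... | zero  with v , p ← ∑-positive (λ v → f (true ∷ v)) pos = true ∷ v , p

module Programs (b R M : ℕ) where
  open Colouring b R M
  open Local {b} {W} {Store}

  startLinks : Id b → Bool → Links b
  startLinks i act = mkLinks
    (λ w → if act ∧ (i == w) then just (entry (slotFor 0 (member i 0 false)) nothing 0) else nothing)
    (λ _ → i) (λ _ _ → nothing) (λ _ _ → i)

  startNode : Id b → Bool → Node b → Node b
  startNode i act x = record x
    { active      = act
    ; current     = if act then just (member i 0 false) else nothing
    ; tokens      = ⟦ act ⟧
    ; rootLevel   = 0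
    ; rootStalled = false
    }

  openColour : Step
  openColour = locally λ i m → memory (startLinks i (is-nothing (done (rest m)))) (total m) (flag m)
                                  (startNode i (is-nothing (done (rest m))) (rest m))

  advanceNode : Node b → Node b
  advanceNode x = record x
    { current     = Maybe.map advanceMember (current x)
    ; rootLevel   = rootLevel x + ⟦ rootStalled x ⟧
    ; rootStalled = false
    }

  advanceAll : Step
  advanceAll = locally λ _ m → memory (links m) (total m) (flag m) (advanceNode (rest m))

  snapshot : Store → Snapshot b
  snapshot m = record { tree = links m ; used = flag m ; final = Maybe.map cluster (current (rest m)) }

  finishDone : ℕ → Maybe (Member b) → Maybe (ℕ × Id b) → Maybe (ℕ × Id b)
  finishDone κ (just m) _   = just (κ , cluster m)
  finishDone κ nothing  old = old

  closeColour : ℕ → Step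
  closeColour κ = locally λ _ m → memory (links m) (total m) (flag m) record (rest m)
    { done    = finishDone κ (current (rest m)) (done (rest m))
    ; archive = λ j → if j ≡ᵇ κ then snapshot m else archive (rest m) j
    }

  steps : ℕ → List Step
  steps i = iterate (λ k → macroStep i (i * M + k)) 0 M

  phases : List Step
  phases = iterate (λ i → steps i ++ advanceAll ∷ []) 0 R

  colourClass : ℕ → List Step
  colourClass κ = openColour ∷ phases ++ Sizes.counting ++ closeColour κ ∷ []

  colourClasses : ℕ → List Step
  colourClasses n = iterate colourClass 0 n

  blank : Store
  blank = memory noLinks (λ _ _ → 0) (λ _ → false) record
    { active = false ; current = nothing ; target = nothing ; tokens = 0 ; rootLevel = 0 ; rootStalled = false
    ; done = nothing ; archive = λ _ → record { tree = noLinks ; used = λ _ → false ; final = nothing } }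
    where
    origin : ∀ {b} → Id b
    origin {zero}  = []
    origin {suc b} = false ∷ origin
    noLinks : Links b
    noLinks = mkLinks (λ _ → nothing) (λ _ → origin) (λ _ _ → nothing) (λ _ _ → origin)

  countingRounds : ℕ
  countingRounds = 2 + (S + suc b + S)

  length-macroStep : ∀ i τ → length (macroStep i τ) ≡ 3 + countingRounds
  length-macroStep i τ = cong (2 +_) (trans (length-++ Proposals.counting)
    (trans (cong (_+ 1) Proposals.length-counting) (+-comm countingRounds 1)))

  length-phases : length phases ≡ R * (1 + M * (3 + countingRounds))
  length-phases = length-iterate _ one 0 R
    where
    one : ∀ i → length (steps i ++ advanceAll ∷ []) ≡ 1 + M * (3 + countingRounds)
    one i = trans (length-++ (steps i)) (trans (+-comm _ 1)
      (cong suc (length-iterate (λ k → macroStep i (i * M + k)) (λ k → length-macroStep i (i * M + k)) 0 M)))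

  length-colourClasses : ∀ n → length (colourClasses n) ≡
                         n * (2 + R * (1 + M * (3 + countingRounds)) + countingRounds)
  length-colourClasses n = length-iterate colourClass one 0 n
    where
    shuffle : ∀ x y → 1 + (x + (y + 1)) ≡ 2 + x + y
    shuffle = solve-∀
    one : ∀ κ → length (colourClass κ) ≡ 2 + R * (1 + M * (3 + countingRounds)) + countingRounds
    one κ = trans (cong suc (trans (length-++ phases) (cong₂ _+_ length-phases
              (trans (length-++ Sizes.counting) (cong (_+ 1) Sizes.length-counting)))))
            (shuffle (R * (1 + M * (3 + countingRounds))) countingRounds)

  module ProgramCorrect .{{_ : NonZero M}} (adj : Id b → Id b → Bool) (adj-sym : ∀ {u v} → adj u v ≡ true → adj v u ≡ true)
                        (M≡ : M ≡ 6 * W) (large : 2 * (W * 2 ^ b * 4 ^ b) < 2 ^ R) where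

    open Run {b} {W} {Store} adj
    open Clusters {b} M adj
    open Phases {b} M adj
    open Forests {b} W adj
    open ForestProperties {b} W adj
    open StepCorrect adj adj-sym

    record Coloured (σ : Id b → Snapshot b) : Set where
      field
        forest    : Forest (tree ∘ σ) S
        home      : ∀ {v w} → final (σ v) ≡ just w → ∃ λ e → entryOf (tree (σ v)) w ≡ just e
        used⇒     : ∀ {v w e} → entryOf (tree (σ v)) w ≡ just e → used (σ v) w ≡ true → ∃ λ u → final (σ u) ≡ just w
        used⇐     : ∀ {u v w e} → entryOf (tree (σ v)) w ≡ just e → final (σ u) ≡ just w → used (σ v) w ≡ true
        separated : ∀ {u v w x} → adj u v ≡ true → final (σ u) ≡ just w → final (σ v) ≡ just x → w ≡ x

    coloured-cong : ∀ {σ σ′} → (∀ v → σ v ≡ σ′ v) → Coloured σ → Coloured σ′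
    coloured-cong {σ} {σ′} eq c = record
      { forest    = forest-cong (λ v → cong tree (eq v)) ≤-refl forest
      ; home      = λ {v} {w} → subst (λ x → final x ≡ just w → ∃ λ e → entryOf (tree x) w ≡ just e) (eq v) home
      ; used⇒     = λ {v} {w} {e} isE us → case subst (λ x → entryOf (tree x) w ≡ just e → used x w ≡ true → ∃ λ u → final (σ u) ≡ just w) (eq v) used⇒ isE us
                      of λ (u , f) → u , trans (cong final (sym (eq u))) f
      ; used⇐     = λ {u} {v} {w} {e} isE f → subst (λ x → entryOf (tree x) w ≡ just e → used x w ≡ true) (eq v)
                      (λ isE → used⇐ isE (trans (cong final (eq u)) f)) isE
      ; separated = λ {u} {v} uv f g → separated uv (trans (cong final (eq u)) f) (trans (cong final (eq v)) g)
      }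
      where open Coloured c

    Keeps : (Id b → Store) → (Id b → Store) → Set
    Keeps s s′ = ∀ v → kept (rest (s′ v)) ≡ kept (rest (s v))

    record Reaches (s : Id b → Store) (i k : ℕ) (s′ : Id b → Store) : Set where
      constructor reaches
      field
        stage : Stage i k s′
        keeps : Keeps s s′

    step-correct : ∀ {i k s s′} → i < R → k < M → Reaches s i k s′ → Reaches s i (suc k) (exec (macroStep i (i * M + k)) s′)
    step-correct {i} {k} {s} {s′} i<R k<M (reaches stage keeps) =
      reaches (proj₁ next) (λ v → trans (proj₂ next v) (keeps v))
      where
      next : Stage i (suc k) (exec (macroStep i (i * M + k)) s′) ×
             (∀ v → kept (rest (exec (macroStep i (i * M + k)) s′ v)) ≡ kept (rest (s′ v)))
      next = macroStep-correct i<R k<M stage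

    steps-correct : ∀ {i s s′} → i < R → Reaches s i 0 s′ → Reaches s i (M + 0) (exec (steps i) s′)
    steps-correct {i} {s} i<R = exec-iterate (λ k → macroStep i (i * M + k)) (Reaches s i) (step-correct i<R) M (≤-reflexive (+-identityʳ M))

    advance-correct : ∀ {i s} → Stage i M s → Stage (suc i) 0 (oneRound advanceAll s)
    advance-correct {i} {s} stage = record
      { clustered = advance clustered adj-sym (λ _ → refl) (λ _ → refl) (λ _ → refl) (λ _ → refl) (λ _ → refl)
      ; forest    = forest-cong (λ _ → refl) (≤-reflexive (trans (+-comm (i * M) M) (sym (+-identityʳ (M + i * M))))) forest
      ; slots     = λ {v} {e = e} eq isE → case before {v} eq of λ { (m , was , refl) → slots′ (slot e) m (slots was isE) }
      ; home      = λ {v} eq → case before {v} eq of λ { (m , was , refl) → home was }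
      }
      where
      open Stage stage
      before : ∀ {v m} → Maybe.map advanceMember (current (rest (s v))) ≡ just m →
               ∃ λ m₀ → current (rest (s v)) ≡ just m₀ × advanceMember m₀ ≡ m
      before {v} = map-just {f = advanceMember} {x = current (rest (s v))}
      lemma : ∀ i → suc (3 * i) + 3 ≡ suc (3 * suc i)
      lemma = solve-∀
      slots′ : ∀ j (m : Member b) → j + rank m ≤ suc (3 * i) → j + rank (advanceMember m) ≤ suc (3 * suc i)
      slots′ j m le = begin
        j + rank (advanceMember m)  ≤⟨ +-monoʳ-≤ j (rank-advance m) ⟩
        j + (rank m + 3)            ≡⟨ +-assoc j (rank m) 3 ⟨
        j + rank m + 3              ≤⟨ +-monoˡ-≤ 3 le ⟩
        suc (3 * i) + 3             ≡⟨ lemma i ⟩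
        suc (3 * suc i)             ∎
        where open ≤-Reasoning

    phase-correct : ∀ {i s s′} → i < R → Reaches s i 0 s′ → Reaches s (suc i) 0 (exec (steps i ++ advanceAll ∷ []) s′)
    phase-correct {i} {s} {s′} i<R r = subst (Reaches s (suc i) 0) (sym (exec-++ (steps i) (advanceAll ∷ []) s′))
      (reaches (advance-correct (subst (λ k → Stage i k (exec (steps i) s′)) (+-identityʳ M) (Reaches.stage r′))) (Reaches.keeps r′))
      where
      r′ : Reaches s i (M + 0) (exec (steps i) s′)
      r′ = steps-correct i<R r

    phases-correct : ∀ {s} → Stage 0 0 s → Reaches s (R + 0) 0 (exec phases s)
    phases-correct {s} stage = exec-iterate (λ i → steps i ++ advanceAll ∷ []) (λ i → Reaches s i 0) phase-correct R
      (≤-reflexive (+-identityʳ R)) (reaches stage λ _ → refl)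

    start-correct : ∀ s → Stage 0 0 (oneRound openColour s)
    start-correct s = record
      { clustered = start (λ _ → refl) (λ _ → refl) (λ _ → refl) (λ _ → refl)
      ; forest    = record
        { placed     = λ {v} eq → case own {v} eq of λ { (_ , refl , refl) → root refl }
        ; slot-tree  = λ {v} eq → case own {v} eq of λ { (_ , refl , _) → refl }
        ; slot-bound = λ {v} eq → case own {v} eq of λ { (_ , refl , refl) → ≤-trans (s≤s (m∸n≤m 1 (rank (member v 0 false)))) (m≤n+m 2 (3 * R)) }
        ; time-bound = λ {v} eq → case own {v} eq of λ { (_ , refl , refl) → z≤n }
        ; kid-entry  = λ ()
        }
      ; slots     = λ {v} eq isE → case own {v} isE of λ { (_ , refl , refl) → case self {v} eq of λ { (_ , refl) →
                      ≤-reflexive (m∸n+n≡m (bit≤1 v 0)) } }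
      ; home      = λ {v} eq → case self {v} eq of λ { (act , refl) → _ , home′ v act }
      }
      where
      act : Id b → Bool
      act v = is-nothing (done (rest (s v)))
      own : ∀ {v w e} → entryOf (startLinks v (act v)) w ≡ just e →
            act v ≡ true × v ≡ w × e ≡ entry (slotFor 0 (member v 0 false)) nothing 0
      own {v} {w} eq with act v | v ≟ᴵ w
      ... | true | yes v≡w = refl , v≡w , sym (just-injective eq)
      self : ∀ {v m} → current (startNode v (act v) (rest (s v))) ≡ just m → act v ≡ true × member v 0 false ≡ m
      self {v} eq with act v
      ... | true = refl , just-injective eq
      home′ : ∀ v → act v ≡ true → entryOf (startLinks v (act v)) v ≡ just (entry (slotFor 0 (member v 0 false)) nothing 0)
      home′ v eq rewrite eq | ==-refl v = refl

    -- `few` counts all identifiers without a colour, whether they name nodes or not. It starts at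
    -- `2 ^ b`, so after `b + 1` halvings fewer than one is left.
    record Progress (κ : ℕ) (s : Id b → Store) : Set where
      field
        few      : 2 ^ κ * ∑ (λ v → ⟦ is-nothing (done (rest (s v))) ⟧) ≤ 2 ^ b
        coloured : ∀ {j} → j < κ → Coloured (λ v → archive (rest (s v)) j)
        done⇒    : ∀ {v j w} → done (rest (s v)) ≡ just (j , w) → j < κ × final (archive (rest (s v)) j) ≡ just w
        done⇐    : ∀ {v j w} → j < κ → final (archive (rest (s v)) j) ≡ just w → done (rest (s v)) ≡ just (j , w)

    module _ {κ : ℕ} {s : Id b → Store} (progress : Progress κ s) where
      open Progress progress

      private
        s₁ = oneRound openColour s
        s₂ = exec phases s₁
        s₃ = exec Sizes.counting s₂
        s₄ = oneRound (closeColour κ) s₃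

        phased : Reaches s₁ (R + 0) 0 s₂
        phased = phases-correct (start-correct s)

        stage : Stage R 0 s₂
        stage = subst (λ i → Stage i 0 s₂) (+-identityʳ R) (Reaches.stage phased)

        open Stage stage
        open Clustered clustered using (self-active)
        module F = Finish {R} {rest ∘ s₂} clustered M≡ large

        active≡ : ∀ v → active (rest (s₂ v)) ≡ is-nothing (done (rest (s v)))
        active≡ v = ,-injectiveˡ (Reaches.keeps phased v)

        done≡ : ∀ v → done (rest (s₂ v)) ≡ done (rest (s v))
        done≡ v = cong (proj₁ ∘ proj₂) (Reaches.keeps phased v)

        archive≡ : ∀ v → archive (rest (s₂ v)) ≡ archive (rest (s v))
        archive≡ v = cong (proj₂ ∘ proj₂) (Reaches.keeps phased v)

        forest′ : Forest (links ∘ s₂) S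
        forest′ = forest-cong (λ _ → refl) (≤-reflexive (+-identityʳ S)) forest

        final-member : ∀ {v w} → Maybe.map cluster (current (rest (s₂ v))) ≡ just w → ∃ λ m → current (rest (s₂ v)) ≡ just m × cluster m ≡ w
        final-member = map-just

        isEq-true : ∀ (x : Maybe (Id b)) {w} → isEq x w ≡ true → x ≡ just w
        isEq-true (just v) eq = cong just (==⇒≡ {v = v} eq)

        marked : ∀ {v w} → isEq (Maybe.map cluster (current (rest (s₂ v)))) w ≡ true → ∃ λ e → entryOf (links (s₂ v)) w ≡ just e
        marked {v} eq with m , was , refl ← final-member {v} (isEq-true _ eq) = home was

        module C = Sizes.Correct adj adj-sym (links ∘ s₂) (rest ∘ s₂) ≤-refl forest′ (λ {v} {w} → marked {v} {w})

        counted = C.counting-correct {s₂} (record { links≡ = λ _ → refl ; rest≡ = λ _ → refl })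

        open C.Fixed (proj₁ counted)

        size-flag : ∀ {v w e} → entryOf (links (s₂ v)) w ≡ just e → flag (s₃ v) w ≡ (1 ≤ᵇ ∑ (C.marks w))
        size-flag = proj₂ (proj₂ counted)

        σ : Id b → Snapshot b
        σ v = record { tree = links (s₂ v) ; used = flag (s₃ v) ; final = Maybe.map cluster (current (rest (s₂ v))) }

        σ-coloured : Coloured σ
        σ-coloured = record
          { forest    = forest′
          ; home      = λ {v} eq → case final-member {v} eq of λ { (m , was , refl) → home was }
          ; used⇒     = λ isE us → case ∑-positive (C.marks _) (≤ᵇ-true (trans (sym (size-flag isE)) us)) of λ (u , pos) → u , mark⇒ u pos
          ; used⇐     = λ {u} {v} {w} isE f → trans (size-flag isE) (positive (≤-trans (mark⇐ u f) (term≤∑ (C.marks w) u)))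
          ; separated = λ {u} {v} uv f g → case final-member {u} f of λ { (m , was , refl) → case final-member {v} g of λ { (m′ , was′ , refl) →
                          F.separated uv was was′ } }
          }
          where
          mark⇒ : ∀ u {w} → 1 ≤ C.marks w u → Maybe.map cluster (current (rest (s₂ u))) ≡ just w
          mark⇒ u {w} pos with isEq (Maybe.map cluster (current (rest (s₂ u)))) w in eq
          ... | true = isEq-true _ eq
          mark⇐ : ∀ u {w} → Maybe.map cluster (current (rest (s₂ u))) ≡ just w → 1 ≤ C.marks w u
          mark⇐ u {w} eq rewrite eq | ==-refl w = ≤-refl
          positive : ∀ {n} → 1 ≤ n → (1 ≤ᵇ n) ≡ true
          positive (s≤s _) = refl

        snapshot≡ : ∀ v → σ v ≡ archive (rest (s₄ v)) κ
        snapshot≡ v = sym (trans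
          (cong (λ t → if t then snapshot (s₃ v) else archive (rest (s₃ v)) κ) (≡ᵇ-refl κ))
          (cong₂ (λ l x → record { tree = l ; used = flag (s₃ v) ; final = Maybe.map cluster (current x) }) (links≡ v) (rest≡ v)))

        older : ∀ {j} v → j < κ → archive (rest (s₄ v)) j ≡ archive (rest (s v)) j
        older {j} v j<κ rewrite <⇒≢ᵇ j<κ = trans (cong (λ x → archive x j) (rest≡ v)) (cong (λ a → a j) (archive≡ v))

        done₄ : ∀ v → done (rest (s₄ v)) ≡ finishDone κ (current (rest (s₂ v))) (done (rest (s v)))
        done₄ v = trans (cong (λ x → finishDone κ (current x) (done x)) (rest≡ v)) (cong (finishDone κ (current (rest (s₂ v)))) (done≡ v))

        undone : ∀ v → ⟦ is-nothing (done (rest (s₄ v))) ⟧ ≡ F.dead v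
        undone v rewrite done₄ v | active≡ v with current (rest (s₂ v)) | done (rest (s v))
        ... | just _  | just _  = refl
        ... | just _  | nothing = refl
        ... | nothing | just _  = refl
        ... | nothing | nothing = refl

        few′ : 2 ^ suc κ * ∑ (λ v → ⟦ is-nothing (done (rest (s₄ v))) ⟧) ≤ 2 ^ b
        few′ = begin
          2 * 2 ^ κ * ∑ (λ v → ⟦ is-nothing (done (rest (s₄ v))) ⟧)  ≡⟨ cong (2 * 2 ^ κ *_) (∑-cong undone) ⟩
          2 * 2 ^ κ * ∑ F.dead                                       ≡⟨ lemma (2 ^ κ) (∑ F.dead) ⟩
          2 ^ κ * (2 * ∑ F.dead)                                     ≤⟨ *-monoʳ-≤ (2 ^ κ) F.half-survives ⟩
          2 ^ κ * ∑ (λ v → ⟦ active (rest (s₂ v)) ⟧)                 ≡⟨ cong (2 ^ κ *_) (∑-cong λ v → cong ⟦_⟧ (active≡ v)) ⟩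
          2 ^ κ * ∑ (λ v → ⟦ is-nothing (done (rest (s v))) ⟧)       ≤⟨ few ⟩
          2 ^ b                                                      ∎
          where
          open ≤-Reasoning
          lemma : ∀ x y → 2 * x * y ≡ x * (2 * y)
          lemma = solve-∀

        done⇒′ : ∀ {v j w} → done (rest (s₄ v)) ≡ just (j , w) → j < suc κ × final (archive (rest (s₄ v)) j) ≡ just w
        done⇒′ {v} {j} {w} eq with current (rest (s₂ v)) in eqc | trans (sym (done₄ v)) eq
        ... | just m  | refl = ≤-refl , trans (cong final (sym (snapshot≡ v))) (cong (Maybe.map cluster) eqc)
        ... | nothing | old with j<κ , f ← done⇒ {v} old = m≤n⇒m≤1+n j<κ , trans (cong final (older v j<κ)) f

        done⇐′ : ∀ {v j w} → j < suc κ → final (archive (rest (s₄ v)) j) ≡ just w → done (rest (s₄ v)) ≡ just (j , w)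
        done⇐′ {v} {j} {w} j<1+κ f with m≤n⇒m<n∨m≡n (s≤s⁻¹ j<1+κ)
        ... | inj₂ refl with m , was , refl ← final-member {v} (trans (cong final (snapshot≡ v)) f) =
          trans (done₄ v) (cong (λ x → finishDone κ x (done (rest (s v)))) was)
        ... | inj₁ j<κ = trans (done₄ v) (idle (current (rest (s₂ v))) refl)
          where
          was : done (rest (s v)) ≡ just (j , w)
          was = done⇐ j<κ (trans (cong final (sym (older v j<κ))) f)
          idle : ∀ x → current (rest (s₂ v)) ≡ x → finishDone κ x (done (rest (s v))) ≡ just (j , w)
          idle nothing  _  = was
          -- A vertex that has a colour takes no part in later classes, so it cannot be a member of
          -- a cluster now.
          idle (just m) eq = case trans (sym (self-active eq)) (trans (active≡ v) (cong is-nothing was)) of λ ()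

      colourClass-correct : Progress (suc κ) (exec (colourClass κ) s)
      colourClass-correct
        rewrite exec-++ phases (Sizes.counting ++ closeColour κ ∷ []) s₁ | exec-++ Sizes.counting (closeColour κ ∷ []) s₂ = record
        { few      = few′
        ; coloured = λ {j} j<1+κ → case m≤n⇒m<n∨m≡n (s≤s⁻¹ j<1+κ) of λ
            { (inj₁ j<κ)  → coloured-cong (λ v → sym (older v j<κ)) (coloured j<κ)
            ; (inj₂ refl) → coloured-cong snapshot≡ σ-coloured }
        ; done⇒    = λ {v} → done⇒′ {v}
        ; done⇐    = λ {v} → done⇐′ {v}
        }

    blank-progress : Progress 0 (λ _ → blank)
    blank-progress = record
      { few      = ≤-reflexive (trans (+-identityʳ _) (∑-1 {b}))
      ; coloured = λ ()
      ; done⇒    = λ ()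
      ; done⇐    = λ ()
      }

    colourClasses-correct : ∀ n → Progress (n + 0) (exec (colourClasses n) (λ _ → blank))
    colourClasses-correct n = exec-iterate colourClass Progress (λ _ → colourClass-correct) n ≤-refl blank-progress

    all-done : ∀ {s} → Progress (suc b) s → ∀ v → ∃ λ x → done (rest (s v)) ≡ just x
    all-done {s} progress v with done (rest (s v)) in eq
    ... | just x  = x , refl
    ... | nothing = contradiction (begin-strict
      2 ^ b                                                     <⟨ ^-monoʳ-< 2 (s≤s (s≤s z≤n)) (n<1+n b) ⟩
      2 ^ suc b                                                 ≡⟨ *-identityʳ (2 ^ suc b) ⟨
      2 ^ suc b * 1                                             ≡⟨ cong (λ x → 2 ^ suc b * ⟦ is-nothing x ⟧) eq ⟨
      2 ^ suc b * ⟦ is-nothing (done (rest (s v))) ⟧            ≤⟨ *-monoʳ-≤ (2 ^ suc b) (term≤∑ (λ v → ⟦ is-nothing (done (rest (s v))) ⟧) v) ⟩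
      2 ^ suc b * ∑ (λ v → ⟦ is-nothing (done (rest (s v))) ⟧)  ≤⟨ few ⟩
      2 ^ b                                                     ∎) (<-irrefl refl)
      where
      open ≤-Reasoning
      open Progress progress

-- Trees and names in the output

Unique-⊆-length : ∀ {A : Set} {xs ys : List A} → Unique xs → All (_∈ ys) xs → length xs ≤ length ys
Unique-⊆-length {xs = []} _ _ = z≤n
Unique-⊆-length {xs = x ∷ xs} (x∉ ∷ unique) (x∈ ∷ xs∈) with as , bs , refl ← ∈-∃++ x∈ = begin
  suc (length xs)                ≤⟨ s≤s (Unique-⊆-length unique (others x∉ xs∈)) ⟩
  suc (length (as ++ bs))        ≡⟨ cong suc (length-++ as) ⟩
  suc (length as + length bs)    ≡⟨ +-suc (length as) (length bs) ⟨
  length as + length (x ∷ bs)    ≡⟨ length-++ as ⟨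
  length (as ++ x ∷ bs)          ∎
  where
  open ≤-Reasoning
  others : ∀ {xs} → All (x ≢_) xs → All (_∈ as ++ x ∷ bs) xs → All (_∈ as ++ bs) xs
  others [] [] = []
  others (x≢y ∷ x∉) (y∈ ∷ ys∈) = other (∈-++⁻ as y∈) ∷ others x∉ ys∈
    where
    other : _ ⊎ _ → _
    other (inj₁ y∈as)         = ∈-++⁺ˡ y∈as
    other (inj₂ (here refl))  = contradiction refl x≢y
    other (inj₂ (there y∈bs)) = ∈-++⁺ʳ as y∈bs

module _ {V : Set} {E : Rel V 0ℓ} where

  within-weaken : ∀ {m n u v} → m ≤ n → Within E m u v → Within E n u v
  within-weaken _         stop        = stop
  within-weaken (s≤s m≤n) (step e es) = step e (within-weaken m≤n es)

  within-trans : ∀ {m n u v w} → Within E m u v → Within E n v w → Within E (m + n) u w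
  within-trans {m} {n} stop     es′ = within-weaken (m≤n+m n m) es′
  within-trans (step e es)      es′ = step e (within-trans es es′)

  within-snoc : ∀ {n u v w} → Within E n u v → E v w → Within E (suc n) u w
  within-snoc {n} {u} {v} {w} es e = subst (λ k → Within E k u w) (+-comm n 1) (within-trans es (step e stop))

  within-map : ∀ {F : Rel V 0ℓ} {n u v} → (∀ {x y} → E x y → F x y) → Within E n u v → Within F n u v
  within-map f stop        = stop
  within-map f (step e es) = step (f e) (within-map f es)

  within-star : ∀ {n u v} → Within E n u v → Star E u v
  within-star stop        = ε
  within-star (step e es) = e ◅ within-star es

-- On a closed walk that never turns back at once, a step down is only followed
-- by steps down; so a step down raises the height forever, and without such a
-- step the height only falls.
module Acyclicity {V : Set} (E Up : Rel V 0ℓ) (height : V → ℕ)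
  (E⇒ : ∀ {u v} → E u v → Up u v ⊎ Up v u)
  (lower : ∀ {u v} → Up u v → height v < height u)
  (functional : ∀ {u v w} → Up u v → Up u w → v ≡ w) where

  data NonBacktracking : List V → Set where
    pair : ∀ {x y} → NonBacktracking (x ∷ y ∷ [])
    _∷_  : ∀ {x y z l} → x ≢ z → NonBacktracking (y ∷ z ∷ l) → NonBacktracking (x ∷ y ∷ z ∷ l)

  lastOf : V → List V → V
  lastOf y []       = y
  lastOf y (a ∷ ys) = lastOf a ys

  lastOf-∈ : ∀ y ys → lastOf y ys ∈ y ∷ ys
  lastOf-∈ y []       = here refl
  lastOf-∈ y (a ∷ ys) = there (lastOf-∈ a ys)

  downwards : ∀ {x} y ys {z} → Linked E (y ∷ ys ++ [ z ]) → NonBacktracking (x ∷ y ∷ ys ++ [ z ]) →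
              Up y x → height x < height z × Up z (lastOf y ys)
  downwards y [] (e ∷ _) (x≢z ∷ _) yx with E⇒ e
  ... | inj₁ yz = contradiction (functional yx yz) x≢z
  ... | inj₂ zy = <-trans (lower yx) (lower zy) , zy
  downwards y (a ∷ ys) (e ∷ es) (x≢a ∷ nb) yx with E⇒ e
  ... | inj₁ ya = contradiction (functional yx ya) x≢a
  ... | inj₂ ay with lt , up ← downwards a ys es nb ay = <-trans (lower yx) lt , up

  walk : ∀ {x} y ys {z} → Linked E (x ∷ y ∷ ys ++ [ z ]) → NonBacktracking (x ∷ y ∷ ys ++ [ z ]) →
         Up z (lastOf y ys) ⊎ height z < height x
  walk y ys (e ∷ es) nb with E⇒ e
  walk y ys (e ∷ es) nb | inj₂ yx = inj₁ (proj₂ (downwards y ys es nb yx))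
  walk y [] (_ ∷ e ∷ _) nb | inj₁ xy with E⇒ e
  ... | inj₁ yz = inj₂ (<-trans (lower yz) (lower xy))
  ... | inj₂ zy = inj₁ zy
  walk y (a ∷ ys) (_ ∷ es) (_ ∷ nb) | inj₁ xy with walk a ys es nb
  ... | inj₁ up = inj₁ up
  ... | inj₂ lt = inj₂ (<-trans lt (lower xy))

  nonBacktracking : ∀ {a c} l {z} → Unique (a ∷ c ∷ l) → All (z ≢_) (a ∷ c ∷ l) →
                    NonBacktracking (a ∷ c ∷ l ++ [ z ])
  nonBacktracking []      _ (z≢a ∷ _) = (z≢a ∘ sym) ∷ pair
  nonBacktracking (d ∷ l) ((_ ∷ a≢d ∷ _) ∷ unique) (_ ∷ z∉) = a≢d ∷ nonBacktracking l unique z∉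

  acyclic : Acyclic E
  acyclic x (y ∷ [])      (s≤s ()) _ _
  acyclic x (y ∷ c ∷ l) _ (x∉@(_ ∷ x≢c ∷ _) ∷ unique@(y∉ ∷ _)) (e ∷ es) 
    with walk y (c ∷ l) (e ∷ es) (x≢c ∷ nonBacktracking l unique x∉) | E⇒ e
  ... | inj₂ lt | _       = <-irrefl refl lt
  ... | inj₁ _  | inj₂ yx = <-irrefl refl (proj₁ (downwards y (c ∷ l) es (x≢c ∷ nonBacktracking l unique x∉) yx))
  -- Both neighbours of `x` on the cycle would be its parent, but `y` does not recur as the last
  -- vertex.
  ... | inj₁ xl | inj₁ xy = All.lookup y∉ (lastOf-∈ c l) (functional xy xl)

code : ∀ {b} → Id b → ℕ
code []          = 0
code (false ∷ v) = 2 * code v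
code (true ∷ v)  = suc (2 * code v)

code-injective : ∀ {b} {v w : Id b} → code v ≡ code w → v ≡ w
code-injective {v = []}        {[]}        _  = refl
code-injective {v = false ∷ v} {false ∷ w} eq = cong (false ∷_) (code-injective (*-cancelˡ-≡ (code v) (code w) 2 eq))
code-injective {v = true ∷ v}  {true ∷ w}  eq = cong (true ∷_) (code-injective (*-cancelˡ-≡ (code v) (code w) 2 (suc-injective eq)))
code-injective {v = false ∷ v} {true ∷ w}  eq = contradiction eq (even≢odd (code v) (code w))
code-injective {v = true ∷ v}  {false ∷ w} eq = contradiction (sym eq) (even≢odd (code w) (code v))

-- In binary, `κ` is the number of trailing ones and the code of `w` follows a separating zero. The
-- colour is part of the name because a vertex that dies may be the root of another cluster in a
-- later class.
nameOf : ∀ {b} → ℕ → Id b → ℕ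
nameOf zero    w = 2 * code w
nameOf (suc κ) w = suc (2 * nameOf κ w)

nameOf-injective : ∀ {b} κ κ′ {w w′ : Id b} → nameOf κ w ≡ nameOf κ′ w′ → κ ≡ κ′ × w ≡ w′
nameOf-injective zero    zero     {w} {w′} eq = refl , code-injective (*-cancelˡ-≡ (code w) (code w′) 2 eq)
nameOf-injective (suc κ) (suc κ′) {w} {w′} eq
  with refl , w≡ ← nameOf-injective κ κ′ {w} {w′} (*-cancelˡ-≡ _ _ 2 (suc-injective eq)) = refl , w≡
nameOf-injective zero    (suc κ′) {w} {w′} eq = contradiction eq (even≢odd (code w) (nameOf κ′ w′))
nameOf-injective (suc κ) zero     {w} {w′} eq = contradiction (sym eq) (even≢odd (code w′) (nameOf κ w))

ids : ∀ b → List (Id b)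
ids zero    = [] ∷ []
ids (suc b) = map (false ∷_) (ids b) ++ map (true ∷_) (ids b)

∈-ids : ∀ {b} (v : Id b) → v ∈ ids b
∈-ids []          = here refl
∈-ids (false ∷ v) = ∈-++⁺ˡ (∈-map⁺ _ (∈-ids v))
∈-ids (true ∷ v)  = ∈-++⁺ʳ _ (∈-map⁺ _ (∈-ids v))

module Outputs (b R M : ℕ) where
  open Colouring b R M using (W; S; Store)

  treeNeighbour : Snapshot b → Id b → Id b → Bool
  treeNeighbour σ w c = isEq (maybe′ parent nothing (entryOf (tree σ) w)) c ∨ is-just (kid (tree σ) c w)

  treeNeighbours : Snapshot b → Id b → List (Id b)
  treeNeighbours σ w = filter (λ c → T? (treeNeighbour σ w c)) (ids b)

  include : ∀ {A : Set} → Maybe (Entry b) → Bool → A → List A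
  include (just _) true x = [ x ]
  include _        _    _ = []

  ∈-include⁻ : ∀ {A : Set} {y u} {x x′ : A} → x′ ∈ include y u x → (∃ λ e → y ≡ just e) × u ≡ true × x′ ≡ x
  ∈-include⁻ {y = just e} {true} (here refl) = (e , refl) , refl , refl

  ∈-include⁺ : ∀ {A : Set} {y u e} {x : A} → y ≡ just e → u ≡ true → x ∈ include y u x
  ∈-include⁺ refl refl = here refl

  treeAtSlot : ℕ → Snapshot b → ℕ → List (ℕ × List (Id b))
  treeAtSlot κ σ j = include (entryOf (tree σ) w) (used σ w) (nameOf κ w , treeNeighbours σ w)
    where w = treeAt (tree σ) j

  record Listed (C : ℕ) (σ : ℕ → Snapshot b) (c : ℕ) (is : List (Id b)) : Set where
    field
      {κ}    : ℕ
      {w}    : Id b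
      {j}    : ℕ
      {e}    : Entry b
      κ<C    : κ < C
      j<W    : j < W
      c≡     : c ≡ nameOf κ w
      is≡    : is ≡ treeNeighbours (σ κ) w
      w≡     : treeAt (tree (σ κ)) j ≡ w
      entry≡ : entryOf (tree (σ κ)) w ≡ just e
      used≡  : used (σ κ) w ≡ true

  abstract
    treesOf : ℕ → (ℕ → Snapshot b) → List (ℕ × List (Id b))
    treesOf C σ = concatMap (λ κ → concatMap (treeAtSlot κ (σ κ)) (upTo W)) (upTo C)

    listed : ∀ {C σ c is} → (c , is) ∈ treesOf C σ → Listed C σ c is
    listed {C} {σ} c∈ with find (∈-concatMap⁻ (λ κ → concatMap (treeAtSlot κ (σ κ)) (upTo W)) c∈)
    ... | κ , κ∈ , c∈κ with find (∈-concatMap⁻ (treeAtSlot κ (σ κ)) c∈κ)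
    ...   | j , j∈ , c∈j with (e , eq) , us , refl ← ∈-include⁻ c∈j = record
      { κ<C = ∈-upTo⁻ κ∈ ; j<W = ∈-upTo⁻ j∈ ; c≡ = refl ; is≡ = refl ; w≡ = refl ; entry≡ = eq ; used≡ = us }

    unlisted : ∀ {C σ κ w e} → κ < C → slot e < W → treeAt (tree (σ κ)) (slot e) ≡ w →
               entryOf (tree (σ κ)) w ≡ just e → used (σ κ) w ≡ true →
               (nameOf κ w , treeNeighbours (σ κ) w) ∈ treesOf C σ
    unlisted {C} {σ} {κ} {_} {e} κ<C j<W refl eq us =
      ∈-concatMap⁺ (λ κ → concatMap (treeAtSlot κ (σ κ)) (upTo W)) (lose (∈-upTo⁺ κ<C)
        (∈-concatMap⁺ (treeAtSlot κ (σ κ)) (lose (∈-upTo⁺ j<W) (∈-include⁺ eq us))))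

  result : ℕ → Id b → Store → Output b
  result C i m = record
    { cluster = maybe′ (λ (κ , w) → nameOf κ w) 0 (done (rest m))
    ; colour  = maybe′ proj₁ 0 (done (rest m))
    ; trees   = treesOf C (archive (rest m))
    }

-- The decomposition and its Steiner trees

module Final {n b : ℕ} (G : Graph n) (ident : Fin n → Id b) (injective : Injective _≡_ _≡_ ident)
             (R M : ℕ) .{{_ : NonZero M}} (M≡ : M ≡ 6 * (3 * R + 2)) (large : 2 * ((3 * R + 2) * 2 ^ b * 4 ^ b) < 2 ^ R) where
  open Graph G using (Adj)
  open IdGraph G ident injective
  open Colouring b R M using (W; S; Store)
  open Programs b R M
  open ProgramCorrect adj adj-sym M≡ large
  open Outputs b R M
  open Forests {b} W adj

  module _ (C : ℕ) (s : Id b → Store) (progress : Progress C s)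
           (finished : ∀ v → ∃ λ x → done (rest (s v)) ≡ just x) where
    open Progress progress

    out : Fin n → Output b
    out v = result C (ident v) (s (ident v))

    open Decomposition G ident out renaming (cluster to clusterOf; colour to colourOf)

    σ : ℕ → Id b → Snapshot b
    σ κ v = archive (rest (s v)) κ

    record Home (v : Fin n) : Set where
      field
        {κ} : ℕ
        {w} : Id b
        κ<C      : κ < C
        final≡   : final (σ κ (ident v)) ≡ just w
        cluster≡ : clusterOf v ≡ nameOf κ w
        colour≡  : colourOf v ≡ κ

    home : ∀ v → Home v
    home v with (κ , w) , eq ← finished (ident v) = record
      { κ<C      = proj₁ (done⇒ {ident v} eq)
      ; final≡   = proj₂ (done⇒ {ident v} eq)
      ; cluster≡ = cong (maybe′ (λ (κ , w) → nameOf κ w) 0) eq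
      ; colour≡  = cong (maybe′ proj₁ 0) eq
      }

    same-home : ∀ {u v} → clusterOf u ≡ clusterOf v → Home.κ (home u) ≡ Home.κ (home v) × Home.w (home u) ≡ Home.w (home v)
    same-home {u} {v} eq = nameOf-injective _ _ (trans (sym (Home.cluster≡ (home u))) (trans eq (Home.cluster≡ (home v))))

    module Tree {κ : ℕ} {w x : Id b} (κ<C : κ < C) (inhabited : final (σ κ x) ≡ just w) where
      open Coloured (coloured κ<C) using (forest; used⇐)
      open Forest forest

      c : ℕ
      c = nameOf κ w

      position : Fin n → Maybe (Entry b)
      position u = entryOf (tree (σ κ (ident u))) w

      Up : Fin n → Fin n → Set
      Up u v = ∃ λ j → ∃ λ t → position u ≡ just (entry j (just (ident v)) t)

      height : Fin n → ℕ
      height u = maybe′ time 0 (position u)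

      vertex⇐ : ∀ {u e} → position u ≡ just e → TreeVertex c u
      vertex⇐ eq = _ , unlisted {C} {λ κ → σ κ _} κ<C (slot-bound eq) (slot-tree eq) eq (used⇐ eq inhabited)

      here-listed : ∀ {u is} → Listed C (λ κ → σ κ (ident u)) c is →
                    (∃ λ e → position u ≡ just e) × is ≡ treeNeighbours (σ κ (ident u)) w
      here-listed {u} {is} l =
        subst₂ (λ κ w → (∃ λ e → entryOf (tree (σ κ (ident u))) w ≡ just e) × is ≡ treeNeighbours (σ κ (ident u)) w)
          (proj₁ names) (proj₂ names) ((Listed.e l , Listed.entry≡ l) , Listed.is≡ l)
        where
        names : Listed.κ l ≡ κ × Listed.w l ≡ w
        names = nameOf-injective (Listed.κ l) κ (sym (Listed.c≡ l))

      vertex⇒ : ∀ {u} → TreeVertex c u → ∃ λ e → position u ≡ just e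
      vertex⇒ {u} (_ , c∈) = proj₁ (here-listed {u} (listed {C} {λ κ → σ κ (ident u)} c∈))

      Up-adj : ∀ {u v} → Up u v → Adj u v
      Up-adj (_ , _ , eq) with placed eq
      ... | child _ uv _ _ _ _ = adj⇒Adj uv

      lower : ∀ {u v} → Up u v → height v < height u
      lower (_ , _ , eq) rewrite eq with placed eq
      ... | child _ _ eq′ t< _ _ rewrite eq′ = t<

      functional : ∀ {u v v′} → Up u v → Up u v′ → v ≡ v′
      functional (_ , _ , eq) (_ , _ , eq′) =
        injective (just-injective (cong (maybe′ parent nothing) (trans (sym eq) eq′)))

      edge⇒ : ∀ {u v} → TreeEdge c u v → Up u v ⊎ Up v u
      edge⇒ {u} {v} (is , c∈ , v∈) = split (Equivalence.to T-∨ (proj₂ (∈-filter⁻ (λ i → T? (treeNeighbour (σ κ (ident u)) w i)) {xs = ids b}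
          (subst (ident v ∈_) (proj₂ (here-listed {u} (listed {C} {λ κ → σ κ (ident u)} c∈))) v∈))))
        where
        up : ∀ y → position u ≡ y → T (isEq (maybe′ parent nothing y) (ident v)) → Up u v
        up (just (entry j (just p) t)) eq isP = j , t , subst (λ p → position u ≡ just (entry j (just p) t)) (==⇒≡ {v = p} (Equivalence.to T-≡ isP)) eq
        down : ∀ y → kid (tree (σ κ (ident u))) (ident v) w ≡ y → T (is-just y) → Up v u
        down (just (j , t)) eq _ = j , t , kid-entry eq
        split : T (isEq (maybe′ parent nothing (position u)) (ident v)) ⊎ T (is-just (kid (tree (σ κ (ident u))) (ident v) w)) → Up u v ⊎ Up v u
        split (inj₁ isP) = inj₁ (up (position u) refl isP)
        split (inj₂ isK) = inj₂ (down (kid (tree (σ κ (ident u))) (ident v) w) refl isK)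

      listed-edge : ∀ {u v e} → position u ≡ just e → treeNeighbour (σ κ (ident u)) w (ident v) ≡ true → TreeEdge c u v
      listed-edge {u} {v} eq nb = _ , proj₂ (vertex⇐ {u} eq) ,
        ∈-filter⁺ (λ i → T? (treeNeighbour (σ κ (ident u)) w i)) (∈-ids (ident v)) (Equivalence.from T-≡ nb)

      edge-up : ∀ {u v} → Up u v → TreeEdge c u v
      edge-up {u} {v} (j , t , eq) = listed-edge {u} {v} eq (nb eq)
        where
        nb : position u ≡ just (entry j (just (ident v)) t) → treeNeighbour (σ κ (ident u)) w (ident v) ≡ true
        nb eq rewrite eq | ==-refl (ident v) = refl

      edge-down : ∀ {u v} → Up u v → TreeEdge c v u
      edge-down {u} {v} (j , t , eq) with placed eq
      ... | child _ _ eq′ _ isK _ = listed-edge {v} {u} eq′ (trans (cong (λ k → isEq (maybe′ parent nothing (position v)) (ident u) ∨ is-just k) isK) (∨-zeroʳ _))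

      -- Times fall towards the root, so the time of a vertex bounds its depth. Every parent on the
      -- way is the identifier of a node, since `adj` relates only such identifiers.
      climb : ∀ m {u e} → position u ≡ just e → time e ≤ m →
              ∃ λ r → ident r ≡ w × Within (TreeEdge c) m u r × Within (TreeEdge c) m r u
      climb m eq t≤m with placed eq
      climb m       eq t≤m | root u≡w = _ , u≡w , stop , stop
      climb zero    eq t≤m | child _ _ _ t< _ _ = contradiction (≤-trans t< t≤m) λ ()
      climb (suc m) {u} eq t≤m | child _ up eq′ t< _ _ with _ , _ , p , _ , refl ← adj⇒ up
        with r , r≡w , forth , back ← climb m {p} eq′ (s≤s⁻¹ (≤-trans t< t≤m)) =
        r , r≡w , step (edge-up {u} {p} (_ , _ , eq)) forth , within-snoc back (edge-down {u} {p} (_ , _ , eq))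

      edge-adj : ∀ {u v} → TreeEdge c u v → Adj u v
      edge-adj {u} {v} e with edge⇒ {u} {v} e
      ... | inj₁ uv = Up-adj {u} {v} uv
      ... | inj₂ vu = Graph.sym G (Up-adj {v} {u} vu)

      edge-sym : ∀ {u v} → TreeEdge c u v → TreeEdge c v u
      edge-sym {u} {v} e with edge⇒ {u} {v} e
      ... | inj₁ uv = edge-down {u} {v} uv
      ... | inj₂ vu = edge-up {v} {u} vu

      edge-start : ∀ {u v} → TreeEdge c u v → TreeVertex c u
      edge-start (is , c∈ , _) = is , c∈

      climbed : ∀ {u e} → position u ≡ just e → ∃ λ r → ident r ≡ w × Within (TreeEdge c) S u r × Within (TreeEdge c) S r u
      climbed eq = climb S eq (time-bound eq)

      connected : ∀ {u v e f} → position u ≡ just e → position v ≡ just f → Within (TreeEdge c) (S + S) u v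
      connected {u} {v} eq eq′ with r , r≡w , forth , _ ← climbed {u} eq | r′ , r′≡w , _ , back ← climbed {v} eq′
        with refl ← injective (trans r≡w (sym r′≡w)) = within-trans forth back

      root-exists : ∀ {u e} → position u ≡ just e → ∃ λ r → ident r ≡ w × ∃ λ e → position r ≡ just e
      root-exists {u} eq with r , refl , _ ← climbed {u} eq = r , refl , ForestProperties.root-entry W adj forest eq

      steiner : ∀ {u v e} → ident u ≡ x → position v ≡ just e → IsSteinerTree c S
      steiner {u} {v} u≡x eq = record
        { subtree      = record
          { edges     = λ {u} {v} → edge-adj {u} {v}
          ; endpoints = λ {u} {v} e → edge-start {u} {v} e , edge-start {v} {u} (edge-sym {u} {v} e)
          ; symmetric = λ {u} {v} → edge-sym {u} {v}
          ; nonempty  = v , vertex⇐ {v} eq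
          ; connected = λ {u} {v} u∈ v∈ → within-star (connected {u} {v} (proj₂ (vertex⇒ {u} u∈)) (proj₂ (vertex⇒ {v} v∈)))
          ; acyclic   = Acyclicity.acyclic (TreeEdge c) Up height (λ {u} {v} → edge⇒ {u} {v})
                          (λ {u} {v} → lower {u} {v}) (λ {u} {v} {w} → functional {u} {v} {w})
          }
        ; terminals    = λ {v} cl → terminal v cl
        ; radius-bound = r , vertex⇐ {r} (proj₂ (proj₂ (proj₂ top))) , λ {v} v∈ → reach v (vertex⇒ {v} v∈)
        }
        where
        top = root-exists {v} eq
        r = proj₁ top
        terminal : ∀ v → clusterOf v ≡ c → TreeVertex c v
        terminal v cl with refl , refl ← nameOf-injective κ (Home.κ (home v)) (trans (sym cl) (Home.cluster≡ (home v))) =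
          vertex⇐ {v} (proj₂ (Coloured.home (coloured κ<C) {ident v} (Home.final≡ (home v))))
        reach : ∀ v → (∃ λ e → position v ≡ just e) → Within (TreeEdge c) S r v
        reach v (_ , eq) with r′ , r′≡w , _ , back ← climbed {v} eq
          with refl ← injective (trans (proj₁ (proj₂ top)) (sym r′≡w)) = back

    homePosition : ∀ v → ∃ λ e → entryOf (tree (σ (Home.κ (home v)) (ident v))) (Home.w (home v)) ≡ just e
    homePosition v = Coloured.home (coloured (Home.κ<C (home v))) {ident v} (Home.final≡ (home v))

    isNetworkDecomposition : IsNetworkDecomposition C (S + S)
    isNetworkDecomposition = record
      { colour-bound   = λ v → subst (_< C) (sym (Home.colour≡ (home v))) (Home.κ<C (home v))
      ; cluster-colour = λ {u} {v} eq → trans (Home.colour≡ (home u)) (trans (proj₁ (same-home {u} {v} eq)) (sym (Home.colour≡ (home v))))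
      ; proper         = λ {u} {v} uv cl≢ col≡ → cl≢ (proper′ u v uv (trans (sym (Home.colour≡ (home u))) (trans col≡ (Home.colour≡ (home v)))))
      ; weak-diameter  = λ {u} {v} → diameter u v
      }
      where
      proper′ : ∀ u v → Adj u v → Home.κ (home u) ≡ Home.κ (home v) → clusterOf u ≡ clusterOf v
      proper′ u v uv κ≡ = trans (Home.cluster≡ (home u)) (trans (cong₂ nameOf κ≡ w≡) (sym (Home.cluster≡ (home v))))
        where
        w≡ : Home.w (home u) ≡ Home.w (home v)
        w≡ = Coloured.separated (coloured (Home.κ<C (home v))) {ident u} {ident v} (Adj⇒adj uv)
               (subst (λ κ → final (σ κ (ident u)) ≡ just (Home.w (home u))) κ≡ (Home.final≡ (home u)))
               (Home.final≡ (home v))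
      diameter : ∀ u v → clusterOf u ≡ clusterOf v → Within Adj (S + S) u v
      diameter u v eq = within-map (λ {x} {y} → T.edge-adj {x} {y})
        (T.connected {u} {v}
          (subst₂ (λ κ w → entryOf (tree (σ κ (ident u))) w ≡ just (proj₁ (homePosition u)))
            (proj₁ (same-home {u} {v} eq)) (proj₂ (same-home {u} {v} eq)) (proj₂ (homePosition u)))
          (proj₂ (homePosition v)))
        where module T = Tree {Home.κ (home v)} {Home.w (home v)} {ident v} (Home.κ<C (home v)) (Home.final≡ (home v))

    hasSteinerTrees : HasSteinerTrees S W
    hasSteinerTrees = record
      { tree               = λ v → subst (λ c → IsSteinerTree c S) (sym (Home.cluster≡ (home v)))
          (Tree.steiner {x = ident v} (Home.κ<C (home v)) (Home.final≡ (home v)) {v} {v} refl (proj₂ (homePosition v)))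
      ; only-clusters      = λ {c} {v} c∈ → occurs v c∈
      ; multiplicity-bound = few-trees
      }
      where
      -- The survivor `x` behind the flag is at first only an identifier. If it is a child, its
      -- adjacency to the parent makes it the name of a node; if it is the root, the climb from `v`
      -- ends at a node of that name.
      occurs : ∀ {c} v → TreeVertex c v → ∃ (Terminal c)
      occurs {c} v (_ , c∈) with l ← listed {C} {λ κ → σ κ (ident v)} c∈
        with x , fx ← Coloured.used⇒ (coloured (Listed.κ<C l)) {ident v} (Listed.entry≡ l) (Listed.used≡ l) = node (placed pos)
        where
        open Coloured (coloured (Listed.κ<C l)) using (forest)
        open Forest forest using (placed)
        pos : entryOf (tree (σ (Listed.κ l) x)) (Listed.w l) ≡ just _
        pos = proj₂ (Coloured.home (coloured (Listed.κ<C l)) {x} fx)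
        terminal : ∀ {u} → ident u ≡ x → Terminal c u
        terminal refl = trans (cong (maybe′ (λ (κ , w) → nameOf κ w) 0) (done⇐ {x} (Listed.κ<C l) fx)) (sym (Listed.c≡ l))
        node : ∀ {e} → Placed (λ v → tree (σ (Listed.κ l) v)) x (Listed.w l) e → ∃ (Terminal c)
        node (child _ xp _ _ _ _) with u , u≡x , _ ← adj⇒ xp = u , terminal u≡x
        node (root x≡w) with r , r≡w , _ ← Tree.root-exists {x = x} (Listed.κ<C l) fx {v} (Listed.entry≡ l) = r , terminal (trans r≡w (sym x≡w))

      -- In one colour, every tree listed at `v` occupies one of the `W` slots of `v`, so the
      -- pigeonhole principle applies.
      few-trees : ∀ v κ → AtMost W λ c → (∃ λ u → Terminal c u × colourOf u ≡ κ) × TreeVertex c v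
      few-trees v κ xs unique all = begin
        length xs                       ≤⟨ Unique-⊆-length unique (All.map slotted all) ⟩
        length (map slotName (upTo W))  ≡⟨ length-map slotName (upTo W) ⟩
        length (upTo W)                 ≡⟨ length-upTo W ⟩
        W                               ∎
        where
        open ≤-Reasoning
        slotName : ℕ → ℕ
        slotName j = nameOf κ (treeAt (tree (σ κ (ident v))) j)
        slotted : ∀ {c} → (∃ λ u → Terminal c u × colourOf u ≡ κ) × TreeVertex c v → c ∈ map slotName (upTo W)
        slotted {c} ((u , cl , col) , _ , c∈) =
          subst (_∈ map slotName (upTo W))
            (subst (λ κ → nameOf κ (treeAt (tree (σ κ (ident v))) (Listed.j l)) ≡ c) κ≡
              (trans (cong (nameOf (Listed.κ l)) (Listed.w≡ l)) (sym (Listed.c≡ l))))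
            (∈-map⁺ slotName (∈-upTo⁺ (Listed.j<W l)))
          where
          l = listed {C} {λ κ → σ κ (ident v)} c∈
          κ≡ : Listed.κ l ≡ κ
          κ≡ = trans (sym (proj₁ (nameOf-injective (Home.κ (home u)) (Listed.κ l)
                 (trans (sym (Home.cluster≡ (home u))) (trans cl (Listed.c≡ l))))))
               (trans (sym (Home.colour≡ (home u))) col)

-- Complexity

-- All parameters of the algorithm are functions of `b`. The base `suc b` is positive, so exponents
-- can be raised and constants are covered at `b = 0` as well.
record Poly (d : ℕ) (f : ℕ → ℕ) : Set where
  constructor poly
  field
    constant : ℕ
    bound    : ∀ b → f b ≤ constant * suc b ^ d

poly-cong : ∀ {d f g} → (∀ b → f b ≡ g b) → Poly d f → Poly d g
poly-cong {d} f≗g (poly K f≤) = poly K λ b → subst (_≤ K * suc b ^ d) (f≗g b) (f≤ b)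

poly-const : ∀ d k → Poly d (λ _ → k)
poly-const d k = poly k λ b → ≤-trans (≤-reflexive (sym (*-identityʳ k))) (*-monoʳ-≤ k (m^n>0 (suc b) d))

poly-suc : Poly 1 suc
poly-suc = poly 1 λ b → ≤-reflexive (sym (trans (*-identityˡ _) (*-identityʳ (suc b))))

poly-+ : ∀ {d f g} → Poly d f → Poly d g → Poly d (λ b → f b + g b)
poly-+ {d} (poly K f≤) (poly L g≤) = poly (K + L) λ b → ≤-trans (+-mono-≤ (f≤ b) (g≤ b)) (≤-reflexive (sym (*-distribʳ-+ (suc b ^ d) K L)))

poly-* : ∀ {d e f g} → Poly d f → Poly e g → Poly (d + e) (λ b → f b * g b)
poly-* {d} {e} (poly K f≤) (poly L g≤) = poly (K * L) λ b → ≤-trans (*-mono-≤ (f≤ b) (g≤ b)) (≤-reflexive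
  (trans (lemma K L (suc b ^ d) (suc b ^ e)) (cong (K * L *_) (sym (^-distribˡ-+-* (suc b) d e)))))
  where
  lemma : ∀ K L x y → K * x * (L * y) ≡ K * L * (x * y)
  lemma = solve-∀

poly-up : ∀ {d e f} → d ≤ e → Poly d f → Poly e f
poly-up d≤e (poly K f≤) = poly K λ b → ≤-trans (f≤ b) (*-monoʳ-≤ K (^-monoʳ-≤ (suc b) d≤e))

phaseCount stepCount : ℕ → ℕ
phaseCount b = 8 * suc b
stepCount b = 6 * (3 * phaseCount b + 2)

module Parameters (b : ℕ) where
  open Colouring b (phaseCount b) (stepCount b) public using (W; S)
  open Programs b (phaseCount b) (stepCount b) public using (countingRounds; colourClasses; length-colourClasses; blank)

packetBits roundCount diameter : ℕ → ℕ
packetBits b = 2 + (b + Parameters.W b)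
diameter b  = Parameters.S b + Parameters.S b
roundCount b    = length (Parameters.colourClasses b (suc b)) + 0

abstract
  R-poly : Poly 1 phaseCount
  R-poly = poly-* (poly-const 0 8) poly-suc

  W-poly : Poly 1 Parameters.W
  W-poly = poly-+ (poly-* (poly-const 0 3) R-poly) (poly-const 1 2)

  M-poly : Poly 1 stepCount
  M-poly = poly-* (poly-const 0 6) W-poly

  S-poly : Poly 2 Parameters.S
  S-poly = poly-* R-poly M-poly

  bandwidth-poly : Poly 1 packetBits
  bandwidth-poly = poly-cong (λ b → cong suc (sym (+-assoc 1 b (Parameters.W b))))
    (poly-+ (poly-const 1 1) (poly-+ poly-suc W-poly))

  diameter-poly : Poly 2 diameter
  diameter-poly = poly-+ S-poly S-poly

  counting-poly : Poly 2 Parameters.countingRounds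
  counting-poly = poly-+ (poly-const 2 2) (poly-+ (poly-+ S-poly (poly-up (s≤s z≤n) poly-suc)) S-poly)

  -- The exponent is 1 for the colours, 1 for the phases, 1 for the steps of a phase and 2 for the
  -- rounds of one count.
  rounds-poly : Poly 5 roundCount
  rounds-poly = poly-cong (λ b → sym (trans (+-identityʳ _) (Parameters.length-colourClasses b (suc b))))
    (poly-* poly-suc
      (poly-+ (poly-+ (poly-const 4 2)
                      (poly-* R-poly (poly-+ (poly-const 3 1) (poly-* M-poly (poly-+ (poly-const 2 3) counting-poly)))))
              (poly-up (s≤s (s≤s z≤n)) counting-poly)))

1+n≤2^n : ∀ n → suc n ≤ 2 ^ n
1+n≤2^n zero    = ≤-refl
1+n≤2^n (suc n) = ≤-trans (+-mono-≤ (m^n>0 2 n) (1+n≤2^n n)) (≤-reflexive (cong (2 ^ n +_) (sym (+-identityʳ (2 ^ n)))))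

-- As `3 * R + 2` is at most `2 ^ (b + 5)`, the left side is at most `2 ^ (4 * b + 6)`, while the
-- right side is `2 ^ (8 * b + 8)`.
phaseCount-large : ∀ b → 2 * ((3 * phaseCount b + 2) * 2 ^ b * 4 ^ b) < 2 ^ phaseCount b
phaseCount-large b = subst (λ y → 2 * ((3 * phaseCount b + 2) * 2 ^ b * y) < 2 ^ phaseCount b) (sym (^-*-assoc 2 2 b)) (begin-strict
  2 * ((3 * phaseCount b + 2) * 2 ^ b * 2 ^ (2 * b))  ≤⟨ *-monoʳ-≤ 2 (*-monoˡ-≤ (2 ^ (2 * b)) (*-monoˡ-≤ (2 ^ b) slots)) ⟩
  2 * (2 ^ 5 * 2 ^ b * 2 ^ b * 2 ^ (2 * b))   ≡⟨ cong (2 *_) (powers 5) ⟩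
  2 ^ suc (5 + b + b + 2 * b)                 <⟨ ^-monoʳ-< 2 (s≤s (s≤s z≤n)) {suc (5 + b + b + 2 * b)} {8 * suc b} exponent< ⟩
  2 ^ (8 * suc b)                             ∎)
  where
  open ≤-Reasoning
  linear : ∀ b → 3 * (8 * suc b) + 2 + (8 * b + 6) ≡ 32 * suc b
  linear = solve-∀
  exponent : ∀ b → suc (suc (5 + b + b + 2 * b)) + (1 + 4 * b) ≡ 8 * suc b
  exponent = solve-∀
  exponent< : suc (5 + b + b + 2 * b) < 8 * suc b
  exponent< = subst (suc (suc (5 + b + b + 2 * b)) ≤_) (exponent b) (m≤m+n (suc (suc (5 + b + b + 2 * b))) (1 + 4 * b))
  slots : 3 * phaseCount b + 2 ≤ 2 ^ 5 * 2 ^ b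
  slots = ≤-trans (subst (3 * phaseCount b + 2 ≤_) (linear b) (m≤m+n (3 * phaseCount b + 2) (8 * b + 6))) (*-monoʳ-≤ 32 (1+n≤2^n b))
  powers : ∀ a → 2 ^ a * 2 ^ b * 2 ^ b * 2 ^ (2 * b) ≡ 2 ^ (a + b + b + 2 * b)
  powers a = sym (trans (^-distribˡ-+-* 2 (a + b + b) (2 * b)) (cong (_* 2 ^ (2 * b))
    (trans (^-distribˡ-+-* 2 (a + b) b) (cong (_* 2 ^ b) (^-distribˡ-+-* 2 a b)))))

code<2^b : ∀ {b} (v : Id b) → code v < 2 ^ b
code<2^b []                = s≤s z≤n
code<2^b {suc b} (false ∷ v) = *-monoʳ-< 2 (code<2^b v)
code<2^b {suc b} (true ∷ v)  = ≤-trans (≤-reflexive (lemma (code v))) (*-monoʳ-≤ 2 (code<2^b v))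
  where
  lemma : ∀ x → suc (suc (2 * x)) ≡ 2 * suc x
  lemma = solve-∀

log≤1+b : ∀ {n b} (ident : Fin n → Id b) → Injective _≡_ _≡_ ident → log n ≤ suc b
log≤1+b {n} {b} ident injective = s≤s (subst (⌊log₂ n ⌋ ≤_) (⌊log₂[2^n]⌋≡n b)
  (⌊log₂⌋-mono-≤ (injective⇒≤ {f = λ v → fromℕ< (code<2^b (ident v))}
    λ {u} {v} eq → injective (code-injective (fromℕ<-injective _ _ (code<2^b (ident u)) (code<2^b (ident v)) eq)))))

module _ {n b : ℕ} {G : Graph n} {ident : Fin n → Id b} {out : Fin n → Output b} where
  open Decomposition G ident out

  decomposition-weaken : ∀ {C C′ D D′} → C ≤ C′ → D ≤ D′ → IsNetworkDecomposition C D → IsNetworkDecomposition C′ D′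
  decomposition-weaken C≤ D≤ d = record
    { colour-bound   = λ v → <-≤-trans (colour-bound v) C≤
    ; cluster-colour = λ {u} {v} → cluster-colour {u} {v}
    ; proper         = proper
    ; weak-diameter  = λ {u} {v} eq → within-weaken D≤ (weak-diameter {u} {v} eq)
    }
    where open IsNetworkDecomposition d

  steiner-weaken : ∀ {r r′ m m′} → r ≤ r′ → m ≤ m′ → HasSteinerTrees r m → HasSteinerTrees r′ m′
  steiner-weaken r≤ m≤ h = record
    { tree               = λ v → widen (HasSteinerTrees.tree h v)
    ; only-clusters      = λ {c} {v} → only-clusters {c} {v}
    ; multiplicity-bound = λ v κ xs unique all → ≤-trans (multiplicity-bound v κ xs unique all) m≤
    }
    where
    open HasSteinerTrees h using (only-clusters; multiplicity-bound)
    widen : ∀ {c} → IsSteinerTree c _ → IsSteinerTree c _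
    widen t = record
      { subtree      = subtree
      ; terminals    = λ {v} → terminals {v}
      ; radius-bound = proj₁ radius-bound , proj₁ (proj₂ radius-bound) , λ {v} v∈ → within-weaken r≤ (proj₂ (proj₂ radius-bound) {v} v∈)
      }
      where open IsSteinerTree t

algorithm : (b : ℕ) → Algorithm b (Output b)
algorithm b = program (Parameters.colourClasses b (suc b)) (λ _ → Parameters.blank b) (Outputs.result b (phaseCount b) (stepCount b) (suc b))

theorem2p1 :
    ∀ (β k : ℕ) →
    ∃ λ (A : (N b : ℕ) → Algorithm b (Output b)) →
    ∃ λ (K : ℕ) →
    ∀ (n N b : ℕ) → n ≤ N → N ≤ k * n ^ k → b ≤ β * log n →
    (G : Graph n) (ident : Fin n → Id b) → Injective _≡_ _≡_ ident →
    let open Algorithm (A N b) using (bandwidth)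
        open Execution (A N b) G ident using (AllFinish)
    in
    (log n ≤ K * bandwidth × bandwidth ≤ K * log n) ×
    (∃ λ t → ∃ λ out →
      t ≤ K * log n ^ 5 ×
      AllFinish t out ×
      Decomposition.IsNetworkDecomposition G ident out (K * log n) (K * log n ^ 2) ×
      Decomposition.HasSteinerTrees G ident out (K * log n ^ 2) (K * log n))
theorem2p1 β k = (λ _ b → algorithm b) , K , main
  where
  k₁ k₂ k₅ k₀ K : ℕ
  k₁ = Poly.constant bandwidth-poly
  k₂ = Poly.constant diameter-poly
  k₅ = Poly.constant rounds-poly
  -- One constant serves every bound. The summand 1 keeps `k₀` positive for the lower bound on the
  -- bandwidth, and the power of `suc β` in `K` converts `suc b ≤ suc β * log n` at the largest
  -- exponent.
  k₀ = 1 + k₁ + k₂ + k₅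
  K  = k₀ * suc β ^ 5

  main : ∀ (n N b : ℕ) → n ≤ N → N ≤ k * n ^ k → b ≤ β * log n →
    (G : Graph n) (ident : Fin n → Id b) → Injective _≡_ _≡_ ident →
    (log n ≤ K * packetBits b × packetBits b ≤ K * log n) ×
    (∃ λ t → ∃ λ out →
      t ≤ K * log n ^ 5 ×
      Execution.AllFinish (algorithm b) G ident t out ×
      Decomposition.IsNetworkDecomposition G ident out (K * log n) (K * log n ^ 2) ×
      Decomposition.HasSteinerTrees G ident out (K * log n ^ 2) (K * log n))
  main n N b _ _ b≤ G ident injective =
    (lower , bandwidth≤) , roundCount b , F.out (suc b) s progress finished ,
    scale 5 ≤-refl (Poly.bound rounds-poly b) k₅≤ ,
    program-finishes G ident injective (Parameters.colourClasses b (suc b)) (λ _ → Parameters.blank b) (Outputs.result b (phaseCount b) (stepCount b) (suc b)) ,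
    -- Both the `b + 1` colours and the multiplicity `W` of the trees are at most the packet length,
    -- so the bandwidth bound covers them.
    decomposition-weaken (≤-trans (≤-trans (s≤s (m≤m+n b _)) (n≤1+n _)) bandwidth≤) diameter≤ (F.isNetworkDecomposition (suc b) s progress finished) ,
    steiner-weaken (≤-trans (m≤m+n _ _) diameter≤) (≤-trans (≤-trans (m≤n+m _ b) (m≤n+m _ 2)) bandwidth≤) (F.hasSteinerTrees (suc b) s progress finished)
    where
    open IdGraph G ident injective
    module F = Final G ident injective (phaseCount b) (stepCount b) refl (phaseCount-large b)
    module P = Programs.ProgramCorrect b (phaseCount b) (stepCount b) adj adj-sym refl (phaseCount-large b)

    s : Id b → Colouring.Store b (phaseCount b) (stepCount b)
    s = Run.exec adj (Parameters.colourClasses b (suc b)) (λ _ → Parameters.blank b)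

    progress : P.Progress (suc b) s
    progress = subst (λ κ → P.Progress κ s) (+-identityʳ (suc b)) (P.colourClasses-correct (suc b))

    finished = P.all-done progress

    1+b≤ : suc b ≤ suc β * log n
    1+b≤ = +-mono-≤ {1} (s≤s z≤n) b≤

    scale : ∀ d {x j} → d ≤ 5 → x ≤ j * suc b ^ d → j ≤ k₀ → x ≤ K * log n ^ d
    scale d {x} {j} d≤5 x≤ j≤ = begin
      x                                    ≤⟨ x≤ ⟩
      j * suc b ^ d                        ≤⟨ *-mono-≤ j≤ (^-monoˡ-≤ d 1+b≤) ⟩
      k₀ * (suc β * log n) ^ d             ≡⟨ cong (k₀ *_) (^-distrib-* d) ⟩
      k₀ * (suc β ^ d * log n ^ d)         ≤⟨ *-monoʳ-≤ k₀ (*-monoˡ-≤ (log n ^ d) (^-monoʳ-≤ (suc β) d≤5)) ⟩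
      k₀ * (suc β ^ 5 * log n ^ d)         ≡⟨ *-assoc k₀ (suc β ^ 5) (log n ^ d) ⟨
      K * log n ^ d                        ∎
      where
      open ≤-Reasoning
      lemma : ∀ x y p q → (x * y) * (p * q) ≡ (x * p) * (y * q)
      lemma = solve-∀
      ^-distrib-* : ∀ d → (suc β * log n) ^ d ≡ suc β ^ d * log n ^ d
      ^-distrib-* zero    = refl
      ^-distrib-* (suc d) = trans (cong (suc β * log n *_) (^-distrib-* d)) (lemma (suc β) (log n) (suc β ^ d) (log n ^ d))

    k₅≤ : k₅ ≤ k₀
    k₅≤ = m≤n+m k₅ (1 + k₁ + k₂)

    k₂≤ : k₂ ≤ k₀
    k₂≤ = ≤-trans (m≤n+m k₂ (1 + k₁)) (m≤m+n _ k₅)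

    k₁≤ : k₁ ≤ k₀
    k₁≤ = ≤-trans (m≤n+m k₁ 1) (≤-trans (m≤m+n _ k₂) (m≤m+n _ k₅))

    diameter≤ : diameter b ≤ K * log n ^ 2
    diameter≤ = scale 2 (s≤s (s≤s z≤n)) (Poly.bound diameter-poly b) k₂≤

    bandwidth≤ : packetBits b ≤ K * log n
    bandwidth≤ = subst (λ x → packetBits b ≤ K * x) (*-identityʳ (log n)) (scale 1 (s≤s z≤n) (Poly.bound bandwidth-poly b) k₁≤)

    lower : log n ≤ K * packetBits b
    lower = ≤-trans (log≤1+b ident injective) (≤-trans (≤-trans (s≤s (m≤m+n b _)) (n≤1+n _))
      (≤-trans (≤-reflexive (sym (*-identityˡ _))) (*-monoˡ-≤ (packetBits b) (*-mono-≤ {1} {k₀} (s≤s z≤n) (m^n>0 (suc β) 5)))))
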